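{- Let $P$ be an oriented forest of $q$ virtual edges on vertices of $G$ (the virtual edges need not be physical edges of $G$). Let $D_P$ be its reduced incidence matrix after grounding $g$, and put $$Z_P=D_P^TK^{ -1}D_P,\qquad \mathcal L_P=Z_P^{ -1}.$$ For each spanning forest $F$ of $G$, let $H_F^P$ be the quotient virtual-port multigraph, $B_F^P=Q_FD_P$, and $\chi_F^P(S)=\det B_F^P[:,S]$. Then for all $A,B\subseteq E(P)$ with $|A|=|B|=r$, $$\det Z_P[A,B]=\frac{1}{\tau_c(G)}\sum_{F\in\mathcal F_{r+1}}\chi_F^P(A)\,\chi_F^P(B)\,w(F).$$ Let $$\Phi_P:=\sum_{\substack{F\in\mathcal F_{q+1}\\ E(P)\text{ is a spanning tree of }H_F^P}}w(F).$$ For $I,J\subseteq E(P)$ with $|I|=|J|=k$ and $r=q-k$, and for $F\in\mathcal F_{r+1}$, let $$\widehat\chi_F^P(I):=\det\begin{pmatrix}B_F^P \\ E_I^T\end{pmatrix}.$$ Then $$\det\mathcal L_P[I,J]=\frac{1}{\Phi_P}\sum_{F\in\mathcal F_{r+1}}\widehat\chi_F^P(I)\,\widehat\chi_F^P(J)\,w(F).$$ All coefficients ($\chi_F^P(A)\chi_F^P(B)$ and $\widehat\chi_F^P(I)\widehat\chi_F^P(J)$) are $0$ or $\pm1$, and a completed determinant $\widehat\chi_F^P(I)$ is nonzero exactly when its complementary virtual-edge set $E(P)\setminus I$ is a spanning tree of $H_F^P$.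
   Context: Network. $G=(V,E)$ is a finite connected simple undirected graph; each edge $e$ has a conductance $c_e\in\mathbb R_{>0}$. The weighted Laplacian $L_c$ is the $V\times V$ matrix with $(L_c)_{uu}=\sum_{e\ni u}c_e$, $(L_c)_{uv}=-c_{uv}$ if $uv\in E$, and $0$ otherwise. Fix a ground vertex $g\in V$ and let $K=L_c[V\setminus\{g\},V\setminus\{g\}]$. A spanning forest $F$ of $G$ is an acyclic subgraph with vertex set $V$ (isolated vertices allowed); $w(F)=\prod_{e\in F}c_e$; $\mathcal F_m$ is the set of spanning forests of $G$ with exactly $m$ connected components. $\tau_c(G)=\sum_T\prod_{e\in T}c_e$, the sum over spanning trees $T$ of $G$. Matrix conventions. $A[S,T]$ is the submatrix with rows $S$ and columns $T$ in inherited order; $A[:,T]$ keeps all rows; empty determinants equal $1$. Virtual dipoles. $P$ is an acyclic graph whose vertices are vertices of $G$, with $q$ oriented edges listed in a fixed order $E(P)$; its edges are arbitrary vertex pairs of $G$. With $(e_v)$ the standard basis of $\mathbb R^{V\setminus\{g\}}$ and $e_g=0$, the reduced incidence matrix $D_P$ has, for each virtual edge oriented from $u$ to $v$, the column $e_v-e_u$, in the fixed order. Quotients. For a spanning forest $F$ of $G$ with $s\ge1$ components, let $C_0(F)$ be the component containing $g$ and order the others as $C_1(F),\dots,C_{s-1}(F)$. The multigraph $H_F^P$ has the components of $F$ as vertices, and each virtual edge from $u$ to $v$ gives a directed edge from the component containing $u$ to the component containing $v$ (a loop if these coincide). $Q_F$ is the $(s-1)\times(|V|-1)$ matrix with columns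 indexed by $V\setminus\{g\}$ and $(Q_F)_{a,v}=1$ if $v\in C_a(F)$, $0$ otherwise ($1\le a\le s-1$). $\chi_F^P(S)$ is defined for $S\subseteq E(P)$ with $|S|=s-1$, with $\chi_F^P(\varnothing)=1$ when $s=1$. For $I\subseteq E(P)$ with $|I|=k$, $E_I$ is the $q\times k$ matrix whose columns are the standard basis vectors of $\mathbb R^{E(P)}$ indexed by $I$, in the inherited virtual-edge order. -}

module Defs where

open import Algebra.Bundles using (CommutativeRing)
open import Algebra.Structures using (IsMagma; IsSemigroup; IsMonoid; IsGroup; IsRing)
open import Data.Bool.Base using (true; false; if_then_else_)
open import Data.Fin.Base using (Fin; zero; suc; toℕ; punchIn; cast)
open import Data.Fin.Properties using (_≟_; any?; all?; injective⇒≤)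
open import Data.List.Base as List using (List; []; _∷_; length)
import Data.List.Properties as List
open import Data.List.Membership.Propositional.Properties using (∈-lookup)
import Data.List.Relation.Unary.All as All
import Data.List.Relation.Unary.AllPairs.Core as AllPairs
open import Data.List.Relation.Unary.Unique.DecPropositional using (unique?)
open import Data.List.Relation.Unary.Unique.Propositional using (Unique)
open import Data.Nat.Base as ℕ using (ℕ; zero; suc; _⊔_)
import Data.Nat.Properties as ℕₚ
open import Data.Product using (∃; _×_; _,_; proj₁; proj₂; uncurry)
open import Data.Product.Properties using (≡-dec)
open import Data.Rational.Base as Rat using (ℚ; 0ℚ; 1ℚ; ½; Positive; NonZero)
import Data.Rational.Properties as ℚₚ
open import Data.Rational.Solver using (module +-*-Solver)
open import Data.Sum.Base using (_⊎_; inj₁; inj₂)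
open import Data.Vec.Base as Vec using (Vec; []; _∷_; here; there)
open import Data.Vec.Functional using (_++_)
open import Data.Vec.Properties using (lookup∘tabulate)
open import Function.Base using (_∘_; id)
open import Function.Bundles using (_⇔_; mk⇔; Equivalence)
open import Function.Definitions using (StrictlySurjective)
open import Level using (0ℓ)
open import Relation.Binary.PropositionalEquality using (_≡_; _≢_; refl; sym; trans; cong; cong₂; subst; subst₂; module ≡-Reasoning)
open import Relation.Binary.Structures using (IsEquivalence)
open import Relation.Nullary using (¬_; Dec; yes; no; does; contradiction)
open import Relation.Nullary.Decidable using (map′; ¬?; _×-dec_; _⊎-dec_; _→-dec_)

module Real where

  open Rat using (_+_; _*_; -_; _-_; ∣_∣; _<_; _≤_; 1/_)
  open +-*-Solver using (solve; _:+_; _:*_; :-_; _:-_; _:=_)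

  private
    infixl 20 _≤⊔ˡ _≤⊔ʳ

    half : ℚ → ℚ
    half ε = ½ * ε

    half-pos : ∀ {ε} → 0ℚ < ε → 0ℚ < half ε
    half-pos {ε} ε>0 = ℚₚ.*-monoʳ-<-pos ½ ε>0

    half+half : ∀ ε → half ε + half ε ≡ ε
    half+half ε = trans (sym (ℚₚ.*-distribʳ-+ ε ½ ½)) (ℚₚ.*-identityˡ ε)

    *-pos : ∀ {p q} → 0ℚ < p → 0ℚ < q → 0ℚ < p * q
    *-pos {p} {q} p>0 q>0 = ℚₚ.positive⁻¹ (p * q) {{ℚₚ.pos*pos⇒pos p {{Rat.positive p>0}} q {{Rat.positive q>0}}}}

    triangle : ∀ x y z → ∣ x - z ∣ ≤ ∣ x - y ∣ + ∣ y - z ∣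
    triangle x y z = subst (λ t → ∣ t ∣ ≤ ∣ x - y ∣ + ∣ y - z ∣)
      (solve 3 (λ x y z → (x :- y) :+ (y :- z) := x :- z) refl x y z)
      (ℚₚ.∣p+q∣≤∣p∣+∣q∣ (x - y) (y - z))

    ∣-∣-sym : ∀ x y → ∣ x - y ∣ ≡ ∣ y - x ∣
    ∣-∣-sym x y = trans (sym (ℚₚ.∣-p∣≡∣p∣ (x - y)))
      (cong ∣_∣ (solve 2 (λ x y → :- (x :- y) := y :- x) refl x y))

    _≤⊔ˡ : ∀ {M N n} → M ⊔ N ℕ.≤ n → M ℕ.≤ n
    _≤⊔ˡ {M} {N} = ℕₚ.≤-trans (ℕₚ.m≤m⊔n M N)

    _≤⊔ʳ : ∀ {M N n} → M ⊔ N ℕ.≤ n → N ℕ.≤ n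
    _≤⊔ʳ {M} {N} = ℕₚ.≤-trans (ℕₚ.m≤n⊔m M N)

    join₄ : ∀ M₁ M₂ N₁ N₂ → ∃ λ K → ∀ {n} → K ℕ.≤ n →
            (M₁ ℕ.≤ n × M₂ ℕ.≤ n) × (N₁ ℕ.≤ n × N₂ ℕ.≤ n)
    join₄ M₁ M₂ N₁ N₂ = (M₁ ⊔ M₂) ⊔ (N₁ ⊔ N₂) , λ le →
      let l = ℕₚ.≤-trans (ℕₚ.m≤m⊔n (M₁ ⊔ M₂) (N₁ ⊔ N₂)) le
          r = ℕₚ.≤-trans (ℕₚ.m≤n⊔m (M₁ ⊔ M₂) (N₁ ⊔ N₂)) le
      in (ℕₚ.≤-trans (ℕₚ.m≤m⊔n M₁ M₂) l , ℕₚ.≤-trans (ℕₚ.m≤n⊔m M₁ M₂) l)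
       , (ℕₚ.≤-trans (ℕₚ.m≤m⊔n N₁ N₂) r , ℕₚ.≤-trans (ℕₚ.m≤n⊔m N₁ N₂) r)

  Cauchy : (ℕ → ℚ) → Set
  Cauchy x = ∀ ε → 0ℚ < ε → ∃ λ N → ∀ m n → N ℕ.≤ m → N ℕ.≤ n → ∣ x m - x n ∣ < ε

  -- Real numbers: Cauchy sequences of rationals, identified by _≈_ when their
  -- difference tends to 0.
  record ℝ : Set where
    no-eta-equality
    constructor mkℝ
    field
      seq    : ℕ → ℚ
      cauchy : Cauchy seq

  open ℝ

  infix 4 _≈_ _<ᴿ_

  -- A record, so that x and y can be inferred from a proof of x ≈ y.
  record _≈_ (x y : ℝ) : Set where
    no-eta-equality
    constructor mk≈
    field
      close : ∀ ε → 0ℚ < ε → ∃ λ N → ∀ n → N ℕ.≤ n → ∣ seq x n - seq y n ∣ < ε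

  open _≈_

  _<ᴿ_ : ℝ → ℝ → Set
  x <ᴿ y = ∃ λ δ → 0ℚ < δ × ∃ λ N → ∀ n → N ℕ.≤ n → δ < seq y n - seq x n

  private
    const-cauchy : ∀ p → Cauchy (λ _ → p)
    const-cauchy p ε ε>0 = 0 , λ _ _ _ _ → subst (λ t → ∣ t ∣ < ε) (sym (ℚₚ.+-inverseʳ p)) ε>0

    ≡⇒≈ : ∀ {x y} → (∀ n → seq x n ≡ seq y n) → x ≈ y
    ≡⇒≈ {x} {y} eq = mk≈ λ ε ε>0 → 0 , λ n _ → subst (λ t → ∣ t ∣ < ε)
      (sym (trans (cong (_- seq y n) (eq n)) (ℚₚ.+-inverseʳ (seq y n)))) ε>0

    ≈-sym : ∀ {x y} → x ≈ y → y ≈ x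
    ≈-sym {x} {y} x≈y = mk≈ λ ε ε>0 → let N , h = close x≈y ε ε>0 in
      N , λ n N≤n → subst (_< ε) (∣-∣-sym (seq x n) (seq y n)) (h n N≤n)

    ≈-trans : ∀ {x y z} → x ≈ y → y ≈ z → x ≈ z
    ≈-trans {x} {y} {z} x≈y y≈z = mk≈ λ ε ε>0 →
      let M , g = close x≈y (half ε) (half-pos ε>0)
          N , h = close y≈z (half ε) (half-pos ε>0)
      in M ⊔ N , λ n le → ℚₚ.≤-<-trans (triangle (seq x n) (seq y n) (seq z n))
           (subst (_ <_) (half+half ε) (ℚₚ.+-mono-< (g n (le ≤⊔ˡ)) (h n (le ≤⊔ʳ))))

    ∣+∣ : ∀ a b c d {ε} → ∣ a - c ∣ < half ε → ∣ b - d ∣ < half ε → ∣ (a + b) - (c + d) ∣ < ε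
    ∣+∣ a b c d {ε} p q = subst₂ (λ s t → ∣ s ∣ < t)
      (solve 4 (λ a b c d → (a :- c) :+ (b :- d) := (a :+ b) :- (c :+ d)) refl a b c d)
      (half+half ε)
      (ℚₚ.≤-<-trans (ℚₚ.∣p+q∣≤∣p∣+∣q∣ (a - c) (b - d)) (ℚₚ.+-mono-< p q))

    ∣neg∣ : ∀ a c {ε} → ∣ a - c ∣ < ε → ∣ - a - - c ∣ < ε
    ∣neg∣ a c {ε} = subst (_< ε) (trans (∣-∣-sym a c)
      (cong ∣_∣ (solve 2 (λ a c → c :- a := :- a :- :- c) refl a c)))

    -- |ab − cd| ≤ |a||b − d| + |d||a − c|
    ∣*∣ : ∀ a b c d {A D ε} (A>0 : 0ℚ < A) (D>0 : 0ℚ < D) → ∣ a ∣ < A → ∣ d ∣ < D →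
          A * ∣ b - d ∣ < half ε → D * ∣ a - c ∣ < half ε → ∣ a * b - c * d ∣ < ε
    ∣*∣ a b c d {A} {D} {ε} A>0 D>0 a<A d<D p q = subst₂ (λ s t → ∣ s ∣ < t)
      (solve 4 (λ a b c d → a :* (b :- d) :+ d :* (a :- c) := a :* b :- c :* d) refl a b c d)
      (half+half ε)
      (ℚₚ.≤-<-trans (ℚₚ.∣p+q∣≤∣p∣+∣q∣ (a * (b - d)) (d * (a - c)))
        (ℚₚ.+-mono-< (bound a (b - d) a<A p) (bound d (a - c) d<D q)))
      where
      bound : ∀ u v {U η} → ∣ u ∣ < U → U * ∣ v ∣ < η → ∣ u * v ∣ < η
      bound u v {U} u<U h = ℚₚ.≤-<-trans
        (subst (_≤ U * ∣ v ∣) (sym (ℚₚ.∣p*q∣≡∣p∣*∣q∣ u v))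
          (ℚₚ.*-monoʳ-≤-nonNeg ∣ v ∣ {{ℚₚ.∣-∣-nonNeg v}} (ℚₚ.<⇒≤ u<U))) h

    -- A positive η with B * η ≡ ε.
    quotient : ∀ {B} → 0ℚ < B → ∀ ε → 0ℚ < ε → ∃ λ η → 0ℚ < η × B * η ≡ ε
    quotient {B} B>0 ε ε>0 = B⁻¹ * ε
      , *-pos (ℚₚ.positive⁻¹ B⁻¹ {{ℚₚ.1/pos⇒pos B}}) ε>0
      , trans (sym (ℚₚ.*-assoc B B⁻¹ ε)) (trans (cong (_* ε) (ℚₚ.*-inverseʳ B)) (ℚₚ.*-identityˡ ε))
      where
      instance
        B-pos : Positive B
        B-pos = Rat.positive B>0
        B-nz : NonZero B
        B-nz = ℚₚ.pos⇒nonZero B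
      B⁻¹ = 1/ B

    scale : ∀ {B} (B>0 : 0ℚ < B) ε (ε>0 : 0ℚ < ε) {t} →
            t < proj₁ (quotient B>0 ε ε>0) → B * t < ε
    scale {B} B>0 ε ε>0 h = subst (_ <_) (proj₂ (proj₂ (quotient B>0 ε ε>0)))
      (ℚₚ.*-monoʳ-<-pos B {{Rat.positive B>0}} h)

    bounded : ∀ {x} → Cauchy x → ∃ λ B → 0ℚ < B × ∃ λ N → ∀ n → N ℕ.≤ n → ∣ x n ∣ < B
    bounded {x} cx = let N , h = cx 1ℚ (ℚₚ.positive⁻¹ 1ℚ) in
      1ℚ + ∣ x N ∣
      , ℚₚ.+-mono-<-≤ {0ℚ} {1ℚ} {0ℚ} (ℚₚ.positive⁻¹ 1ℚ) (ℚₚ.0≤∣p∣ (x N))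
      , N , λ n N≤n → subst (λ t → ∣ t ∣ < _)
          (solve 2 (λ a b → (a :- b) :+ b := a) refl (x n) (x N))
          (ℚₚ.≤-<-trans (ℚₚ.∣p+q∣≤∣p∣+∣q∣ (x n - x N) (x N))
            (ℚₚ.+-monoˡ-< ∣ x N ∣ (h n N N≤n ℕₚ.≤-refl)))

    +-cauchy : ∀ {x y} → Cauchy x → Cauchy y → Cauchy (λ n → x n + y n)
    +-cauchy {x} {y} cx cy ε ε>0 =
      let M , g = cx (half ε) (half-pos ε>0)
          N , h = cy (half ε) (half-pos ε>0)
      in M ⊔ N , λ m n le le′ →
           ∣+∣ (x m) (y m) (x n) (y n)
             (g m n (le ≤⊔ˡ) (le′ ≤⊔ˡ)) (h m n (le ≤⊔ʳ) (le′ ≤⊔ʳ))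

    neg-cauchy : ∀ {x} → Cauchy x → Cauchy (λ n → - x n)
    neg-cauchy {x} cx ε ε>0 =
      let N , h = cx ε ε>0
      in N , λ m n le le′ → ∣neg∣ (x m) (x n) (h m n le le′)

    *-cauchy : ∀ {x y} → Cauchy x → Cauchy y → Cauchy (λ n → x n * y n)
    *-cauchy {x} {y} cx cy ε ε>0 =
      let A , A>0 , M₁ , a = bounded {x} cx
          D , D>0 , M₂ , d = bounded {y} cy
          ε/2>0 = half-pos ε>0
          _ , δ>0 , _ = quotient D>0 (half ε) ε/2>0
          _ , η>0 , _ = quotient A>0 (half ε) ε/2>0
          N₁ , g = cx _ δ>0
          N₂ , h = cy _ η>0
          K , above = join₄ M₁ M₂ N₁ N₂
      in K , λ m n le le′ →
           let (a≤ , _) , (g≤ , h≤) = above le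
               (_ , d≤) , (g≤′ , h≤′) = above le′
           in ∣*∣ (x m) (y m) (x n) (y n) A>0 D>0 (a m a≤) (d n d≤)
                (scale A>0 (half ε) ε/2>0 (h m n h≤ h≤′))
                (scale D>0 (half ε) ε/2>0 (g m n g≤ g≤′))

  fromℚ : ℚ → ℝ
  fromℚ p = mkℝ (λ _ → p) (const-cauchy p)

  infixl 6 _+ᴿ_
  infixl 7 _*ᴿ_
  infix  8 -ᴿ_

  -- Opaque because unfolding these makes conversion checking very slow.
  opaque
    _+ᴿ_ : ℝ → ℝ → ℝ
    x +ᴿ y = mkℝ (λ n → seq x n + seq y n) (+-cauchy {seq x} {seq y} (cauchy x) (cauchy y))

    -ᴿ_ : ℝ → ℝ
    -ᴿ x = mkℝ (λ n → - seq x n) (neg-cauchy {seq x} (cauchy x))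

    _*ᴿ_ : ℝ → ℝ → ℝ
    x *ᴿ y = mkℝ (λ n → seq x n * seq y n) (*-cauchy {seq x} {seq y} (cauchy x) (cauchy y))

  private
    opaque
      unfolding _+ᴿ_ -ᴿ_ _*ᴿ_

      +-cong : ∀ {x y u v} → x ≈ y → u ≈ v → x +ᴿ u ≈ y +ᴿ v
      +-cong {x} {y} {u} {v} x≈y u≈v = mk≈ λ ε ε>0 →
        let M , g = close x≈y (half ε) (half-pos ε>0)
            N , h = close u≈v (half ε) (half-pos ε>0)
        in M ⊔ N , λ n le → ∣+∣ (seq x n) (seq u n) (seq y n) (seq v n) (g n (le ≤⊔ˡ)) (h n (le ≤⊔ʳ))

      neg-cong : ∀ {x y} → x ≈ y → (-ᴿ x) ≈ (-ᴿ y)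
      neg-cong {x} {y} x≈y = mk≈ λ ε ε>0 →
        let N , h = close x≈y ε ε>0
        in N , λ n le → ∣neg∣ (seq x n) (seq y n) (h n le)

      *-cong : ∀ {x y u v} → x ≈ y → u ≈ v → x *ᴿ u ≈ y *ᴿ v
      *-cong {x} {y} {u} {v} x≈y u≈v = mk≈ λ ε ε>0 →
        let A , A>0 , M₁ , a = bounded {seq x} (cauchy x)
            D , D>0 , M₂ , d = bounded {seq v} (cauchy v)
            ε/2>0 = half-pos ε>0
            _ , δ>0 , _ = quotient D>0 (half ε) ε/2>0
            _ , η>0 , _ = quotient A>0 (half ε) ε/2>0
            N₁ , g = close x≈y _ δ>0
            N₂ , h = close u≈v _ η>0
            K , above = join₄ M₁ M₂ N₁ N₂
        in K , λ n le →
             let (a≤ , d≤) , (g≤ , h≤) = above le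
             in ∣*∣ (seq x n) (seq u n) (seq y n) (seq v n) A>0 D>0 (a n a≤) (d n d≤)
                  (scale A>0 (half ε) ε/2>0 (h n h≤))
                  (scale D>0 (half ε) ε/2>0 (g n g≤))

  private
    0ᴿ 1ᴿ : ℝ
    0ᴿ = fromℚ 0ℚ
    1ᴿ = fromℚ 1ℚ

    open import Algebra.Definitions _≈_

    isEquivalence : IsEquivalence _≈_
    isEquivalence = record { refl = ≡⇒≈ λ _ → refl ; sym = ≈-sym ; trans = ≈-trans }

    opaque
      unfolding _+ᴿ_ -ᴿ_ _*ᴿ_

      +-assoc : Associative _+ᴿ_
      +-assoc x y z = ≡⇒≈ λ n → ℚₚ.+-assoc (seq x n) (seq y n) (seq z n)

      +-comm : Commutative _+ᴿ_
      +-comm x y = ≡⇒≈ λ n → ℚₚ.+-comm (seq x n) (seq y n)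

      +-identity : Identity 0ᴿ _+ᴿ_
      +-identity = (λ x → ≡⇒≈ λ n → ℚₚ.+-identityˡ (seq x n))
                 , (λ x → ≡⇒≈ λ n → ℚₚ.+-identityʳ (seq x n))

      +-inverse : Inverse 0ᴿ -ᴿ_ _+ᴿ_
      +-inverse = (λ x → ≡⇒≈ λ n → ℚₚ.+-inverseˡ (seq x n))
                , (λ x → ≡⇒≈ λ n → ℚₚ.+-inverseʳ (seq x n))

      *-assoc : Associative _*ᴿ_
      *-assoc x y z = ≡⇒≈ λ n → ℚₚ.*-assoc (seq x n) (seq y n) (seq z n)

      *-comm : Commutative _*ᴿ_
      *-comm x y = ≡⇒≈ λ n → ℚₚ.*-comm (seq x n) (seq y n)

      *-identity : Identity 1ᴿ _*ᴿ_
      *-identity = (λ x → ≡⇒≈ λ n → ℚₚ.*-identityˡ (seq x n))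
                 , (λ x → ≡⇒≈ λ n → ℚₚ.*-identityʳ (seq x n))

      distrib : _*ᴿ_ DistributesOver _+ᴿ_
      distrib = (λ x y z → ≡⇒≈ λ n → ℚₚ.*-distribˡ-+ (seq x n) (seq y n) (seq z n))
              , (λ x y z → ≡⇒≈ λ n → ℚₚ.*-distribʳ-+ (seq x n) (seq y n) (seq z n))

    +-isMagma : IsMagma _≈_ _+ᴿ_
    +-isMagma = record { isEquivalence = isEquivalence ; ∙-cong = +-cong }

    +-isSemigroup : IsSemigroup _≈_ _+ᴿ_
    +-isSemigroup = record { isMagma = +-isMagma ; assoc = +-assoc }

    +-isMonoid : IsMonoid _≈_ _+ᴿ_ 0ᴿ
    +-isMonoid = record { isSemigroup = +-isSemigroup ; identity = +-identity }

    +-isGroup : IsGroup _≈_ _+ᴿ_ 0ᴿ -ᴿ_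
    +-isGroup = record { isMonoid = +-isMonoid ; inverse = +-inverse ; ⁻¹-cong = neg-cong }

    isRing : IsRing _≈_ _+ᴿ_ _*ᴿ_ -ᴿ_ 0ᴿ 1ᴿ
    isRing = record
      { +-isAbelianGroup = record { isGroup = +-isGroup ; comm = +-comm }
      ; *-cong = *-cong
      ; *-assoc = *-assoc
      ; *-identity = *-identity
      ; distrib = distrib
      }

  ℝ-commutativeRing : CommutativeRing 0ℓ 0ℓ
  ℝ-commutativeRing = record
    { isCommutativeRing = record { isRing = isRing ; *-comm = *-comm } }

  open CommutativeRing ℝ-commutativeRing using (0#; 1#)

  private
    recipℚ : ℚ → ℚ
    recipℚ p with p ℚₚ.≟ 0ℚ
    ... | yes _ = 0ℚ
    ... | no p≢0 = 1/_ p {{Rat.≢-nonZero p≢0}}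

    *-recipℚ : ∀ {p} → 0ℚ < p → p * recipℚ p ≡ 1ℚ
    *-recipℚ {p} p>0 with p ℚₚ.≟ 0ℚ
    ... | yes p≡0 = contradiction (sym p≡0) (ℚₚ.<⇒≢ p>0)
    ... | no p≢0 = ℚₚ.*-inverseʳ p {{Rat.≢-nonZero p≢0}}

    recipℚ-close : ∀ {a b δ ε} → 0ℚ < δ → δ < a → δ < b → ∣ a - b ∣ < (δ * δ) * ε →
                   ∣ recipℚ a - recipℚ b ∣ < ε
    recipℚ-close {a} {b} {δ} {ε} δ>0 δ<a δ<b h =
      ℚₚ.*-cancelˡ-<-nonNeg (a * b) {{ℚₚ.pos⇒nonNeg (a * b) {{ab-pos}}}}
        (ℚₚ.≤-<-trans (ℚₚ.≤-reflexive eq) (ℚₚ.<-trans h grow))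
      where
      a>0 = ℚₚ.<-trans δ>0 δ<a
      b>0 = ℚₚ.<-trans δ>0 δ<b
      ab-pos = Rat.positive (*-pos a>0 b>0)
      ε>0 : 0ℚ < ε
      ε>0 = ℚₚ.*-cancelˡ-<-nonNeg (δ * δ) {{ℚₚ.pos⇒nonNeg (δ * δ) {{Rat.positive (*-pos δ>0 δ>0)}}}}
        (subst (_< (δ * δ) * ε) (sym (ℚₚ.*-zeroʳ (δ * δ))) (ℚₚ.≤-<-trans (ℚₚ.0≤∣p∣ (a - b)) h))
      grow : (δ * δ) * ε < (a * b) * ε
      grow = ℚₚ.*-monoˡ-<-pos ε {{Rat.positive ε>0}}
        (ℚₚ.<-trans (ℚₚ.*-monoˡ-<-pos δ {{Rat.positive δ>0}} δ<a)
                    (ℚₚ.*-monoʳ-<-pos a {{Rat.positive a>0}} δ<b))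
      ra = recipℚ a
      rb = recipℚ b
      eq : (a * b) * ∣ ra - rb ∣ ≡ ∣ a - b ∣
      eq = begin
        (a * b) * ∣ ra - rb ∣      ≡⟨ cong (_* ∣ ra - rb ∣) (sym (ℚₚ.0≤p⇒∣p∣≡p (ℚₚ.<⇒≤ (*-pos a>0 b>0)))) ⟩
        ∣ a * b ∣ * ∣ ra - rb ∣    ≡⟨ sym (ℚₚ.∣p*q∣≡∣p∣*∣q∣ (a * b) (ra - rb)) ⟩
        ∣ (a * b) * (ra - rb) ∣    ≡⟨ cong ∣_∣ (solve 4 (λ a b r s → (a :* b) :* (r :- s) := (a :* r) :* b :- (b :* s) :* a) refl a b ra rb) ⟩
        ∣ (a * ra) * b - (b * rb) * a ∣ ≡⟨ cong₂ (λ s t → ∣ s * b - t * a ∣) (*-recipℚ a>0) (*-recipℚ b>0) ⟩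
        ∣ 1ℚ * b - 1ℚ * a ∣        ≡⟨ cong₂ (λ s t → ∣ s - t ∣) (ℚₚ.*-identityˡ b) (ℚₚ.*-identityˡ a) ⟩
        ∣ b - a ∣                  ≡⟨ ∣-∣-sym b a ⟩
        ∣ a - b ∣                  ∎
        where open ≡-Reasoning

    tail-pos : ∀ p {δ} → δ < p - 0ℚ → δ < p
    tail-pos p {δ} = subst (δ <_) (ℚₚ.+-identityʳ p)

    recip-cauchy : ∀ {x} → 0# <ᴿ x → Cauchy (λ n → recipℚ (seq x n))
    recip-cauchy {x} (δ , δ>0 , N , below) ε ε>0 =
      let M , h = cauchy x ((δ * δ) * ε) (*-pos (*-pos δ>0 δ>0) ε>0)
      in N ⊔ M , λ m n le le′ → recipℚ-close {seq x m} {seq x n} δ>0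
           (tail-pos (seq x m) (below m (le ≤⊔ˡ))) (tail-pos (seq x n) (below n (le′ ≤⊔ˡ)))
           (h m n (le ≤⊔ʳ) (le′ ≤⊔ʳ))

  opaque
    unfolding _*ᴿ_

    recip : (x : ℝ) → 0# <ᴿ x → ℝ
    recip x x>0 = mkℝ (λ n → recipℚ (seq x n)) (recip-cauchy {x} x>0)

    *-recip : ∀ x (x>0 : 0# <ᴿ x) → x *ᴿ recip x x>0 ≈ 1#
    *-recip x (δ , δ>0 , N , below) = mk≈ λ ε ε>0 → N , λ n N≤n →
      subst (λ t → ∣ t - 1ℚ ∣ < ε)
        (sym (*-recipℚ {seq x n} (ℚₚ.<-trans δ>0 (tail-pos (seq x n) (below n N≤n)))))
        ε>0

open import Data.Fin.Subset using (Subset; _∈_; ∣_∣; ⊤; inside; outside)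
open import Data.Fin.Subset.Properties using (_∈?_)
open import Relation.Binary.Construct.Closure.ReflexiveTransitive as Star using (Star; ε; _◅_; _◅◅_)

-- Finite multigraphs: vertices Fin n, edges Fin m.  The pair of ends of an edge
-- is read as an orientation where one is needed and is unordered otherwise.
-- Sets of edges are values of Subset m.
Multigraph : ℕ → ℕ → Set
Multigraph n m = Fin m → Fin n × Fin n

module _ {n m : ℕ} (G : Multigraph n m) where

  Joins : Fin m → Fin n → Fin n → Set
  Joins e u v = G e ≡ (u , v) ⊎ G e ≡ (v , u)

  Incident : Fin m → Fin n → Set
  Incident e u = proj₁ (G e) ≡ u ⊎ proj₂ (G e) ≡ u

  Simple : Set
  Simple = (∀ e → proj₁ (G e) ≢ proj₂ (G e))
         × (∀ {e e′ u v} → Joins e u v → Joins e′ u v → e ≡ e′)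

  Step : Subset m → Fin n → Fin n → Set
  Step F u v = ∃ λ e → e ∈ F × Joins e u v

  -- Walks whose edges lie in F.
  Walk : Subset m → Fin n → Fin n → Set
  Walk F = Star (Step F)

  edges : ∀ {F u v} → Walk F u v → List (Fin m)
  edges ε             = []
  edges ((e , _) ◅ p) = e ∷ edges p

  -- The vertices visited, except the final one.
  sources : ∀ {F u v} → Walk F u v → List (Fin n)
  sources ε             = []
  sources (_◅_ {u} _ p) = u ∷ sources p

  -- Loops and pairs of parallel edges are cycles, of lengths 1 and 2.
  IsCycle : ∀ {F u} → Walk F u u → Set
  IsCycle p = edges p ≢ [] × Unique (edges p) × Unique (sources p)

  Acyclic : Subset m → Set
  Acyclic F = ∀ {u} (p : Walk F u u) → ¬ IsCycle p

  Connected : Subset m → Set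
  Connected F = ∀ u v → Walk F u v

  IsSpanningTree : Subset m → Set
  IsSpanningTree F = Acyclic F × Connected F

  -- comp numbers the connected components of the spanning subgraph F by Fin s.
  IsComponentMap : Subset m → ∀ {s} → (Fin n → Fin s) → Set
  IsComponentMap F comp =
    StrictlySurjective _≡_ comp × (∀ u v → comp u ≡ comp v ⇔ Walk F u v)

  -- F is a spanning forest with exactly s connected components.
  IsSpanningForest : ℕ → Subset m → Set
  IsSpanningForest s F = Acyclic F × ∃ λ (comp : Fin n → Fin s) → IsComponentMap F comp

  -- A numbering C₀ , … , Cᵣ of the components of F for which C₀ contains g.
  record ComponentOrder (g : Fin n) (F : Subset m) (r : ℕ) : Set where
    field
      comp           : Fin n → Fin (suc r)
      isComponentMap : IsComponentMap F comp
      ground         : comp g ≡ zero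

  joins? : ∀ e u v → Dec (Joins e u v)
  joins? e u v = ≡-dec _≟_ _≟_ (G e) (u , v) ⊎-dec ≡-dec _≟_ _≟_ (G e) (v , u)

  incident? : ∀ e u → Dec (Incident e u)
  incident? e u = (proj₁ (G e) ≟ u) ⊎-dec (proj₂ (G e) ≟ u)

  edge? : ∀ u v → Dec (∃ λ e → Joins e u v)
  edge? u v = any? λ e → joins? e u v

private
  -- Adding one edge a b to F connects u to v iff F did, or F connects u and v
  -- to different ends of that edge.
  walk?′ : ∀ {n m} (G : Multigraph n m) F u v → Dec (Walk G F u v)
  walk?′ G [] u v = map′ (λ { refl → ε }) (λ { ε → refl ; ((() , _) ◅ _) }) (u ≟ v)
  walk?′ {n} {suc m} G (x ∷ F) = go x
    where
    G′ : Multigraph n m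
    G′ = G ∘ suc
    a = proj₁ (G zero)
    b = proj₂ (G zero)

    lift : ∀ {x u v} → Walk G′ F u v → Walk G (x ∷ F) u v
    lift = Star.map λ { (e , e∈F , j) → suc e , there e∈F , j }

    Via : Fin n → Fin n → Set
    Via u v = Walk G′ F u v ⊎ (Walk G′ F u a × Walk G′ F b v)
                            ⊎ (Walk G′ F u b × Walk G′ F a v)

    join : ∀ {u v} → Via u v → Walk G (inside ∷ F) u v
    join (inj₁ p)              = lift p
    join (inj₂ (inj₁ (p , q))) = lift p ◅◅ (zero , here , inj₁ refl) ◅ lift q
    join (inj₂ (inj₂ (p , q))) = lift p ◅◅ (zero , here , inj₂ refl) ◅ lift q

    split : ∀ {u v} → Walk G (inside ∷ F) u v → Via u v
    split ε = inj₁ ε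
    split ((suc e , there e∈F , j) ◅ p) with split p
    ... | inj₁ q              = inj₁ ((e , e∈F , j) ◅ q)
    ... | inj₂ (inj₁ (q , r)) = inj₂ (inj₁ ((e , e∈F , j) ◅ q , r))
    ... | inj₂ (inj₂ (q , r)) = inj₂ (inj₂ ((e , e∈F , j) ◅ q , r))
    split ((zero , here , inj₁ refl) ◅ p) with split p
    ... | inj₁ q              = inj₂ (inj₁ (ε , q))
    ... | inj₂ (inj₁ (_ , r)) = inj₂ (inj₁ (ε , r))
    ... | inj₂ (inj₂ (_ , r)) = inj₁ r
    split ((zero , here , inj₂ refl) ◅ p) with split p
    ... | inj₁ q              = inj₂ (inj₂ (ε , q))
    ... | inj₂ (inj₁ (_ , r)) = inj₁ r
    ... | inj₂ (inj₂ (_ , r)) = inj₂ (inj₂ (ε , r))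

    drop : ∀ {u v} → Walk G (outside ∷ F) u v → Walk G′ F u v
    drop = Star.map λ { (suc e , there e∈F , j) → e , e∈F , j }

    go : ∀ x u v → Dec (Walk G (x ∷ F) u v)
    go true  u v = map′ join split (w u v ⊎-dec (w u a ×-dec w b v) ⊎-dec (w u b ×-dec w a v))
      where w = walk?′ G′ F
    go false u v = map′ lift drop (walk?′ G′ F u v)

  lookup-injective : ∀ {A : Set} {xs : List A} → Unique xs →
                     ∀ {i j} → List.lookup xs i ≡ List.lookup xs j → i ≡ j
  lookup-injective (_ AllPairs.∷ _)   {zero}  {zero}  _  = refl
  lookup-injective (x∉ AllPairs.∷ _)  {zero}  {suc j} eq = contradiction eq (All.lookup x∉ (∈-lookup j))
  lookup-injective (x∉ AllPairs.∷ _)  {suc i} {zero}  eq = contradiction (sym eq) (All.lookup x∉ (∈-lookup i))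
  lookup-injective (_ AllPairs.∷ xs!) {suc i} {suc j} eq = cong suc (lookup-injective xs! eq)

  unique⇒length≤ : ∀ {m} {es : List (Fin m)} → Unique es → length es ℕ.≤ m
  unique⇒length≤ es! = injective⇒≤ (lookup-injective es!)

  anyVec? : ∀ {s} n {Q : Vec (Fin s) n → Set} → (∀ xs → Dec (Q xs)) → Dec (∃ Q)
  anyVec? zero    Q? = map′ ([] ,_) (λ { ([] , q) → q }) (Q? [])
  anyVec? (suc n) Q? = map′ (λ { (x , xs , q) → x ∷ xs , q }) (λ { (x ∷ xs , q) → x , xs , q })
                            (any? λ x → anyVec? n λ xs → Q? (x ∷ xs))

module _ {n m : ℕ} (G : Multigraph n m) where

  walk? : ∀ F u v → Dec (Walk G F u v)
  walk? = walk?′ G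

  private
    -- Bounded search for a walk with prescribed edge and vertex sequences.
    search : ∀ F k {Q : List (Fin m) → List (Fin n) → Set} → (∀ es us → Dec (Q es us)) →
             ∀ u v → Dec (∃ λ (p : Walk G F u v) →
                            length (edges G p) ℕ.≤ k × Q (edges G p) (sources G p))
    search F zero Q? u v = map′
      (λ { (refl , q) → ε , ℕ.z≤n , q })
      (λ { (ε , _ , q) → refl , q ; (_ ◅ _ , () , _) })
      ((u ≟ v) ×-dec Q? [] [])
    search F (suc k) Q? u v = map′
      (λ { (inj₁ (refl , q)) → ε , ℕ.z≤n , q
         ; (inj₂ (e , w , (e∈F , j) , p , l , q)) → (e , e∈F , j) ◅ p , ℕ.s≤s l , q })
      (λ { (ε , _ , q) → inj₁ (refl , q)
         ; (_◅_ {j = w} (e , e∈F , j) p , ℕ.s≤s l , q) → inj₂ (e , w , (e∈F , j) , p , l , q) })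
      (((u ≟ v) ×-dec Q? [] []) ⊎-dec
       any? λ e → any? λ w → ((e ∈? F) ×-dec joins? G e u w) ×-dec
         search F k (λ es us → Q? (e ∷ es) (u ∷ us)) w v)

  acyclic? : ∀ F → Dec (Acyclic G F)
  acyclic? F = map′
    (λ none {u} p cyc → none (u , p , unique⇒length≤ (proj₁ (proj₂ cyc)) , cyc))
    (λ acyc (u , p , _ , cyc) → acyc p cyc)
    (¬? (any? λ u → search F m cycle? u u))
    where
    cycle? : ∀ es us → Dec (es ≢ [] × Unique es × Unique us)
    cycle? es us = ¬? (List.≡-dec _≟_ es []) ×-dec unique? _≟_ es ×-dec unique? _≟_ us

  spanningTree? : ∀ F → Dec (IsSpanningTree G F)
  spanningTree? F = acyclic? F ×-dec all? λ u → all? λ v → walk? F u v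

  private
    componentMap? : ∀ F {s} (comp : Fin n → Fin s) → Dec (IsComponentMap G F comp)
    componentMap? F comp =
      (all? λ a → any? λ v → comp v ≟ a) ×-dec
      (all? λ u → all? λ v → map′ (uncurry mk⇔) (λ f → Equivalence.to f , Equivalence.from f)
        (((comp u ≟ comp v) →-dec walk? F u v) ×-dec (walk? F u v →-dec (comp u ≟ comp v))))

    resp : ∀ F {s} {f f′ : Fin n → Fin s} → (∀ v → f v ≡ f′ v) →
           IsComponentMap G F f → IsComponentMap G F f′
    resp F f≗f′ (sur , ker) =
      (λ a → proj₁ (sur a) , trans (sym (f≗f′ _)) (proj₂ (sur a))) ,
      (λ u v → mk⇔ (λ eq → Equivalence.to (ker u v) (trans (f≗f′ u) (trans eq (sym (f≗f′ v)))))
                   (λ p → trans (sym (f≗f′ u)) (trans (Equivalence.from (ker u v) p) (f≗f′ v))))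

  spanningForest? : ∀ s F → Dec (IsSpanningForest G s F)
  spanningForest? s F = acyclic? F ×-dec map′
    (λ (xs , h) → Vec.lookup xs , h)
    (λ (f , h) → Vec.tabulate f , resp F (λ v → sym (lookup∘tabulate f v)) h)
    (anyVec? n λ xs → componentMap? F (Vec.lookup xs))

-- The increasing enumeration of a subset.
elements : ∀ {n} (S : Subset n) → Fin ∣ S ∣ → Fin n
elements (true  ∷ S) zero    = zero
elements (true  ∷ S) (suc i) = suc (elements S i)
elements (false ∷ S) i       = suc (elements S i)

enum : ∀ {n k} (S : Subset n) → ∣ S ∣ ≡ k → Fin k → Fin n
enum S ∣S∣≡k = elements S ∘ cast (sym ∣S∣≡k)

module LinearAlgebra {a ℓ} (R : CommutativeRing a ℓ) where

  open CommutativeRing R using (Carrier; _≈_; _+_; _*_; -_; 0#; 1#; semiring)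
  open import Algebra.Properties.Semiring.Sum semiring using (sum)
  open import Algebra.Properties.Semiring.Exp semiring using (_^_)

  Matrix : ℕ → ℕ → Set a
  Matrix k l = Fin k → Fin l → Carrier

  -- 1# if the proposition holds and 0# otherwise.
  indicator : ∀ {p} {A : Set p} → Dec A → Carrier
  indicator A? = if does A? then 1# else 0#

  identity : ∀ {k} → Matrix k k
  identity i j = indicator (i ≟ j)

  infixl 7 _⊗_

  _⊗_ : ∀ {k l p} → Matrix k l → Matrix l p → Matrix k p
  (A ⊗ B) i j = sum λ t → A i t * B t j

  infixl 8 _ᵀ

  _ᵀ : ∀ {k l} → Matrix k l → Matrix l k
  (A ᵀ) i j = A j i

  infix 8 _[_,_]

  _[_,_] : ∀ {k l k′ l′} → Matrix k l → (Fin k′ → Fin k) → (Fin l′ → Fin l) → Matrix k′ l′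
  (A [ f , h ]) i j = A (f i) (h j)

  infix 4 _≋_

  _≋_ : ∀ {k l} → Matrix k l → Matrix k l → Set ℓ
  A ≋ B = ∀ i j → A i j ≈ B i j

  IsInverse : ∀ {k} → Matrix k k → Matrix k k → Set ℓ
  IsInverse A B = A ⊗ B ≋ identity × B ⊗ A ≋ identity

  -- Laplace expansion along the first row.
  det : ∀ {k} → Matrix k k → Carrier
  det {zero}  A = 1#
  det {suc k} A = sum λ j → ((- 1#) ^ toℕ j) * (A zero j * det (λ i l → A (suc i) (punchIn j l)))

  sumOverSubsets : ∀ {m} → (Subset m → Carrier) → Carrier
  sumOverSubsets {zero}  f = f []
  sumOverSubsets {suc m} f = sumOverSubsets (f ∘ (inside ∷_)) + sumOverSubsets (f ∘ (outside ∷_))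

  withProof : ∀ {p} {A : Set p} → Dec A → (A → Carrier) → Carrier
  withProof (yes h) f = f h
  withProof (no _)  f = 0#

  -- Sum over the subsets that satisfy P; a summand may use the proof of P.
  sumOver : ∀ {m} {P : Subset m → Set} → (∀ F → Dec (P F)) → (∀ F → P F → Carrier) → Carrier
  sumOver P? f = sumOverSubsets λ F → withProof (P? F) (f F)

  Is0or±1 : Carrier → Set ℓ
  Is0or±1 x = x ≈ 0# ⊎ x ≈ 1# ⊎ x ≈ - 1#

-- The vertex set is Fin (suc n); punchIn g : Fin n → Fin (suc n) enumerates the
-- vertices other than g in increasing order and indexes the grounded matrices.
-- P gives the virtual edges, with (u , v) oriented from u to v, and order an
-- arbitrary numbering of the components of each forest.
module Network {a ℓ} (R : CommutativeRing a ℓ) {n m q : ℕ}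
  (G : Multigraph (suc n) m) (c : Fin m → CommutativeRing.Carrier R) (g : Fin (suc n))
  (P : Multigraph (suc n) q)
  (order : ∀ {r} F → IsSpanningForest G (suc r) F → ComponentOrder G g F r) where

  open CommutativeRing R using (Carrier; _*_; -_; _-_; 0#; 1#; semiring; *-commutativeMonoid)
  open LinearAlgebra R
  open import Algebra.Properties.Semiring.Sum semiring using (sum)
  open import Algebra.Properties.CommutativeMonoid.Sum *-commutativeMonoid using () renaming (sum to product)

  laplacian : Matrix (suc n) (suc n)
  laplacian u v with u ≟ v
  ... | yes _ = sum λ e → if does (incident? G e u) then c e else 0#
  ... | no _ with edge? G u v
  ...   | yes (e , _) = - c e
  ...   | no _        = 0#

  K : Matrix n n
  K = laplacian [ punchIn g , punchIn g ]

  D : Matrix n q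
  D i p = indicator (punchIn g i ≟ proj₂ (P p)) - indicator (punchIn g i ≟ proj₁ (P p))

  Z : Matrix n n → Matrix q q
  Z K⁻¹ = D ᵀ ⊗ K⁻¹ ⊗ D

  w : Subset m → Carrier
  w F = product λ e → if Vec.lookup F e then c e else 1#

  τ : Carrier
  τ = sumOver (spanningTree? G) λ T _ → w T

  -- F ∈𝓕 s: F is a spanning forest of G with exactly s components.
  infix 4 _∈𝓕_

  _∈𝓕_ : Subset m → ℕ → Set
  F ∈𝓕 s = IsSpanningForest G s F

  ∑𝓕 : ∀ s → (∀ F → F ∈𝓕 s → Carrier) → Carrier
  ∑𝓕 s = sumOver (spanningForest? G s)

  module _ {r} {F : Subset m} (F∈ : F ∈𝓕 suc r) where

    open ComponentOrder (order F F∈) using (comp)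

    H : Multigraph (suc r) q
    H p = comp (proj₁ (P p)) , comp (proj₂ (P p))

    -- Row t belongs to the component numbered suc t.
    Q : Matrix r n
    Q t i = indicator (comp (punchIn g i) ≟ suc t)

    B : Matrix r q
    B = Q ⊗ D

    χ : (S : Subset q) → ∣ S ∣ ≡ r → Carrier
    χ S ∣S∣≡r = det (B [ id , enum S ∣S∣≡r ])

    E : ∀ {k} (I : Subset q) → ∣ I ∣ ≡ k → Matrix q k
    E I ∣I∣≡k p j = indicator (p ≟ enum I ∣I∣≡k j)

    χ̂ : ∀ {k} → r ℕ.+ k ≡ q → (I : Subset q) → ∣ I ∣ ≡ k → Carrier
    χ̂ r+k≡q I ∣I∣≡k = det λ i → (B ++ E I ∣I∣≡k ᵀ) (cast (sym r+k≡q) i)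

  Φ : Carrier
  Φ = ∑𝓕 (suc q) λ F F∈ → if does (spanningTree? (H F∈) ⊤) then w F else 0#

{-# OPTIONS --safe #-}

-- Border K by the port columns W and W′ (and, for the completed determinants, by the rows of E_I and E_J)
-- and compute the determinant of the bordered matrix in two ways.  Schur complements give τ det Z[A,B],
-- respectively Φ det 𝓛[I,J].  On the other hand K = Σ_e c_e a_e a_eᵀ, so the Cauchy–Binet formula gives
-- Σ_F w(F) det(a_F | W) det(a_F | W′).  Contracting the edges of F one by one shows that det(a_F | W) is
-- ± det(Q_F W), with a sign that does not depend on W, if F is a forest, and 0 otherwise.  The same contraction
-- in H_F shows that χ_F(S) is ±1 if S is a spanning tree of H_F, and 0 otherwise.  Hence τ and Φ are sums of
-- positive weights, and they are not empty: extend P, or the empty graph, greedily to a spanning tree.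

module Submission where

open import Defs
open import Algebra.Bundles using (CommutativeRing)
open import Data.Bool.Base using (true; false; if_then_else_)
open import Data.Fin.Base using (Fin; zero; suc; toℕ; punchIn; punchOut; cast; splitAt; _↑ˡ_; _↑ʳ_)
open import Data.Fin.Permutation as Perm using (Permutation; _⟨$⟩ʳ_; _⟨$⟩ˡ_)
open import Data.Fin.Properties using (_≟_; +↔⊎; cast-involutive; cast-is-id; punchIn-injective; punchIn-punchOut; punchInᵢ≢i; splitAt-join; suc-injective; toℕ-↑ˡ)
open import Data.Fin.Subset using (Subset; inside; outside; ⊤; ∁; ∣_∣)
open import Data.Fin.Subset.Properties using (∣⊤∣≡n; ∣∁p∣≡n∸∣p∣)
open import Data.Nat.Base as ℕ using (ℕ; zero; suc; _⊔_)
import Data.Nat.Properties as ℕₚ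
open import Data.Product using (Σ; ∃; _×_; _,_; proj₁; proj₂)
open import Data.Rational.Base as ℚ using (0ℚ; 1ℚ; ½)
import Data.Rational.Properties as ℚₚ
open import Data.Rational.Solver using (module +-*-Solver)
open import Data.Sum.Algebra using (⊎-comm)
open import Data.Sum.Base as Sum using (_⊎_; inj₁; inj₂; map₁)
open import Data.Sum.Function.Propositional using (_⊎-↔_)
open import Data.Unit.Base using (tt)
open import Data.Vec.Base as Vec using (Vec)
open import Function.Base using (_∘_; id)
open import Function.Bundles using (_⇔_; _↔_; Equivalence; Inverse; mk⇔; mk↔ₛ′)
open import Function.Construct.Composition using (_↔-∘_)
open import Function.Construct.Symmetry using (↔-sym)
open import Relation.Binary.Construct.Closure.ReflexiveTransitive using (ε; _◅_)
open import Relation.Binary.PropositionalEquality as ≡ using (_≡_; _≢_)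
open import Relation.Nullary using (¬_; Dec; yes; no; does; contradiction)
open import Relation.Nullary.Decidable using (toWitness)

-- Two choices keep the computation uniform. Determinants are extended by the value 0 to rectangular
-- matrices, because the number of rows of (a_F | W) depends on F: subsets of the wrong size then
-- drop out of the sum by themselves. And the sign found by contracting F is quantified before W, so
-- that it can be used for two different borders and cancels in their product; its value never
-- matters. A row of the border is an edge together with a constant tail. Contraction acts on the
-- edge part alone, so the minors of `Z` (empty tails) and the completed determinants (tails from
-- E_I and E_J) are instances of one formula. The full minor of `Z` gives det Z · `τ` = `Φ`, and
-- this is how `Φ` becomes the denominator for `𝓛`. The expansions are proved over any commutative
-- ring, multiplied through by `τ` or `Φ`; the reals enter when these are inverted. As the order of
-- the reals is not decidable, positivity of the two sums rests on the decidability of the forest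
-- and tree conditions and on one explicit positive summand.

module Forests where

  open import Data.List.Base as List using (List; []; _∷_)
  open import Data.List.Relation.Unary.All as All using (All; []; _∷_)
  import Data.List.Relation.Unary.All.Properties as All
  open import Data.List.Relation.Unary.AllPairs using ([]; _∷_)
  open import Data.List.Relation.Unary.Unique.Propositional using (Unique)
  import Data.List.Relation.Unary.Unique.Propositional.Properties as Unique
  open import Data.Product using (∃₂)
  import Data.Unit.Base as Unit
  open import Data.Vec.Base using ([]; _∷_; here; there)
  open import Relation.Binary.Construct.Closure.ReflexiveTransitive as Star using (_◅◅_)
  open import Relation.Binary.PropositionalEquality using (refl; sym; trans; cong; subst)
  open import Relation.Nullary.Decidable using (_⊎-dec_)

  -- Walks, paths and loop erasure.

  module _ {n m} (G : Multigraph n m) where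

    joins-sym : ∀ {e u v} → Joins G e u v → Joins G e v u
    joins-sym (inj₁ p) = inj₂ p
    joins-sym (inj₂ p) = inj₁ p

    walk-sym : ∀ {F u v} → Walk G F u v → Walk G F v u
    walk-sym = Star.reverse λ (e , e∈F , j) → e , e∈F , joins-sym j

    joins-common : ∀ {e u v x y} → Joins G e u v → Joins G e x y → u ≡ x ⊎ u ≡ y
    joins-common (inj₁ p) (inj₁ q) = inj₁ (cong proj₁ (trans (sym p) q))
    joins-common (inj₁ p) (inj₂ q) = inj₂ (cong proj₁ (trans (sym p) q))
    joins-common (inj₂ p) (inj₁ q) = inj₂ (cong proj₂ (trans (sym p) q))
    joins-common (inj₂ p) (inj₂ q) = inj₁ (cong proj₂ (trans (sym p) q))

    module _ {F : Subset m} where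

      OnWalk : ∀ {u v} → Fin n → Walk G F u v → Set
      OnWalk {u} x ε       = x ≡ u
      OnWalk {u} x (_ ◅ p) = x ≡ u ⊎ OnWalk x p

      onWalk? : ∀ {u v} x (p : Walk G F u v) → Dec (OnWalk x p)
      onWalk? {u} x ε       = x ≟ u
      onWalk? {u} x (_ ◅ p) = (x ≟ u) ⊎-dec onWalk? x p

      start-on : ∀ {u v} (p : Walk G F u v) → OnWalk u p
      start-on ε       = refl
      start-on (_ ◅ _) = inj₁ refl

      end-on : ∀ {u v} (p : Walk G F u v) → OnWalk v p
      end-on ε       = refl
      end-on (_ ◅ p) = inj₂ (end-on p)

      IsPath : ∀ {u v} → Walk G F u v → Set
      IsPath ε           = Unit.⊤
      IsPath (_◅_ {u} _ p) = ¬ OnWalk u p × IsPath p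

      suffix : ∀ {u v x} (p : Walk G F u v) → IsPath p → OnWalk x p → ∃ λ (q : Walk G F x v) → IsPath q
      suffix ε         π       refl        = ε , π
      suffix p@(_ ◅ _) π       (inj₁ refl) = p , π
      suffix (_ ◅ p)   (_ , π) (inj₂ x∈p)  = suffix p π x∈p

      -- Loop erasure: if the new start already lies on the path built so far, everything before
      -- that occurrence is dropped.
      path : ∀ {u v} → Walk G F u v → ∃ λ (p : Walk G F u v) → IsPath p
      path ε = ε , Unit.tt
      path (_◅_ {u} s p) with p′ , π ← path p with onWalk? u p′
      ... | yes u∈p′ = suffix p′ π u∈p′
      ... | no  u∉p′ = s ◅ p′ , u∉p′ , π

      ∉sources : ∀ {u v x} (p : Walk G F u v) → ¬ OnWalk x p → All (x ≢_) (sources G p)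
      ∉sources ε       x∉p = []
      ∉sources (_ ◅ p) x∉p = (x∉p ∘ inj₁) ∷ ∉sources p (x∉p ∘ inj₂)

      sources-unique : ∀ {u v} (p : Walk G F u v) → IsPath p → Unique (sources G p)
      sources-unique ε       _         = []
      sources-unique (_ ◅ p) (u∉p , π) = ∉sources p u∉p ∷ sources-unique p π

      end∉sources : ∀ {u v} (p : Walk G F u v) → IsPath p → All (v ≢_) (sources G p)
      end∉sources ε       _         = []
      end∉sources (_ ◅ p) (u∉p , π) = (λ { refl → u∉p (end-on p) }) ∷ end∉sources p π

      -- Using an edge puts both of its ends on the walk.
      ∉edges : ∀ {u v x y e} → Joins G e x y → (p : Walk G F u v) → ¬ OnWalk x p → All (e ≢_) (edges G p)
      ∉edges j ε x∉p = []
      ∉edges j ((e′ , _ , j′) ◅ p) x∉p =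
        (λ { refl → Sum.[ x∉p ∘ inj₁ , (λ { refl → x∉p (inj₂ (start-on p)) }) ] (joins-common j j′) })
        ∷ ∉edges j p (x∉p ∘ inj₂)

      edges-unique : ∀ {u v} (p : Walk G F u v) → IsPath p → Unique (edges G p)
      edges-unique ε               _         = []
      edges-unique ((_ , _ , j) ◅ p) (u∉p , π) = ∉edges j p u∉p ∷ edges-unique p π

  -- Walks and cycles when the first edge is deleted or added.

  module _ {n m} (G : Multigraph n (suc m)) {F : Subset m} where

    private
      G′ : Multigraph n m
      G′ = G ∘ suc
      a = proj₁ (G zero)
      b = proj₂ (G zero)

    walk-lift : ∀ {x u v} → Walk G′ F u v → Walk G (x ∷ F) u v
    walk-lift = Star.map λ (e , e∈F , j) → suc e , there e∈F , j

    Through : Fin n → Fin n → Set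
    Through u v = (Walk G′ F u a × Walk G′ F b v) ⊎ (Walk G′ F u b × Walk G′ F a v)

    walk-join : ∀ {u v} → Walk G′ F u v ⊎ Through u v → Walk G (inside ∷ F) u v
    walk-join (inj₁ p)              = walk-lift p
    walk-join (inj₂ (inj₁ (p , q))) = walk-lift p ◅◅ (zero , here , inj₁ refl) ◅ walk-lift q
    walk-join (inj₂ (inj₂ (p , q))) = walk-lift p ◅◅ (zero , here , inj₂ refl) ◅ walk-lift q

    -- However often a walk crosses the first edge, at most one crossing has to be kept: the
    -- excursion between two crossings can be cut out.
    walk-split : ∀ {u v} → Walk G (inside ∷ F) u v → Walk G′ F u v ⊎ Through u v
    walk-split ε = inj₁ ε
    walk-split ((suc e , there e∈F , j) ◅ p) with walk-split p
    ... | inj₁ q              = inj₁ ((e , e∈F , j) ◅ q)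
    ... | inj₂ (inj₁ (q , r)) = inj₂ (inj₁ ((e , e∈F , j) ◅ q , r))
    ... | inj₂ (inj₂ (q , r)) = inj₂ (inj₂ ((e , e∈F , j) ◅ q , r))
    walk-split ((zero , here , inj₁ refl) ◅ p) with walk-split p
    ... | inj₁ q              = inj₂ (inj₁ (ε , q))
    ... | inj₂ (inj₁ (_ , r)) = inj₂ (inj₁ (ε , r))
    ... | inj₂ (inj₂ (_ , r)) = inj₁ r
    walk-split ((zero , here , inj₂ refl) ◅ p) with walk-split p
    ... | inj₁ q              = inj₂ (inj₂ (ε , q))
    ... | inj₂ (inj₁ (_ , r)) = inj₁ r
    ... | inj₂ (inj₂ (_ , r)) = inj₂ (inj₂ (ε , r))

    walk-drop : ∀ {u v} → Walk G (outside ∷ F) u v → Walk G′ F u v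
    walk-drop = Star.map λ { (suc e , there e∈F , j) → e , e∈F , j }

    edges-lift : ∀ {x u v} (p : Walk G′ F u v) → edges G (walk-lift {x} p) ≡ List.map suc (edges G′ p)
    edges-lift ε       = refl
    edges-lift (_ ◅ p) = cong (_ ∷_) (edges-lift p)

    sources-lift : ∀ {x u v} (p : Walk G′ F u v) → sources G (walk-lift {x} p) ≡ sources G′ p
    sources-lift ε       = refl
    sources-lift (_ ◅ p) = cong (_ ∷_) (sources-lift p)

    unique-map-suc : ∀ {k} {es : List (Fin k)} → Unique es → Unique (List.map suc es)
    unique-map-suc = Unique.map⁺ suc-injective

    acyclic-tail : ∀ {x} → Acyclic G (x ∷ F) → Acyclic G′ F
    acyclic-tail {x} acyc p (ne , ue , us) = acyc (walk-lift p)
      ( (λ eq → ne (map-[] (trans (sym (edges-lift p)) eq)))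
      , subst Unique (sym (edges-lift p)) (unique-map-suc ue)
      , subst Unique (sym (sources-lift {x} p)) us )
      where
      map-[] : ∀ {es : List (Fin m)} → List.map suc es ≡ [] → es ≡ []
      map-[] {[]} _ = refl

    walk-avoiding : ∀ {x u v} (p : Walk G (x ∷ F) u v) → All (zero ≢_) (edges G p) →
      ∃ λ (q : Walk G′ F u v) → edges G p ≡ List.map suc (edges G′ q) × sources G p ≡ sources G′ q
    walk-avoiding ε _ = ε , refl , refl
    walk-avoiding ((zero , _ , _) ◅ p) (0≢0 ∷ _) = contradiction refl 0≢0
    walk-avoiding ((suc e , there e∈F , j) ◅ p) (_ ∷ avoid) with q , eqe , eqs ← walk-avoiding p avoid =
      (e , e∈F , j) ◅ q , cong (_ ∷_) eqe , cong (_ ∷_) eqs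

    not-cycle : ∀ {x u} → Acyclic G′ F → (p : Walk G (x ∷ F) u u) → All (zero ≢_) (edges G p) → ¬ IsCycle G p
    not-cycle acyc p avoid (ne , ue , us) with q , eqe , eqs ← walk-avoiding p avoid = acyc q
      ( (λ eq → ne (trans eqe (cong (List.map suc) eq)))
      , Unique.map⁻ (subst Unique eqe ue)
      , subst Unique eqs us )

    acyclic-outside : Acyclic G′ F → Acyclic G (outside ∷ F)
    acyclic-outside acyc p = not-cycle acyc p (avoid p)
      where
      avoid : ∀ {u v} (p : Walk G (outside ∷ F) u v) → All (zero ≢_) (edges G p)
      avoid ε = []
      avoid ((suc e , there _ , _) ◅ p) = (λ ()) ∷ avoid p

    private
      -- Distinctness of the edges guarantees that what follows the first crossing stays in the
      -- smaller graph. For a closed walk the two pieces then join into a walk between the ends of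
      -- the edge.
      once : ∀ {x u v} (p : Walk G (x ∷ F) u v) → Unique (edges G p) → All (zero ≢_) (edges G p) ⊎ Through u v
      once ε _ = inj₁ []
      once ((zero , _ , inj₁ refl) ◅ p) (avoid ∷ _) = inj₂ (inj₁ (ε , proj₁ (walk-avoiding p avoid)))
      once ((zero , _ , inj₂ refl) ◅ p) (avoid ∷ _) = inj₂ (inj₂ (ε , proj₁ (walk-avoiding p avoid)))
      once ((suc e , there e∈F , j) ◅ p) (_ ∷ ue) with once p ue
      ... | inj₁ avoid          = inj₁ ((λ ()) ∷ avoid)
      ... | inj₂ (inj₁ (q , r)) = inj₂ (inj₁ ((e , e∈F , j) ◅ q , r))
      ... | inj₂ (inj₂ (q , r)) = inj₂ (inj₂ ((e , e∈F , j) ◅ q , r))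

    acyclic-inside : Acyclic G′ F → ¬ Walk G′ F a b → Acyclic G (inside ∷ F)
    acyclic-inside acyc a≁b p cyc with once p (proj₁ (proj₂ cyc))
    ... | inj₁ avoid          = not-cycle acyc p avoid cyc
    ... | inj₂ (inj₁ (q , r)) = a≁b (walk-sym G′ (r ◅◅ q))
    ... | inj₂ (inj₂ (q , r)) = a≁b (r ◅◅ q)

    -- The connecting walk is first made a path, since a cycle may repeat neither edges nor
    -- vertices. The empty path gives the cycle of length 1 at a loop.
    cyclic-inside : Walk G′ F a b → ¬ Acyclic G (inside ∷ F)
    cyclic-inside w acyc with p , π ← path G′ w = acyc ((zero , here , inj₂ refl) ◅ walk-lift p)
      ( (λ ())
      , subst (λ es → Unique (zero ∷ es)) (sym (edges-lift p))
          (All.map⁺ (All.universal (λ _ ()) (edges G′ p)) ∷ unique-map-suc (edges-unique G′ p π))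
      , subst (λ us → Unique (b ∷ us)) (sym (sources-lift p)) (end∉sources G′ p π ∷ sources-unique G′ p π) )

  -- Merging two classes of a labelling.

  module _ {r} (s : Fin (suc r)) {t : Fin (suc (suc r))} (t≢ : t ≢ suc s) where

    -- Identifies suc s with t and closes the gap left by suc s.
    merge : Fin (suc (suc r)) → Fin (suc r)
    merge x with x ≟ suc s
    ... | yes _ = punchOut (t≢ ∘ sym)
    ... | no x≢ = punchOut (x≢ ∘ sym)

    -- Together with `merge-other` this determines `merge`, because `punchIn (suc s)` is injective;
    -- the facts below are read off from these two equations.
    merge-suc : punchIn (suc s) (merge (suc s)) ≡ t
    merge-suc with suc s ≟ suc s
    ... | yes _  = punchIn-punchOut _
    ... | no s≢s = contradiction refl s≢s

    merge-other : ∀ {x} → x ≢ suc s → punchIn (suc s) (merge x) ≡ x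
    merge-other {x} x≢ with x ≟ suc s
    ... | yes x≡ = contradiction x≡ x≢
    ... | no _   = punchIn-punchOut _

    merge-identifies : merge t ≡ merge (suc s)
    merge-identifies = punchIn-injective (suc s) _ _ (trans (merge-other t≢) (sym merge-suc))

    merge-punchIn : ∀ y → merge (punchIn (suc s) y) ≡ y
    merge-punchIn y = punchIn-injective (suc s) _ _ (merge-other (punchInᵢ≢i (suc s) y))

    merge-zero : merge zero ≡ zero
    merge-zero = merge-punchIn zero

    merge-injective : ∀ {x y} → merge x ≡ merge y → x ≡ y ⊎ ((x ≡ t × y ≡ suc s) ⊎ (x ≡ suc s × y ≡ t))
    merge-injective {x} {y} eq = go (x ≟ suc s) (y ≟ suc s)
      where
      go : Dec (x ≡ suc s) → Dec (y ≡ suc s) → x ≡ y ⊎ ((x ≡ t × y ≡ suc s) ⊎ (x ≡ suc s × y ≡ t))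
      go (yes refl) (yes refl) = inj₁ refl
      go (yes refl) (no y≢)    = inj₂ (inj₂ (refl , trans (sym (merge-other y≢)) (trans (cong (punchIn (suc s)) (sym eq)) merge-suc)))
      go (no x≢)    (yes refl) = inj₂ (inj₁ (trans (sym (merge-other x≢)) (trans (cong (punchIn (suc s)) eq) merge-suc) , refl))
      go (no x≢)    (no y≢)    = inj₁ (trans (sym (merge-other x≢)) (trans (cong (punchIn (suc s)) eq) (merge-other y≢)))

  EndsAt : ∀ {r} → Fin (suc (suc r)) → Fin (suc (suc r)) → Fin (suc r) → Fin (suc (suc r)) → Set
  EndsAt x y s t = (x ≡ t × y ≡ suc s) ⊎ (x ≡ suc s × y ≡ t)

  merge-ends : ∀ {r x y s t} (t≢ : t ≢ suc {suc r} s) → EndsAt x y s t → merge s t≢ x ≡ merge s t≢ y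
  merge-ends {s = s} t≢ (inj₁ (refl , refl)) = merge-identifies s t≢
  merge-ends {s = s} t≢ (inj₂ (refl , refl)) = sym (merge-identifies s t≢)

  -- Of two distinct labels at least one is nonzero. That one is absorbed, so label zero, the class
  -- of the ground, survives every merge.
  distinct-ends : ∀ {r} (x y : Fin (suc (suc r))) → x ≢ y → ∃₂ λ s t → t ≢ suc s × EndsAt x y s t
  distinct-ends x       (suc s) x≢y = s , x , x≢y , inj₁ (refl , refl)
  distinct-ends zero    zero    x≢y = contradiction refl x≢y
  distinct-ends (suc s) zero    x≢y = s , zero , (λ ()) , inj₂ (refl , refl)

  -- Chain ℓ es ℓ′: the edges es, taken from the last to the first, each join two
  -- different classes of the labelling ℓ as merged so far; the result is ℓ′.
  data Chain {n r₀} (ℓ : Fin n → Fin (suc r₀)) : ∀ {l} → Vec (Fin n × Fin n) l → ∀ {r} → (Fin n → Fin (suc r)) → Set where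
    done : Chain ℓ [] ℓ
    join : ∀ {l} {es : Vec _ l} {r} {ℓ′ : Fin n → Fin (suc (suc r))} {u v s t} (t≢ : t ≢ suc s) →
            EndsAt (ℓ′ u) (ℓ′ v) s t → Chain ℓ es ℓ′ → Chain ℓ ((u , v) ∷ es) (merge s t≢ ∘ ℓ′)

  -- Only the edges behind the loop must form a chain. Those in front of it are arbitrary, since a
  -- single row that contracts to 0 makes the determinant vanish.
  data Dependent {n r₀} (ℓ : Fin n → Fin (suc r₀)) : ∀ {l} → Vec (Fin n × Fin n) l → Set where
    loop  : ∀ {l} {es : Vec _ l} {r} {ℓ′ : Fin n → Fin (suc r)} {u v} → Chain ℓ es ℓ′ → ℓ′ u ≡ ℓ′ v → Dependent ℓ ((u , v) ∷ es)
    later : ∀ {l} {es : Vec _ l} {e} → Dependent ℓ es → Dependent ℓ (e ∷ es)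

  edgeList : ∀ {n m} → Multigraph n m → (F : Subset m) → Vec (Fin n × Fin n) ∣ F ∣
  edgeList G []          = []
  edgeList G (true ∷ F)  = G zero ∷ edgeList (G ∘ suc) F
  edgeList G (false ∷ F) = edgeList (G ∘ suc) F

  lookup-edgeList : ∀ {n m} (G : Multigraph n m) F i → Vec.lookup (edgeList G F) i ≡ G (elements F i)
  lookup-edgeList G (true ∷ F)  zero    = refl
  lookup-edgeList G (true ∷ F)  (suc i) = lookup-edgeList (G ∘ suc) F i
  lookup-edgeList G (false ∷ F) i       = lookup-edgeList (G ∘ suc) F i

  -- A basis of the graphic matroid of `G` after contraction of the classes of `ℓ`: `maximal` says
  -- that every edge of `G` has become a loop.
  record Extension {n r₀ m} (ℓ : Fin n → Fin (suc r₀)) (G : Multigraph n m) : Set where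
    field
      forest     : Subset m
      {rank}     : ℕ
      label      : Fin n → Fin (suc rank)
      chain      : Chain ℓ (edgeList G forest) label
      surjective : ∀ i → ∃ λ v → label v ≡ i
      maximal    : ∀ e → label (proj₁ (G e)) ≡ label (proj₂ (G e))

  greedy : ∀ {n r₀ m} (ℓ : Fin n → Fin (suc r₀)) → (∀ i → ∃ λ v → ℓ v ≡ i) → (G : Multigraph n m) → Extension ℓ G
  greedy {m = zero} ℓ ℓ-surjective G = record
    { forest = [] ; label = ℓ ; chain = done ; surjective = ℓ-surjective ; maximal = λ () }
  greedy {m = suc m} ℓ ℓ-surjective G = go (greedy ℓ ℓ-surjective (G ∘ suc))
    where
    go : Extension ℓ (G ∘ suc) → Extension ℓ G
    go ξ with Extension.label ξ (proj₁ (G zero)) ≟ Extension.label ξ (proj₂ (G zero))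
    ... | yes eq = record
      { forest = outside ∷ forest ; label = label ; chain = chain ; surjective = surjective
      ; maximal = λ { zero → eq ; (suc e) → maximal e } }
      where
      open Extension ξ
    go ξ@(record { rank = zero }) | no ne with Extension.label ξ (proj₁ (G zero)) | Extension.label ξ (proj₂ (G zero))
    ... | zero | zero = contradiction refl ne
    go ξ@(record { rank = suc r }) | no ne with s , t , t≢ , ends ← distinct-ends _ _ ne = record
      { forest = inside ∷ forest ; label = merge s t≢ ∘ label ; chain = join t≢ ends chain
      ; surjective = λ y → let v , eq = surjective (punchIn (suc s) y) in v , trans (cong (merge s t≢) eq) (merge-punchIn s t≢ y)
      ; maximal = λ { zero → merge-ends t≢ ends ; (suc e) → cong (merge s t≢) (maximal e) } }
      where
      open Extension ξ

  -- A labelling that does not change along edges is constant along walks, so in a connected graph a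
  -- second label could not be attained.
  connected⇒rank-zero : ∀ {n m r} {G : Multigraph n m} → Connected G ⊤ → (ℓ : Fin n → Fin (suc r)) →
    (∀ i → ∃ λ v → ℓ v ≡ i) → (∀ e → ℓ (proj₁ (G e)) ≡ ℓ (proj₂ (G e))) → r ≡ zero
  connected⇒rank-zero {r = zero}  conn ℓ onto constant = refl
  connected⇒rank-zero {r = suc r} {G} conn ℓ onto constant with u , u0 ← onto zero | v , v1 ← onto (suc zero) =
    contradiction (trans (sym u0) (trans (along (conn u v)) v1)) λ ()
    where
    along : ∀ {u v} → Walk G ⊤ u v → ℓ u ≡ ℓ v
    along ε = refl
    along ((e , _ , inj₁ eq) ◅ p) = trans (trans (cong (ℓ ∘ proj₁) (sym eq)) (trans (constant e) (cong (ℓ ∘ proj₂) eq))) (along p)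
    along ((e , _ , inj₂ eq) ◅ p) = trans (trans (cong (ℓ ∘ proj₂) (sym eq)) (trans (sym (constant e)) (cong (ℓ ∘ proj₁) eq))) (along p)

  -- Acyclicity is decided together with a certificate that evaluates the incidence rows of `F`: a
  -- chain will yield a sign, a dependence 0.
  record Reduction {n r₀ m} (ℓ : Fin n → Fin (suc r₀)) (g : Fin n) (G : Multigraph n m) (F : Subset m) : Set where
    field
      {rank}         : ℕ
      comp           : Fin n → Fin (suc rank)
      isComponentMap : IsComponentMap G F comp
      ground         : comp g ≡ zero
      status         : (Acyclic G F × Chain ℓ (edgeList G F) comp) ⊎ (¬ Acyclic G F × Dependent ℓ (edgeList G F))

  module _ {n r₀} (ℓ : Fin n → Fin (suc r₀)) (g : Fin n) (ℓ-injective : ∀ {u v} → ℓ u ≡ ℓ v → u ≡ v)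
    (ℓ-surjective : ∀ i → ∃ λ v → ℓ v ≡ i) (ℓ-ground : ℓ g ≡ zero) where

    -- Edges are added from the last to the first. If the ends of the new edge already share a
    -- label, a walk joins them and the edge closes a cycle; otherwise merging their classes creates
    -- none. The bijective `ℓ` makes every vertex a class of its own at the start.
    reduce : ∀ {m} (G : Multigraph n m) F → Reduction ℓ g G F
    reduce G [] = record
      { comp = ℓ
      ; isComponentMap = ℓ-surjective , λ u v → mk⇔ (λ eq → subst (Walk G [] u) (ℓ-injective eq) ε)
          (λ { ε → refl ; ((() , _) ◅ _) })
      ; ground = ℓ-ground
      ; status = inj₁ ((λ { ε (ne , _) → ne refl ; ((() , _) ◅ _) _ }) , done)
      }
    reduce G (false ∷ F) = record
      { comp = comp
      ; isComponentMap = proj₁ isComponentMap , λ u v → mk⇔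
          (walk-lift G ∘ Equivalence.to (proj₂ isComponentMap u v)) (Equivalence.from (proj₂ isComponentMap u v) ∘ walk-drop G)
      ; ground = ground
      ; status = Sum.map (λ (acyc , c) → acyclic-outside G acyc , c) (λ (cyc , d) → cyc ∘ acyclic-tail G , d) status
      }
      where
      open Reduction (reduce (G ∘ suc) F)
    reduce G (true ∷ F) = go (reduce (G ∘ suc) F)
      where
      a = proj₁ (G zero)
      b = proj₂ (G zero)

      go : Reduction ℓ g (G ∘ suc) F → Reduction ℓ g G (true ∷ F)
      go ρ with Reduction.comp ρ a ≟ Reduction.comp ρ b
      ... | yes eq = record
        { comp = comp
        ; isComponentMap = proj₁ isComponentMap , λ u v → mk⇔ (walk-lift G ∘ Equivalence.to (kernel u v)) (from ∘ walk-split G)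
        ; ground = ground
        -- A loop is certified relative to a chain of the later edges; if these are already
        -- dependent, their own certificate is passed on instead.
        ; status = inj₂ (cyclic-inside G (Equivalence.to (kernel a b) eq) ,
            Sum.[ (λ (_ , c) → loop c eq) , (λ (_ , d) → later d) ] status)
        }
        where
        open Reduction ρ
        kernel = proj₂ isComponentMap
        from : ∀ {u v} → Walk (G ∘ suc) F u v ⊎ Through G u v → comp u ≡ comp v
        from (inj₁ p)              = Equivalence.from (kernel _ _) p
        from (inj₂ (inj₁ (p , q))) = trans (Equivalence.from (kernel _ _) p) (trans eq (Equivalence.from (kernel _ _) q))
        from (inj₂ (inj₂ (p , q))) = trans (Equivalence.from (kernel _ _) p) (trans (sym eq) (Equivalence.from (kernel _ _) q))
      go ρ@(record { rank = zero }) | no ne with Reduction.comp ρ a | Reduction.comp ρ b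
      ... | zero | zero = contradiction refl ne
      go ρ@(record { rank = suc r }) | no ne with s , t , t≢ , ends ← distinct-ends _ _ ne = record
        { comp = merge s t≢ ∘ comp
        ; isComponentMap = (λ y → let v , eq = proj₁ isComponentMap (punchIn (suc s) y) in
                             v , trans (cong (merge s t≢) eq) (merge-punchIn s t≢ y))
                         , λ u v → mk⇔ (walk-join G ∘ to ends ∘ merge-injective s t≢) (from ends ∘ walk-split G)
        ; ground = trans (cong (merge s t≢) ground) (merge-zero s t≢)
        ; status = Sum.map (λ (acyc , c) → acyclic-inside G acyc (ne ∘ Equivalence.from (kernel a b)) , join t≢ ends c)
                           (λ (cyc , d) → cyc ∘ acyclic-tail G , later d) status
        }
        where
        open Reduction ρ
        kernel = proj₂ isComponentMap
        to : ∀ {u v} → EndsAt (comp a) (comp b) s t →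
          comp u ≡ comp v ⊎ ((comp u ≡ t × comp v ≡ suc s) ⊎ (comp u ≡ suc s × comp v ≡ t)) →
          Walk (G ∘ suc) F u v ⊎ Through G u v
        to ends (inj₁ eq) = inj₁ (Equivalence.to (kernel _ _) eq)
        to (inj₁ (at , bs)) (inj₂ (inj₁ (ut , vs))) = inj₂ (inj₁ (Equivalence.to (kernel _ _) (trans ut (sym at)) , Equivalence.to (kernel _ _) (trans bs (sym vs))))
        to (inj₁ (at , bs)) (inj₂ (inj₂ (us , vt))) = inj₂ (inj₂ (Equivalence.to (kernel _ _) (trans us (sym bs)) , Equivalence.to (kernel _ _) (trans at (sym vt))))
        to (inj₂ (as , bt)) (inj₂ (inj₁ (ut , vs))) = inj₂ (inj₂ (Equivalence.to (kernel _ _) (trans ut (sym bt)) , Equivalence.to (kernel _ _) (trans as (sym vs))))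
        to (inj₂ (as , bt)) (inj₂ (inj₂ (us , vt))) = inj₂ (inj₁ (Equivalence.to (kernel _ _) (trans us (sym as)) , Equivalence.to (kernel _ _) (trans bt (sym vt))))
        M : ∀ {u v} → Walk (G ∘ suc) F u v → merge s t≢ (comp u) ≡ merge s t≢ (comp v)
        M p = cong (merge s t≢) (Equivalence.from (kernel _ _) p)
        from : ∀ {u v} → EndsAt (comp a) (comp b) s t → Walk (G ∘ suc) F u v ⊎ Through G u v → merge s t≢ (comp u) ≡ merge s t≢ (comp v)
        from ends (inj₁ p)              = M p
        from ends (inj₂ (inj₁ (p , q))) = trans (M p) (trans (merge-ends t≢ ends) (M q))
        from ends (inj₂ (inj₂ (p , q))) = trans (M p) (trans (sym (merge-ends t≢ ends)) (M q))

open Forests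

open import Data.Vec.Functional using (Vector; _∷_; _++_; [])
open import Data.Vec.Functional.Properties using (lookup-++ˡ; lookup-++ʳ; ++-cong)

-- Determinants of rectangular matrices over a commutative ring.

module Determinant {a ℓ} (R : CommutativeRing a ℓ) where

  open CommutativeRing R hiding (zero)
  open LinearAlgebra R
  open import Algebra.Properties.Ring ring using (-‿distribʳ-*; -1*x≈-x; -‿involutive; -0#≈0#; -‿+-comm)
  open import Algebra.Properties.Semiring.Exp semiring using (_^_)
  open import Algebra.Properties.Semiring.Sum semiring
    using (sum; sum-cong-≋; sum-replicate-zero; ∑-distrib-+; ∑-comm; *-distribˡ-sum; *-distribʳ-sum)
  open import Algebra.Solver.Ring.NaturalCoefficients.Default commutativeSemiring using (solve; _:+_; _:*_; _:=_)
  open import Relation.Binary.Reasoning.Setoid setoid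

  sgn : ∀ {k} → Fin k → Carrier
  sgn i = (- 1#) ^ toℕ i

  IsSign : Carrier → Set ℓ
  IsSign x = x ≈ 1# ⊎ x ≈ - 1#

  -1*-1≈1 : - 1# * - 1# ≈ 1#
  -1*-1≈1 = trans (-1*x≈-x (- 1#)) (-‿involutive 1#)

  isSign-square : ∀ {x} → IsSign x → x * x ≈ 1#
  isSign-square (inj₁ x≈1)  = trans (*-cong x≈1 x≈1) (*-identityˡ 1#)
  isSign-square (inj₂ x≈-1) = trans (*-cong x≈-1 x≈-1) -1*-1≈1

  isSign-* : ∀ {x y} → IsSign x → IsSign y → IsSign (x * y)
  isSign-* (inj₁ x≈1)  (inj₁ y≈1)  = inj₁ (trans (*-cong x≈1 y≈1) (*-identityˡ 1#))
  isSign-* (inj₁ x≈1)  (inj₂ y≈-1) = inj₂ (trans (*-cong x≈1 y≈-1) (*-identityˡ _))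
  isSign-* (inj₂ x≈-1) (inj₁ y≈1)  = inj₂ (trans (*-cong x≈-1 y≈1) (*-identityʳ _))
  isSign-* (inj₂ x≈-1) (inj₂ y≈-1) = inj₁ (trans (*-cong x≈-1 y≈-1) -1*-1≈1)

  isSign-resp : ∀ {x y} → x ≈ y → IsSign x → IsSign y
  isSign-resp x≈y = Sum.map (trans (sym x≈y)) (trans (sym x≈y))

  isSign-^ : ∀ n → IsSign ((- 1#) ^ n)
  isSign-^ zero    = inj₁ refl
  isSign-^ (suc n) = isSign-* (inj₂ refl) (isSign-^ n)

  sign-cancel : ∀ {e x y} → IsSign e → (e * x) * (e * y) ≈ x * y
  sign-cancel {e} {x} {y} e± = begin
    (e * x) * (e * y) ≈⟨ solve 3 (λ e x y → (e :* x) :* (e :* y) := (e :* e) :* (x :* y)) refl e x y ⟩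
    (e * e) * (x * y) ≈⟨ *-congʳ (isSign-square e±) ⟩
    1# * (x * y)      ≈⟨ *-identityˡ _ ⟩
    x * y             ∎

  -- Opaque, like rdet below, because unfolding would block the inference of the summand or the matrix.
  opaque
    ∑ : ∀ {n} → Vector Carrier n → Carrier
    ∑ = sum

    ∑≈sum : ∀ {n} (f : Vector Carrier n) → ∑ f ≈ sum f
    ∑≈sum f = refl

    ∑-empty : (f : Vector Carrier 0) → ∑ f ≈ 0#
    ∑-empty f = refl

    ∑-suc : ∀ {n} (f : Vector Carrier (suc n)) → ∑ f ≈ f zero + ∑ (f ∘ suc)
    ∑-suc f = refl

    ∑-cong : ∀ {n} {f g : Vector Carrier n} → (∀ i → f i ≈ g i) → ∑ f ≈ ∑ g
    ∑-cong = sum-cong-≋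

    ∑-zero : ∀ {n} {f : Vector Carrier n} → (∀ i → f i ≈ 0#) → ∑ f ≈ 0#
    ∑-zero {n} f≈0 = trans (sum-cong-≋ f≈0) (sum-replicate-zero n)

    ∑-+ : ∀ {n} (f g : Vector Carrier n) → ∑ (λ i → f i + g i) ≈ ∑ f + ∑ g
    ∑-+ = ∑-distrib-+

    ∑-∑ : ∀ {m n} (f : Fin m → Fin n → Carrier) → ∑ (λ i → ∑ λ j → f i j) ≈ ∑ (λ j → ∑ λ i → f i j)
    ∑-∑ = ∑-comm

    *-∑ : ∀ {n} x (f : Vector Carrier n) → x * ∑ f ≈ ∑ λ i → x * f i
    *-∑ = *-distribˡ-sum

    ∑-* : ∀ {n} x (f : Vector Carrier n) → ∑ f * x ≈ ∑ λ i → f i * x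
    ∑-* = *-distribʳ-sum

  ∑-one : (f : Vector Carrier 1) → ∑ f ≈ f zero
  ∑-one f = trans (∑-suc f) (trans (+-congˡ (∑-empty _)) (+-identityʳ _))

  ∑-single : ∀ {n} (f : Vector Carrier n) j → (∀ i → i ≢ j → f i ≈ 0#) → ∑ f ≈ f j
  ∑-single f zero    rest = trans (∑-suc f) (trans (+-congˡ (∑-zero λ i → rest (suc i) λ ())) (+-identityʳ _))
  ∑-single f (suc j) rest = trans (∑-suc f) (trans
    (+-cong (rest zero λ ()) (∑-single (f ∘ suc) j λ i i≢j → rest (suc i) λ { ≡.refl → i≢j ≡.refl }))
    (+-identityˡ _))

  ∑-↑ : ∀ k {l} (f : Vector Carrier (k ℕ.+ l)) → ∑ f ≈ ∑ (λ i → f (i ↑ˡ l)) + ∑ (λ i → f (k ↑ʳ i))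
  ∑-↑ zero    f = sym (trans (+-congʳ (∑-empty _)) (+-identityˡ _))
  ∑-↑ (suc k) f = trans (∑-suc f) (trans (+-congˡ (∑-↑ k (f ∘ suc))) (trans (sym (+-assoc _ _ _)) (+-congʳ (sym (∑-suc _)))))

  ∑-neg : ∀ {n} (f : Vector Carrier n) → ∑ (λ i → - f i) ≈ - ∑ f
  ∑-neg f = trans (∑-cong λ i → sym (-1*x≈-x (f i))) (trans (sym (*-∑ (- 1#) f)) (-1*x≈-x _))

  +-inverse-swap : ∀ x y → - (x + - y) ≈ y + - x
  +-inverse-swap x y = trans (sym (-‿+-comm x (- y))) (trans (+-congˡ (-‿involutive y)) (+-comm _ _))

  -- The determinant of a square matrix, and 0 for other shapes.
  opaque
    rdet : ∀ {k l} → Matrix k l → Carrier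
    rdet {zero}  {zero}  A = 1#
    rdet {zero}  {suc l} A = 0#
    rdet {suc k} {zero}  A = 0#
    rdet {suc k} {suc l} A = ∑ λ j → sgn j * (A zero j * rdet (λ i c → A (suc i) (punchIn j c)))

    rdet-empty : (A : Matrix 0 0) → rdet A ≈ 1#
    rdet-empty A = refl

    rdet-wide : ∀ {l} (A : Matrix 0 (suc l)) → rdet A ≈ 0#
    rdet-wide A = refl

    rdet-tall : ∀ {k} (A : Matrix (suc k) 0) → rdet A ≈ 0#
    rdet-tall A = refl

    rdet-expandRow : ∀ {k l} (A : Matrix (suc k) (suc l)) →
      rdet A ≈ ∑ λ j → sgn j * (A zero j * rdet (λ i c → A (suc i) (punchIn j c)))
    rdet-expandRow A = refl

    rdet-cong : ∀ {k l} {A B : Matrix k l} → A ≋ B → rdet A ≈ rdet B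
    rdet-cong {zero}  {zero}  A≋B = refl
    rdet-cong {zero}  {suc l} A≋B = refl
    rdet-cong {suc k} {zero}  A≋B = refl
    rdet-cong {suc k} {suc l} A≋B = ∑-cong λ j →
      *-congˡ {sgn j} (*-cong (A≋B zero j) (rdet-cong λ i c → A≋B (suc i) (punchIn j c)))

  rdet-cast : ∀ {k l k′ l′} (k≡k′ : k ≡ k′) (l≡l′ : l ≡ l′) {A : Matrix k l} {B : Matrix k′ l′} →
              (∀ i j → A i j ≈ B (cast k≡k′ i) (cast l≡l′ j)) → rdet A ≈ rdet B
  rdet-cast ≡.refl ≡.refl {B = B} h = rdet-cong λ i j →
    trans (h i j) (reflexive (≡.cong₂ B (cast-is-id ≡.refl i) (cast-is-id ≡.refl j)))

  det≈rdet : ∀ {k} (A : Matrix k k) → det A ≈ rdet A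
  det≈rdet {zero}  A = sym (rdet-empty A)
  det≈rdet {suc k} A = trans
    (sum-cong-≋ λ j → *-congˡ {sgn j} (*-congˡ {A zero j} (det≈rdet (λ i c → A (suc i) (punchIn j c)))))
    (trans (sym (∑≈sum _)) (sym (rdet-expandRow A)))

  zero-term : ∀ {x} s y → x ≈ 0# → s * (x * y) ≈ 0#
  zero-term s y x≈0 = trans (*-congˡ (trans (*-congʳ x≈0) (zeroˡ y))) (zeroʳ s)

  zero-term′ : ∀ {y} s x → y ≈ 0# → s * (x * y) ≈ 0#
  zero-term′ s x y≈0 = trans (*-congˡ (trans (*-congˡ y≈0) (zeroʳ x))) (zeroʳ s)

  rdet-nonsquare : ∀ {k l} (A : Matrix k l) → k ≢ l → rdet A ≈ 0#
  rdet-nonsquare {zero}  {zero}  A k≢l = contradiction ≡.refl k≢l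
  rdet-nonsquare {zero}  {suc l} A k≢l = rdet-wide A
  rdet-nonsquare {suc k} {zero}  A k≢l = rdet-tall A
  rdet-nonsquare {suc k} {suc l} A k≢l = trans (rdet-expandRow A) (∑-zero λ j →
    zero-term′ (sgn j) (A zero j) (rdet-nonsquare (λ i c → A (suc i) (punchIn j c)) λ k≡l → k≢l (≡.cong suc k≡l)))

  rdet-zeroRow : ∀ {k l} (A : Matrix (suc k) l) → (∀ j → A zero j ≈ 0#) → rdet A ≈ 0#
  rdet-zeroRow {l = zero}  A h = rdet-tall A
  rdet-zeroRow {l = suc l} A h = trans (rdet-expandRow A) (∑-zero λ j → zero-term (sgn j) _ (h j))

  -- Induction: expand along the first row, every minor but the first along its own first column,
  -- and exchange the two sums; for each row of the matrix the inner sum is then a row expansion of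
  -- a column minor. The corner term is common to both sides. With a single row or column and a
  -- non-square shape, both sides are 0.
  rdet-expandCol : ∀ {k l} (A : Matrix (suc k) (suc l)) →
    rdet A ≈ ∑ λ i → sgn i * (A i zero * rdet (λ r c → A (punchIn i r) (suc c)))
  rdet-expandCol {zero}  {zero}  A = trans (rdet-expandRow A) (trans (∑-one _) (trans
    (*-congˡ (*-congˡ (trans (rdet-empty _) (sym (rdet-empty _))))) (sym (∑-one _))))
  rdet-expandCol {zero}  {suc l} A = trans (rdet-nonsquare A λ ()) (sym (∑-zero λ i → zero-term′ (sgn i) (A i zero) (rdet-nonsquare _ λ ())))
  rdet-expandCol {suc k} {zero}  A = trans (rdet-nonsquare A λ ()) (sym (∑-zero λ i → zero-term′ (sgn i) (A i zero) (rdet-nonsquare _ λ ())))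
  rdet-expandCol {suc k} {suc l} A = trans (rdet-expandRow A) (trans (∑-suc _) (trans (+-congˡ (begin
    ∑ (λ j → sgn (suc j) * (α j * rdet (minorʳ j)))
      ≈⟨ ∑-cong (λ j → *-congˡ {sgn (suc j)} (*-congˡ {α j} (rdet-expandCol (minorʳ j)))) ⟩
    ∑ (λ j → sgn (suc j) * (α j * ∑ λ i → sgn i * (β i * X i j)))
      ≈⟨ ∑-cong (λ j → pull (sgn (suc j)) (α j) (λ i → sgn i * (β i * X i j))) ⟩
    ∑ (λ j → ∑ λ i → sgn (suc j) * (α j * (sgn i * (β i * X i j))))
      ≈⟨ ∑-∑ (λ j i → sgn (suc j) * (α j * (sgn i * (β i * X i j)))) ⟩
    ∑ (λ i → ∑ λ j → sgn (suc j) * (α j * (sgn i * (β i * X i j))))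
      ≈⟨ ∑-cong (λ i → ∑-cong λ j → solve 6 (λ m s t a b x →
           (m :* s) :* (a :* (t :* (b :* x))) := (m :* t) :* (b :* (s :* (a :* x)))) refl (- 1#) (sgn j) (sgn i) (α j) (β i) (X i j)) ⟩
    ∑ (λ i → ∑ λ j → sgn (suc i) * (β i * (sgn j * (α j * X i j))))
      ≈⟨ ∑-cong (λ i → pull (sgn (suc i)) (β i) (λ j → sgn j * (α j * X i j))) ⟨
    ∑ (λ i → sgn (suc i) * (β i * ∑ λ j → sgn j * (α j * X i j)))
      ≈⟨ ∑-cong (λ i → *-congˡ {sgn (suc i)} (*-congˡ {β i} (rdet-expandRow _))) ⟨
    ∑ (λ i → sgn (suc i) * (β i * rdet λ r c → A (punchIn (suc i) r) (suc c))) ∎)) (sym (∑-suc _))))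
    where
    α = λ j → A zero (suc j)
    β = λ i → A (suc i) zero
    minorʳ : Fin (suc l) → Matrix (suc k) (suc l)
    minorʳ j i c = A (suc i) (punchIn (suc j) c)
    X = λ i j → rdet (λ r c → A (suc (punchIn i r)) (suc (punchIn j c)))
    pull : ∀ {n} s x (f : Vector Carrier n) → s * (x * ∑ f) ≈ ∑ (λ i → s * (x * f i))
    pull s x f = trans (*-congˡ (*-∑ x f)) (*-∑ s _)

  rdet-ᵀ : ∀ {k l} (A : Matrix k l) → rdet A ≈ rdet (A ᵀ)
  rdet-ᵀ {zero}  {zero}  A = trans (rdet-empty A) (sym (rdet-empty (A ᵀ)))
  rdet-ᵀ {zero}  {suc l} A = trans (rdet-wide A) (sym (rdet-tall (A ᵀ)))
  rdet-ᵀ {suc k} {zero}  A = trans (rdet-tall A) (sym (rdet-wide (A ᵀ)))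
  rdet-ᵀ {suc k} {suc l} A = trans (rdet-expandRow A) (trans
    (∑-cong λ j → *-congˡ {sgn j} (*-congˡ {A zero j} (rdet-ᵀ (λ i c → A (suc i) (punchIn j c)))))
    (sym (rdet-expandCol (A ᵀ))))

  rdet-zeroCol : ∀ {k l} (A : Matrix k (suc l)) → (∀ i → A i zero ≈ 0#) → rdet A ≈ 0#
  rdet-zeroCol A h = trans (rdet-ᵀ A) (rdet-zeroRow (A ᵀ) h)

  rdet-∷-+ : ∀ {k l} (x y : Vector Carrier l) (M : Matrix k l) →
             rdet ((λ j → x j + y j) ∷ M) ≈ rdet (x ∷ M) + rdet (y ∷ M)
  rdet-∷-+ {l = zero}  x y M = trans (rdet-tall _) (sym (trans (+-cong (rdet-tall _) (rdet-tall _)) (+-identityˡ 0#)))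
  rdet-∷-+ {l = suc l} x y M = trans (rdet-expandRow _) (trans
    (∑-cong λ j → solve 4 (λ s x y m → s :* ((x :+ y) :* m) := s :* (x :* m) :+ s :* (y :* m)) refl
      (sgn j) (x j) (y j) (rdet λ i c → M i (punchIn j c)))
    (trans (∑-+ _ _) (+-cong (sym (rdet-expandRow (x ∷ M))) (sym (rdet-expandRow (y ∷ M))))))

  -- Laplace expansion reduces a proportionality of the remaining rows to one
  -- that holds after every choice of columns.
  rdet-∷-scale : ∀ {k k′ l} e (x : Vector Carrier l) (U : Matrix k l) (V : Matrix k′ l) →
    (∀ {l′} (h : Fin l′ → Fin l) → rdet (λ i → U i ∘ h) ≈ e * rdet (λ i → V i ∘ h)) →
    rdet (x ∷ U) ≈ e * rdet (x ∷ V)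
  rdet-∷-scale {l = zero}  e x U V h = trans (rdet-tall _) (sym (trans (*-congˡ (rdet-tall _)) (zeroʳ e)))
  rdet-∷-scale {l = suc l} e x U V h = trans (rdet-expandRow _) (trans
    (∑-cong λ j → trans (*-congˡ {sgn j} (*-congˡ {x j} (h (punchIn j))))
      (solve 4 (λ s x e v → s :* (x :* (e :* v)) := e :* (s :* (x :* v))) refl (sgn j) (x j) e _))
    (trans (sym (*-∑ e _)) (*-congˡ (sym (rdet-expandRow (x ∷ V))))))

  rdet-∷-* : ∀ {k l} b (x : Vector Carrier l) (M : Matrix k l) →
             rdet ((λ j → b * x j) ∷ M) ≈ b * rdet (x ∷ M)
  rdet-∷-* {l = zero}  b x M = trans (rdet-tall _) (sym (trans (*-congˡ (rdet-tall _)) (zeroʳ b)))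
  rdet-∷-* {l = suc l} b x M = trans (rdet-expandRow _) (trans
    (∑-cong λ j → solve 4 (λ s b x m → s :* ((b :* x) :* m) := b :* (s :* (x :* m))) refl
      (sgn j) b (x j) (rdet λ i c → M i (punchIn j c)))
    (trans (sym (*-∑ b _)) (*-congˡ (sym (rdet-expandRow (x ∷ M))))))

  rdet-∷-∑ : ∀ {n k l} (x : Fin n → Vector Carrier l) (M : Matrix k l) →
               rdet ((λ j → ∑ λ i → x i j) ∷ M) ≈ ∑ λ i → rdet (x i ∷ M)
  rdet-∷-∑ {zero}  x M = trans (rdet-zeroRow ((λ j → ∑ λ i → x i j) ∷ M) λ _ → ∑-empty _) (sym (∑-empty _))
  rdet-∷-∑ {suc n} x M = trans (rdet-cong λ { zero j → ∑-suc _ ; (suc i) j → refl }) (trans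
    (rdet-∷-+ (x zero) (λ j → ∑ λ i → x (suc i) j) M) (trans (+-congˡ (rdet-∷-∑ (x ∘ suc) M)) (sym (∑-suc _))))

  rdet-∷-cong : ∀ {k k′ l} (x : Vector Carrier l) (U : Matrix k l) (V : Matrix k′ l) →
    (∀ {l′} (h : Fin l′ → Fin l) → rdet (λ i → U i ∘ h) ≈ rdet (λ i → V i ∘ h)) →
    rdet (x ∷ U) ≈ rdet (x ∷ V)
  rdet-∷-cong x U V h = trans (rdet-∷-scale 1# x U V λ g → trans (h g) (sym (*-identityˡ _))) (*-identityˡ _)

  rdet-≗ : ∀ {k l} {A B : Matrix k l} → (∀ i → A i ≡ B i) → rdet A ≈ rdet B
  rdet-≗ A≗B = rdet-cong λ i j → reflexive (≡.cong (λ f → f j) (A≗B i))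

  -- The common source of `rdet-equalRows` and `rdet-swap`. The terms that delete neither of the
  -- first two rows have coefficients free of `x` and `y` and again begin with these two rows, one
  -- column shorter, which permits induction on the columns.
  rdet-∷∷-expandCol : ∀ {k l} (M : Matrix k (suc l)) →
    ∃ λ (A : Fin k → Carrier) → ∃ λ (N : Fin k → ∃ λ k′ → Matrix k′ l) →
    ∀ x y → rdet (x ∷ y ∷ M) ≈
      (x zero * rdet (y ∘ suc ∷ (λ r → M r ∘ suc)) + - (y zero * rdet (x ∘ suc ∷ (λ r → M r ∘ suc))))
      + ∑ λ i → A i * rdet (x ∘ suc ∷ y ∘ suc ∷ proj₂ (N i))
  rdet-∷∷-expandCol {k} {l} M = (λ i → sgn (suc (suc i)) * M i zero) , N , λ x y → begin
    rdet (x ∷ y ∷ M) ≈⟨ rdet-expandCol (x ∷ y ∷ M) ⟩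
    ∑ _ ≈⟨ trans (∑-suc _) (+-congˡ (∑-suc _)) ⟩
    _ + (_ + ∑ _) ≈⟨ +-assoc _ _ _ ⟨
    (_ + _) + ∑ _ ≈⟨ +-cong (+-cong (first x y) (second x y))
                              (∑-cong λ i → trans (sym (*-assoc _ _ _)) (*-congˡ {sgn (suc (suc i)) * M i zero} (rest x y M i))) ⟩
    _ ∎
    where
    N : ∀ {k} {M : Matrix k (suc l)} → Fin k → ∃ λ k′ → Matrix k′ l
    N {suc k} {M} i = k , λ r c → M (punchIn i r) (suc c)
    first : ∀ x y → 1# * (x zero * rdet (λ r c → (y ∷ M) r (suc c))) ≈ x zero * rdet (y ∘ suc ∷ (λ r → M r ∘ suc))
    first x y = trans (*-identityˡ _) (*-congˡ (rdet-≗ λ { zero → ≡.refl ; (suc r) → ≡.refl }))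
    second : ∀ x y → (- 1# * 1#) * (y zero * rdet (λ r c → (x ∷ y ∷ M) (punchIn (suc zero) r) (suc c)))
                     ≈ - (y zero * rdet (x ∘ suc ∷ (λ r → M r ∘ suc)))
    second x y = trans (*-cong (*-identityʳ _) (*-congˡ (rdet-≗ λ { zero → ≡.refl ; (suc r) → ≡.refl }))) (-1*x≈-x _)
    rest : ∀ {k} x y (M : Matrix k (suc l)) i →
           rdet (λ r c → (x ∷ y ∷ M) (punchIn (suc (suc i)) r) (suc c)) ≈ rdet (x ∘ suc ∷ y ∘ suc ∷ proj₂ (N {M = M} i))
    rest {suc k} x y M i = rdet-≗ λ { zero → ≡.refl ; (suc zero) → ≡.refl ; (suc (suc r)) → ≡.refl }

  -- Proved directly, because over a general commutative ring antisymmetry gives only that twice the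
  -- determinant is 0. In the expansion the two special terms cancel and the others have equal rows
  -- again.
  rdet-equalRows : ∀ {k l} (x : Vector Carrier l) (M : Matrix k l) → rdet (x ∷ x ∷ M) ≈ 0#
  rdet-equalRows {l = zero}  x M = rdet-tall _
  rdet-equalRows {l = suc l} x M with A , N , expand ← rdet-∷∷-expandCol M = begin
    rdet (x ∷ x ∷ M) ≈⟨ expand x x ⟩
    _ + ∑ _        ≈⟨ +-cong (-‿inverseʳ _) (∑-zero λ i → trans (*-congˡ {A i} (rdet-equalRows (x ∘ suc) (proj₂ (N i)))) (zeroʳ _)) ⟩
    0# + 0#          ≈⟨ +-identityˡ 0# ⟩
    0#               ∎

  rdet-swap : ∀ {k l} (x y : Vector Carrier l) (M : Matrix k l) → rdet (x ∷ y ∷ M) ≈ - rdet (y ∷ x ∷ M)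
  rdet-swap {l = zero}  x y M = trans (rdet-tall _) (sym (trans (-‿cong (rdet-tall _)) -0#≈0#))
  rdet-swap {l = suc l} x y M with A , N , expand ← rdet-∷∷-expandCol M = begin
    rdet (x ∷ y ∷ M) ≈⟨ expand x y ⟩
    (p + - q) + ∑ (λ i → A i * S x y i)
      ≈⟨ +-cong (sym (+-inverse-swap q p)) (∑-cong λ i → trans (*-congˡ {A i} (rdet-swap (x ∘ suc) (y ∘ suc) (proj₂ (N i)))) (sym (-‿distribʳ-* _ _))) ⟩
    - (q + - p) + ∑ (λ i → - (A i * S y x i))
      ≈⟨ +-congˡ (∑-neg λ i → A i * S y x i) ⟩
    - (q + - p) + - ∑ (λ i → A i * S y x i)
      ≈⟨ -‿+-comm _ _ ⟩
    - ((q + - p) + ∑ (λ i → A i * S y x i))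
      ≈⟨ -‿cong (expand y x) ⟨
    - rdet (y ∷ x ∷ M) ∎
    where
    p = x zero * rdet (y ∘ suc ∷ (λ r → M r ∘ suc))
    q = y zero * rdet (x ∘ suc ∷ (λ r → M r ∘ suc))
    S = λ x y i → rdet (x ∘ suc ∷ y ∘ suc ∷ proj₂ (N i))

-- Concatenated vectors.

module _ {b} {B : Set b} where

  ∷-η : ∀ {n} (f : Vector B (suc n)) i → f i ≡ (f zero ∷ f ∘ suc) i
  ∷-η f zero    = ≡.refl
  ∷-η f (suc i) = ≡.refl

  ++-suc : ∀ {m n} (U : Vector B (suc m)) (V : Vector B n) i → (U ++ V) (suc i) ≡ ((U ∘ suc) ++ V) i
  ++-suc {m} U V i with splitAt m i
  ... | inj₁ _ = ≡.refl
  ... | inj₂ _ = ≡.refl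

  ++-map : ∀ {c} {C : Set c} {m n} (f : B → C) (U : Vector B m) (V : Vector B n) i →
           f ((U ++ V) i) ≡ ((f ∘ U) ++ (f ∘ V)) i
  ++-map {m = m} f U V i with splitAt m i
  ... | inj₁ _ = ≡.refl
  ... | inj₂ _ = ≡.refl

  splitAt-punchIn : ∀ {m n} (j : Fin (suc m)) (c : Fin (m ℕ.+ n)) →
    splitAt (suc m) (punchIn (j ↑ˡ n) c) ≡ map₁ (punchIn j) (splitAt m c)
  splitAt-punchIn zero    c = ≡.refl
  splitAt-punchIn {suc m} (suc j) zero = ≡.refl
  splitAt-punchIn {suc m} {n} (suc j) (suc c) rewrite splitAt-punchIn {m} {n} j c with splitAt m c
  ... | inj₁ _ = ≡.refl
  ... | inj₂ _ = ≡.refl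

  ++-punchIn : ∀ {m n} (U : Vector B (suc m)) (V : Vector B n) j c →
    (U ++ V) (punchIn (j ↑ˡ n) c) ≡ ((U ∘ punchIn j) ++ V) c
  ++-punchIn {m} {n} U V j c rewrite splitAt-punchIn {m} {n} j c with splitAt m c
  ... | inj₁ _ = ≡.refl
  ... | inj₂ _ = ≡.refl

cast-↑ˡ : ∀ {n} (i : Fin n) → cast (≡.sym (ℕₚ.+-identityʳ n)) i ≡ i ↑ˡ 0
cast-↑ˡ zero    = ≡.refl
cast-↑ˡ (suc i) = ≡.cong suc (cast-↑ˡ i)

-- Row operations, block matrices, Schur complements and inverses.

module Block {a ℓ} (R : CommutativeRing a ℓ) where

  open CommutativeRing R hiding (zero)
  open LinearAlgebra R
  open Determinant R
  open import Algebra.Properties.Ring ring using (-‿distribˡ-*; -1*x≈-x)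
  open import Algebra.Properties.Semiring.Exp semiring using (_^_)
  open import Algebra.Solver.Ring.NaturalCoefficients.Default commutativeSemiring using (solve; _:*_; _:=_)
  open import Relation.Binary.Reasoning.Setoid setoid

  indicator-yes : ∀ {p} {A : Set p} (A? : Dec A) → A → indicator A? ≡ 1#
  indicator-yes (yes _) _ = ≡.refl
  indicator-yes (no ¬x) x = contradiction x ¬x

  indicator-no : ∀ {p} {A : Set p} (A? : Dec A) → ¬ A → indicator A? ≡ 0#
  indicator-no (yes x) ¬x = contradiction x ¬x
  indicator-no (no _)  _  = ≡.refl

  indicator-⇔ : ∀ {p q} {A : Set p} {B : Set q} (A? : Dec A) (B? : Dec B) → (A → B) → (B → A) → indicator A? ≡ indicator B?
  indicator-⇔ (yes x) B? f g = ≡.sym (indicator-yes B? (f x))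
  indicator-⇔ (no ¬x) B? f g = ≡.sym (indicator-no B? (¬x ∘ g))

  ∑-identityˡ : ∀ {n} (f : Vector Carrier n) i → ∑ (λ t → identity i t * f t) ≈ f i
  ∑-identityˡ f i = trans
    (∑-single _ i λ t t≢i → trans (*-congʳ (reflexive (indicator-no (i ≟ t) (t≢i ∘ ≡.sym)))) (zeroˡ _))
    (trans (*-congʳ (reflexive (indicator-yes (i ≟ i) ≡.refl))) (*-identityˡ _))

  ∑-identityʳ : ∀ {n} (f : Vector Carrier n) i → ∑ (λ t → f t * identity t i) ≈ f i
  ∑-identityʳ f i = trans
    (∑-single _ i λ t t≢i → trans (*-congˡ (reflexive (indicator-no (t ≟ i) t≢i))) (zeroʳ _))
    (trans (*-congˡ (reflexive (indicator-yes (i ≟ i) ≡.refl))) (*-identityʳ _))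

  rdet-++-suc : ∀ {m n l} (U : Matrix (suc m) l) (V : Matrix n l) → rdet (U ++ V) ≈ rdet (U zero ∷ ((U ∘ suc) ++ V))
  rdet-++-suc U V = rdet-≗ λ { zero → ≡.refl ; (suc i) → ++-suc U V i }

  rdet-++-∘ : ∀ {m n l l′} (U : Matrix m l) (V : Matrix n l) (h : Fin l′ → Fin l) →
              rdet (λ i → (U ++ V) i ∘ h) ≈ rdet ((λ i → U i ∘ h) ++ (λ i → V i ∘ h))
  rdet-++-∘ U V h = rdet-≗ (++-map (_∘ h) U V)

  rdet-rowToFront : ∀ {k l} j (M : Matrix (suc k) l) → rdet (M j ∷ (M ∘ punchIn j)) ≈ sgn j * rdet M
  rdet-rowToFront zero M = trans (rdet-≗ (≡.sym ∘ ∷-η M)) (sym (*-identityˡ _))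
  rdet-rowToFront {suc k} (suc j) M = begin
    rdet (M (suc j) ∷ (M ∘ punchIn (suc j)))
      ≈⟨ rdet-≗ (λ { zero → ≡.refl ; (suc zero) → ≡.refl ; (suc (suc i)) → ≡.refl }) ⟩
    rdet (M (suc j) ∷ M zero ∷ (M ∘ suc ∘ punchIn j))
      ≈⟨ rdet-swap (M (suc j)) (M zero) _ ⟩
    - rdet (M zero ∷ M (suc j) ∷ (M ∘ suc ∘ punchIn j))
      ≈⟨ -‿cong (rdet-∷-scale (sgn j) (M zero) _ (M ∘ suc) λ h → trans
           (rdet-≗ λ { zero → ≡.refl ; (suc i) → ≡.refl })
           (rdet-rowToFront j (λ i → M (suc i) ∘ h))) ⟩
    - (sgn j * rdet (M zero ∷ (M ∘ suc)))
      ≈⟨ trans (sym (-1*x≈-x _)) (sym (*-assoc _ _ _)) ⟩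
    sgn (suc j) * rdet (M zero ∷ (M ∘ suc))
      ≈⟨ *-congˡ {sgn (suc j)} (rdet-≗ (≡.sym ∘ ∷-η M)) ⟩
    sgn (suc j) * rdet M ∎

  rdet-fromFront : ∀ {k l} j (M : Matrix (suc k) l) → rdet M ≈ sgn j * rdet (M j ∷ (M ∘ punchIn j))
  rdet-fromFront j M = begin
    rdet M                                        ≈⟨ *-identityˡ _ ⟨
    1# * rdet M                                   ≈⟨ *-congʳ (isSign-square (isSign-^ (toℕ j))) ⟨
    (sgn j * sgn j) * rdet M                      ≈⟨ *-assoc _ _ _ ⟩
    sgn j * (sgn j * rdet M)                      ≈⟨ *-congˡ {sgn j} (rdet-rowToFront j M) ⟨
    sgn j * rdet (M j ∷ (M ∘ punchIn j))          ∎

  rdet-repeatedRow : ∀ {k l} (x : Vector Carrier l) (M : Matrix k l) i → (∀ j → M i j ≈ x j) → rdet (x ∷ M) ≈ 0#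
  rdet-repeatedRow {suc k} x M i Mᵢ≈x = begin
    rdet (x ∷ M)
      ≈⟨ rdet-∷-scale (sgn i) x M (M i ∷ (M ∘ punchIn i)) (λ h → trans (rdet-fromFront i (λ r → M r ∘ h))
           (*-congˡ {sgn i} (rdet-≗ λ { zero → ≡.refl ; (suc r) → ≡.refl }))) ⟩
    sgn i * rdet (x ∷ M i ∷ (M ∘ punchIn i))
      ≈⟨ *-congˡ {sgn i} (rdet-cong λ { zero j → refl ; (suc zero) j → Mᵢ≈x j ; (suc (suc r)) j → refl }) ⟩
    sgn i * rdet (x ∷ x ∷ (M ∘ punchIn i))
      ≈⟨ *-congˡ {sgn i} (rdet-equalRows x _) ⟩
    sgn i * 0#
      ≈⟨ zeroʳ _ ⟩
    0# ∎

  -- The first row is split by linearity, and each added multiple repeats a row of `M`. The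
  -- remaining rows of `T` are treated under the first one by `rdet-∷-cong`, that is, after every
  -- choice of columns.
  rdet-addRows : ∀ {m n l} (Y : Matrix m n) (T : Matrix m l) (M : Matrix n l) →
    rdet ((λ i j → T i j + ∑ λ r → Y i r * M r j) ++ M) ≈ rdet (T ++ M)
  rdet-addRows {zero}  Y T M = rdet-≗ λ i → ≡.refl
  rdet-addRows {suc m} {n} {l} Y T M = begin
    rdet (T′ ++ M)
      ≈⟨ rdet-++-suc T′ M ⟩
    rdet (T′ zero ∷ rest)
      ≈⟨ rdet-∷-+ (T zero) (λ j → ∑ λ r → Y zero r * M r j) rest ⟩
    rdet (T zero ∷ rest) + rdet ((λ j → ∑ λ r → Y zero r * M r j) ∷ rest)
      ≈⟨ +-congˡ (trans (rdet-∷-∑ (λ r j → Y zero r * M r j) rest) (∑-zero λ r → trans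
           (rdet-∷-* (Y zero r) (M r) rest)
           (trans (*-congˡ (rdet-repeatedRow (M r) rest (m ↑ʳ r) (λ j → reflexive
             (≡.cong (λ row → row j) (lookup-++ʳ (T′ ∘ suc) M r))))) (zeroʳ _)))) ⟩
    rdet (T zero ∷ rest) + 0#
      ≈⟨ +-identityʳ _ ⟩
    rdet (T zero ∷ rest)
      ≈⟨ rdet-∷-cong (T zero) rest ((T ∘ suc) ++ M) (λ h → trans (rdet-++-∘ (T′ ∘ suc) M h) (trans
           (rdet-addRows (Y ∘ suc) (λ i → T (suc i) ∘ h) (λ i → M i ∘ h)) (sym (rdet-++-∘ (T ∘ suc) M h)))) ⟩
    rdet (T zero ∷ ((T ∘ suc) ++ M))
      ≈⟨ rdet-++-suc T M ⟨
    rdet (T ++ M) ∎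
    where
    T′ : Matrix (suc m) l
    T′ i j = T i j + ∑ λ r → Y i r * M r j
    rest = (T′ ∘ suc) ++ M

  -- The sign stands before the quantifier over `M`, so one sign serves all matrices and cancels
  -- wherever it occurs twice.
  rdet-permuteRows : ∀ {k k′} (π : Permutation k k′) →
    ∃ λ e → IsSign e × ∀ {l} (M : Matrix k′ l) → rdet (M ∘ (π ⟨$⟩ʳ_)) ≈ e * rdet M
  rdet-permuteRows {zero}  {zero}  π = 1# , inj₁ refl , λ M → trans (rdet-≗ λ ()) (sym (*-identityˡ _))
  rdet-permuteRows {zero}  {suc _} π with () ← π ⟨$⟩ˡ zero
  rdet-permuteRows {suc _} {zero}  π with () ← π ⟨$⟩ʳ zero
  rdet-permuteRows {suc k} {suc k′} π with e , e± , h ← rdet-permuteRows (Perm.remove zero π) =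
    e * sgn j , isSign-* e± (isSign-^ (toℕ j)) , λ M → begin
      rdet (M ∘ (π ⟨$⟩ʳ_))
        ≈⟨ rdet-≗ (λ { zero → ≡.refl ; (suc i) → ≡.cong M (Perm.punchIn-permute π zero i) }) ⟩
      rdet (M j ∷ (M ∘ punchIn j ∘ (Perm.remove zero π ⟨$⟩ʳ_)))
        ≈⟨ rdet-∷-scale e (M j) _ (M ∘ punchIn j) (λ g → h (λ i → M (punchIn j i) ∘ g)) ⟩
      e * rdet (M j ∷ (M ∘ punchIn j))
        ≈⟨ *-congˡ (rdet-rowToFront j M) ⟩
      e * (sgn j * rdet M)
        ≈⟨ *-assoc _ _ _ ⟨
      (e * sgn j) * rdet M ∎
    where j = π ⟨$⟩ʳ zero

  rdet-permuteCols : ∀ {k k′} (π : Permutation k k′) →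
    ∃ λ e → IsSign e × ∀ {l} (M : Matrix l k′) → rdet (λ i → M i ∘ (π ⟨$⟩ʳ_)) ≈ e * rdet M
  rdet-permuteCols π with e , e± , h ← rdet-permuteRows π =
    e , e± , λ M → trans (rdet-ᵀ _) (trans (h (M ᵀ)) (*-congˡ (sym (rdet-ᵀ M))))

  -- Rows and columns contribute the same sign. An index set can therefore be reordered without
  -- computing one.
  rdet-conjugate : ∀ {k k′} (π : Permutation k k′) (M : Matrix k′ k′) →
    rdet (λ i j → M (π ⟨$⟩ʳ i) (π ⟨$⟩ʳ j)) ≈ rdet M
  rdet-conjugate π M with e , e± , h ← rdet-permuteRows π = begin
    rdet (λ i j → M (π ⟨$⟩ʳ i) (π ⟨$⟩ʳ j))  ≈⟨ h (λ i j → M i (π ⟨$⟩ʳ j)) ⟩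
    e * rdet (λ i j → M i (π ⟨$⟩ʳ j))       ≈⟨ *-congˡ (trans (rdet-ᵀ _) (trans (h (M ᵀ)) (*-congˡ (sym (rdet-ᵀ M))))) ⟩
    e * (e * rdet M)                        ≈⟨ *-assoc _ _ _ ⟨
    (e * e) * rdet M                        ≈⟨ *-congʳ (isSign-square e±) ⟩
    1# * rdet M                             ≈⟨ *-identityˡ _ ⟩
    rdet M                                  ∎

  block : ∀ {k l m n} → Matrix k m → Matrix k n → Matrix l m → Matrix l n → Matrix (k ℕ.+ l) (m ℕ.+ n)
  block A B C D = (λ i → A i ++ B i) ++ (λ i → C i ++ D i)

  𝟎 : ∀ {k l} → Matrix k l
  𝟎 _ _ = 0#

  ++-≈ : ∀ {m n} {u u′ : Vector Carrier m} {v v′ : Vector Carrier n} →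
         (∀ i → u i ≈ u′ i) → (∀ i → v i ≈ v′ i) → ∀ i → (u ++ v) i ≈ (u′ ++ v′) i
  ++-≈ {m} p q i with splitAt m i
  ... | inj₁ j = p j
  ... | inj₂ j = q j

  block-cong : ∀ {k l m n} {A A′ : Matrix k m} {B B′ : Matrix k n} {C C′ : Matrix l m} {D D′ : Matrix l n} →
    A ≋ A′ → B ≋ B′ → C ≋ C′ → D ≋ D′ → block A B C D ≋ block A′ B′ C′ D′
  block-cong {k} p q r s i with splitAt k i
  ... | inj₁ i = ++-≈ (p i) (q i)
  ... | inj₂ i = ++-≈ (r i) (s i)

  -- If `A` has more columns than rows, the right side is 0 while `C` could still make the matrix
  -- invertible, for example when `A` has no rows at all. Hence the alternative: `A` is square, or
  -- `C` vanishes.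
  rdet-lowerTriangular : ∀ {k l m n} (A : Matrix k m) (C : Matrix l m) (D : Matrix l n) →
    k ≡ m ⊎ (∀ i j → C i j ≈ 0#) → rdet (block A 𝟎 C D) ≈ rdet A * rdet D
  rdet-lowerTriangular {zero}  {m = zero}  A C D h =
    trans (rdet-≗ λ i → ≡.refl) (trans (sym (*-identityˡ _)) (*-congʳ (sym (rdet-empty A))))
  rdet-lowerTriangular {zero}  {m = suc m} A C D (inj₂ C≈0) =
    trans (rdet-zeroCol (block A 𝟎 C D) (λ i → C≈0 i zero)) (sym (trans (*-congʳ (rdet-wide A)) (zeroˡ _)))
  rdet-lowerTriangular {suc k} {m = zero}  A C D h =
    trans (rdet-zeroRow (block A 𝟎 C D) λ j → refl) (sym (trans (*-congʳ (rdet-tall A)) (zeroˡ _)))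
  rdet-lowerTriangular {suc k} {l} {suc m} {n} A C D h = begin
    rdet M
      ≈⟨ rdet-expandRow M ⟩
    ∑ (λ j → sgn j * (M zero j * rdet (λ i c → M (suc i) (punchIn j c))))
      ≈⟨ ∑-↑ (suc m) _ ⟩
    ∑ (λ j → sgn (j ↑ˡ n) * (M zero (j ↑ˡ n) * rdet (λ i c → M (suc i) (punchIn (j ↑ˡ n) c)))) + ∑ _
      ≈⟨ +-cong (∑-cong λ j → trans
           (*-cong (reflexive (≡.cong ((- 1#) ^_) (toℕ-↑ˡ j n)))
             (*-cong (reflexive (lookup-++ˡ (A zero) (λ _ → 0#) j))
               (trans (rdet-cong (minor j)) (rdet-lowerTriangular (minorA j) (λ i → C i ∘ punchIn j) D
                 (Sum.map ℕₚ.suc-injective (λ C≈0 i c → C≈0 i (punchIn j c)) h)))))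
           (solve 4 (λ s a b d → s :* (a :* (b :* d)) := (s :* (a :* b)) :* d) refl (sgn j) (A zero j) (rdet (minorA j)) (rdet D)))
         (∑-zero λ j → zero-term (sgn (suc m ↑ʳ j)) _ (reflexive (lookup-++ʳ (A zero) (λ (_ : Fin n) → 0#) j))) ⟩
    ∑ (λ j → (sgn j * (A zero j * rdet (minorA j))) * rdet D) + 0#
      ≈⟨ +-identityʳ _ ⟩
    ∑ (λ j → (sgn j * (A zero j * rdet (minorA j))) * rdet D)
      ≈⟨ ∑-* (rdet D) _ ⟨
    ∑ (λ j → sgn j * (A zero j * rdet (minorA j))) * rdet D
      ≈⟨ *-congʳ (rdet-expandRow A) ⟨
    rdet A * rdet D ∎
    where
    M = block A 𝟎 C D
    minorA : Fin (suc m) → Matrix k m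
    minorA j i c = A (suc i) (punchIn j c)
    minor : ∀ j i c → M (suc i) (punchIn (j ↑ˡ n) c) ≈ block (minorA j) 𝟎 (λ i → C i ∘ punchIn j) D i c
    minor j i c with splitAt k i
    ... | inj₁ i = reflexive (++-punchIn (A (suc i)) (λ _ → 0#) j c)
    ... | inj₂ i = reflexive (++-punchIn (C i) (D i) j c)

  -- Subtracting B D⁻¹ times the lower block row clears `B` and turns `A` into the Schur complement.
  rdet-schur : ∀ {k l} (A : Matrix k k) (B : Matrix k l) (C : Matrix l k) (D D⁻¹ : Matrix l l) →
    (∀ i j → ∑ (λ t → D⁻¹ i t * D t j) ≈ identity i j) →
    rdet (block A B C D) ≈ rdet (λ i j → A i j - ∑ λ t → ∑ (λ s → B i s * D⁻¹ s t) * C t j) * rdet D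
  rdet-schur {k} {l} A B C D D⁻¹ D⁻¹D≈1 = begin
    rdet (block A B C D)
      ≈⟨ rdet-addRows (λ i t → - BD⁻¹ i t) (λ i → A i ++ B i) (λ i → C i ++ D i) ⟨
    rdet ((λ i j → (A i ++ B i) j + ∑ λ t → - BD⁻¹ i t * (C t ++ D t) j) ++ (λ i → C i ++ D i))
      ≈⟨ rdet-cong cleared ⟩
    rdet (block S 𝟎 C D)
      ≈⟨ rdet-lowerTriangular S C D (inj₁ ≡.refl) ⟩
    rdet S * rdet D ∎
    where
    BD⁻¹ : Matrix k l
    BD⁻¹ i t = ∑ λ s → B i s * D⁻¹ s t
    S : Matrix k k
    S i j = A i j - ∑ λ t → BD⁻¹ i t * C t j
    -∑ : ∀ i (f : Vector Carrier l) → ∑ (λ t → - BD⁻¹ i t * f t) ≈ - ∑ (λ t → BD⁻¹ i t * f t)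
    -∑ i f = trans (∑-cong λ t → sym (-‿distribˡ-* _ _)) (∑-neg _)
    BD⁻¹D≈B : ∀ i j → ∑ (λ t → BD⁻¹ i t * D t j) ≈ B i j
    BD⁻¹D≈B i j = begin
      ∑ (λ t → BD⁻¹ i t * D t j)                      ≈⟨ ∑-cong (λ t → ∑-* (D t j) _) ⟩
      ∑ (λ t → ∑ λ s → (B i s * D⁻¹ s t) * D t j)     ≈⟨ ∑-∑ (λ t s → (B i s * D⁻¹ s t) * D t j) ⟩
      ∑ (λ s → ∑ λ t → (B i s * D⁻¹ s t) * D t j)     ≈⟨ ∑-cong (λ s → trans (∑-cong λ t → *-assoc _ _ _) (sym (*-∑ (B i s) _))) ⟩
      ∑ (λ s → B i s * ∑ λ t → D⁻¹ s t * D t j)       ≈⟨ ∑-cong (λ s → *-congˡ {B i s} (D⁻¹D≈1 s j)) ⟩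
      ∑ (λ s → B i s * identity s j)                  ≈⟨ ∑-identityʳ (B i) j ⟩
      B i j ∎
    clearedRow : ∀ i j → (A i ++ B i) j + ∑ (λ t → - BD⁻¹ i t * (C t ++ D t) j) ≈ (S i ++ (λ _ → 0#)) j
    clearedRow i j with splitAt k j
    ... | inj₁ j = +-congˡ (-∑ i λ t → C t j)
    ... | inj₂ j = trans (+-congˡ (trans (-∑ i λ t → D t j) (-‿cong (BD⁻¹D≈B i j)))) (-‿inverseʳ _)
    cleared : ((λ i j → (A i ++ B i) j + ∑ λ t → - BD⁻¹ i t * (C t ++ D t) j) ++ (λ i → C i ++ D i)) ≋ block S 𝟎 C D
    cleared i with splitAt k i
    ... | inj₁ i = clearedRow i
    ... | inj₂ i = λ j → refl

  -- The inverse is `u` times the adjugate. An entry of the product expands the determinant of `M`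
  -- with row `j` replaced by row `i`, which has a repeated row unless the two indices agree.
  rightInverse : ∀ {k} (M : Matrix k k) u → rdet M * u ≈ 1# →
    ∃ λ (N : Matrix k k) → ∀ i j → ∑ (λ t → M i t * N t j) ≈ identity i j
  rightInverse {zero}  M u h = (λ ()) , λ ()
  rightInverse {suc k} M u h = N , λ i j → begin
    ∑ (λ t → M i t * N t j)
      ≈⟨ ∑-cong (λ t → solve 5 (λ m u s r d → m :* (u :* (s :* (r :* d))) := (u :* s) :* (r :* (m :* d))) refl
           (M i t) u (sgn j) (sgn t) (rdet (minor j t))) ⟩
    ∑ (λ t → (u * sgn j) * (sgn t * (M i t * rdet (minor j t))))
      ≈⟨ *-∑ (u * sgn j) _ ⟨
    (u * sgn j) * ∑ (λ t → sgn t * (M i t * rdet (minor j t)))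
      ≈⟨ *-congˡ {u * sgn j} (rdet-expandRow (M i ∷ (M ∘ punchIn j))) ⟨
    (u * sgn j) * rdet (M i ∷ (M ∘ punchIn j))
      ≈⟨ cofactor i j ⟩
    identity i j ∎
    where
    minor : Fin (suc k) → Fin (suc k) → Matrix k k
    minor j t r c = M (punchIn j r) (punchIn t c)
    N : Matrix (suc k) (suc k)
    N t j = u * (sgn j * (sgn t * rdet (minor j t)))
    cofactor : ∀ i j → (u * sgn j) * rdet (M i ∷ (M ∘ punchIn j)) ≈ identity i j
    cofactor i j with i ≟ j
    ... | yes ≡.refl = begin
      (u * sgn i) * rdet (M i ∷ (M ∘ punchIn i)) ≈⟨ *-congˡ {u * sgn i} (rdet-rowToFront i M) ⟩
      (u * sgn i) * (sgn i * rdet M)             ≈⟨ solve 3 (λ u s d → (u :* s) :* (s :* d) := (s :* s) :* (d :* u)) refl u (sgn i) (rdet M) ⟩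
      (sgn i * sgn i) * (rdet M * u)             ≈⟨ *-cong (isSign-square (isSign-^ (toℕ i))) h ⟩
      1# * 1#                                    ≈⟨ *-identityˡ 1# ⟩
      1# ∎
    ... | no i≢j = trans (*-congˡ {u * sgn j} (rdet-repeatedRow (M i) (M ∘ punchIn j) (punchOut (i≢j ∘ ≡.sym))
                     λ c → reflexive (≡.cong (λ r → M r c) (punchIn-punchOut (i≢j ∘ ≡.sym))))) (zeroʳ _)

  -- The right inverse of the transpose gives a left inverse of `M`, and by associativity the two
  -- coincide.
  inverse : ∀ {k} (M : Matrix k k) u → rdet M * u ≈ 1# → ∃ λ (N : Matrix k k) →
    (∀ i j → ∑ (λ t → M i t * N t j) ≈ identity i j) × (∀ i j → ∑ (λ t → N i t * M t j) ≈ identity i j)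
  inverse M u h
    with N , MN≈1 ← rightInverse M u h | Lᵀ , MᵀLᵀ≈1 ← rightInverse (M ᵀ) u (trans (*-congʳ (sym (rdet-ᵀ M))) h) =
    N , MN≈1 , λ i j → trans (∑-cong λ t → *-congʳ (N≈L i t)) (LM≈1 i j)
    where
    LM≈1 : ∀ i j → ∑ (λ t → Lᵀ t i * M t j) ≈ identity i j
    LM≈1 i j = trans (∑-cong λ t → *-comm _ _) (trans (MᵀLᵀ≈1 j i) (reflexive (indicator-⇔ (j ≟ i) (i ≟ j) ≡.sym ≡.sym)))
    N≈L : ∀ i j → N i j ≈ Lᵀ j i
    N≈L i j = begin
      N i j                                             ≈⟨ ∑-identityˡ (λ s → N s j) i ⟨
      ∑ (λ s → identity i s * N s j)                    ≈⟨ ∑-cong (λ s → *-congʳ {N s j} (LM≈1 i s)) ⟨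
      ∑ (λ s → ∑ (λ t → Lᵀ t i * M t s) * N s j)        ≈⟨ ∑-cong (λ s → trans (∑-* (N s j) _) (∑-cong λ t → *-assoc _ _ _)) ⟩
      ∑ (λ s → ∑ λ t → Lᵀ t i * (M t s * N s j))        ≈⟨ ∑-∑ (λ s t → Lᵀ t i * (M t s * N s j)) ⟩
      ∑ (λ t → ∑ λ s → Lᵀ t i * (M t s * N s j))        ≈⟨ ∑-cong (λ t → *-∑ (Lᵀ t i) _) ⟨
      ∑ (λ t → Lᵀ t i * ∑ λ s → M t s * N s j)          ≈⟨ ∑-cong (λ t → *-congˡ {Lᵀ t i} (MN≈1 t j)) ⟩
      ∑ (λ t → Lᵀ t i * identity t j)                   ≈⟨ ∑-identityʳ (λ t → Lᵀ t i) j ⟩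
      Lᵀ j i ∎

+-swap : ∀ m n → Permutation (m ℕ.+ n) (n ℕ.+ m)
+-swap m n = ↔-sym +↔⊎ ↔-∘ (⊎-comm (Fin m) (Fin n) ↔-∘ +↔⊎)

++-swap : ∀ {b} {B : Set b} {m n} (U : Vector B n) (V : Vector B m) i →
          (U ++ V) (+-swap m n ⟨$⟩ʳ i) ≡ (V ++ U) i
++-swap {m = m} {n} U V i with splitAt m i
... | inj₁ i = ≡.cong Sum.[ U , V ] (splitAt-join n m (inj₂ i))
... | inj₂ i = ≡.cong Sum.[ U , V ] (splitAt-join n m (inj₁ i))

-- Rank-one updates and the Cauchy-Binet expansion.

module CauchyBinet {a ℓ} (R : CommutativeRing a ℓ) where

  open CommutativeRing R hiding (zero)
  open LinearAlgebra R
  open Determinant R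
  open Block R
  open import Algebra.Properties.Ring ring using (-‿distribˡ-*; -‿distribʳ-*; -1*x≈-x; -‿involutive; -0#≈0#)
  open import Algebra.Properties.CommutativeMonoid.Sum *-commutativeMonoid using () renaming (sum to product)
  open import Algebra.Properties.Semiring.Exp semiring using (_^_)
  open import Algebra.Solver.Ring.NaturalCoefficients.Default commutativeSemiring using (solve; _:*_; _:=_)
  open import Relation.Binary.Reasoning.Setoid setoid

  rdet-insert : ∀ {m n l} (U : Matrix m l) (x : Vector Carrier l) (V : Matrix n l) →
    rdet (U ++ (x ∷ V)) ≈ (- 1#) ^ m * rdet (x ∷ (U ++ V))
  rdet-insert {zero}  U x V = trans (rdet-≗ λ { zero → ≡.refl ; (suc i) → ≡.refl }) (sym (*-identityˡ _))
  rdet-insert {suc m} U x V = begin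
    rdet (U ++ (x ∷ V))
      ≈⟨ rdet-++-suc U (x ∷ V) ⟩
    rdet (U zero ∷ (U′ ++ (x ∷ V)))
      ≈⟨ rdet-∷-scale ((- 1#) ^ m) (U zero) _ (x ∷ (U′ ++ V)) (λ h → trans (rdet-++-∘ U′ (x ∷ V) h) (trans
           (rdet-cong λ i j → reflexive (≡.cong (λ f → f j) (++-congʳ h i))) (trans
           (rdet-insert (λ i → U′ i ∘ h) (x ∘ h) (λ i → V i ∘ h))
           (*-congˡ (rdet-≗ λ { zero → ≡.refl ; (suc i) → ≡.sym (++-map (_∘ h) U′ V i) }))))) ⟩
    (- 1#) ^ m * rdet (U zero ∷ x ∷ (U′ ++ V))
      ≈⟨ *-congˡ (trans (rdet-swap (U zero) x _) (sym (-1*x≈-x _))) ⟩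
    (- 1#) ^ m * (- 1# * rdet (x ∷ U zero ∷ (U′ ++ V)))
      ≈⟨ solve 3 (λ s m d → s :* (m :* d) := (m :* s) :* d) refl ((- 1#) ^ m) (- 1#) _ ⟩
    (- 1#) ^ suc m * rdet (x ∷ U zero ∷ (U′ ++ V))
      ≈⟨ *-congˡ (rdet-≗ λ { zero → ≡.refl ; (suc zero) → ≡.refl ; (suc (suc i)) → ≡.sym (++-suc U V i) }) ⟩
    (- 1#) ^ suc m * rdet (x ∷ (U ++ V)) ∎
    where
    U′ = U ∘ suc
    ++-congʳ : ∀ {l′} (h : Fin l′ → Fin _) i →
      ((λ i → U′ i ∘ h) ++ (λ i → (x ∷ V) i ∘ h)) i ≡ ((λ i → U′ i ∘ h) ++ ((x ∘ h) ∷ (λ i → V i ∘ h))) i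
    ++-congʳ h i with splitAt m i
    ... | inj₁ _ = ≡.refl
    ... | inj₂ zero = ≡.refl
    ... | inj₂ (suc _) = ≡.refl

  rdet-move : ∀ {b} {B : Set b} {m n l} (g : B → Vector Carrier l) (U : Vector B m) x (W : Vector B n) →
    rdet (g ∘ (U ++ (x ∷ W))) ≈ (- 1#) ^ m * rdet (g ∘ (x ∷ (U ++ W)))
  rdet-move {m = m} g U x W = begin
    rdet (g ∘ (U ++ (x ∷ W)))                           ≈⟨ rdet-≗ (λ i → ≡.trans (++-map g U (x ∷ W) i) (∷-map i)) ⟩
    rdet ((g ∘ U) ++ (g x ∷ (g ∘ W)))                   ≈⟨ rdet-insert (g ∘ U) (g x) (g ∘ W) ⟩
    (- 1#) ^ m * rdet (g x ∷ ((g ∘ U) ++ (g ∘ W)))      ≈⟨ *-congˡ (rdet-≗ λ { zero → ≡.refl ; (suc i) → ≡.sym (++-map g U W i) }) ⟩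
    (- 1#) ^ m * rdet (g ∘ (x ∷ (U ++ W)))              ∎
    where
    ∷-map : ∀ i → ((g ∘ U) ++ (g ∘ (x ∷ W))) i ≡ ((g ∘ U) ++ (g x ∷ (g ∘ W))) i
    ∷-map i with splitAt m i
    ... | inj₁ _       = ≡.refl
    ... | inj₂ zero    = ≡.refl
    ... | inj₂ (suc _) = ≡.refl

  rdet-++[] : ∀ {k l} (A : Matrix k l) → rdet A ≈ rdet (A ++ [])
  rdet-++[] {k} A = rdet-cast (≡.sym (ℕₚ.+-identityʳ k)) ≡.refl λ i j → reflexive (≡.sym (≡.cong₂ (λ r c → r c)
    (≡.trans (≡.cong (A ++ []) (cast-↑ˡ i)) (lookup-++ˡ A [] i)) (cast-is-id ≡.refl j)))

  -- The first row is carried to the end, where `rdet-addRows` applies, and back again; the two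
  -- journeys have the same sign.
  rdet-addFirst : ∀ {k l} (x : Vector Carrier l) (y : Vector Carrier k) (M : Matrix k l) →
    rdet (x ∷ (λ i j → M i j + y i * x j)) ≈ rdet (x ∷ M)
  rdet-addFirst {k} x y M = begin
    rdet (x ∷ M′)                  ≈⟨ toEnd M′ ⟩
    s * rdet (M′ ++ (x ∷ []))      ≈⟨ *-congˡ (trans (rdet-cong rows) (rdet-addRows (λ i _ → y i) M (x ∷ []))) ⟩
    s * rdet (M ++ (x ∷ []))       ≈⟨ toEnd M ⟨
    rdet (x ∷ M)                   ∎
    where
    s = (- 1#) ^ k
    M′ = λ i j → M i j + y i * x j
    toEnd : ∀ N → rdet (x ∷ N) ≈ s * rdet (N ++ (x ∷ []))
    toEnd N = begin
      rdet (x ∷ N)                   ≈⟨ rdet-∷-cong x N (N ++ []) (λ h → trans (rdet-++[] (λ i → N i ∘ h))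
                                          (rdet-≗ λ i → ≡.trans (++-cong (λ i → N i ∘ h) (λ i → N i ∘ h) (λ _ → ≡.refl) (λ ()) i) (≡.sym (++-map (_∘ h) N [] i)))) ⟩
      rdet (x ∷ (N ++ []))           ≈⟨ *-identityˡ _ ⟨
      1# * rdet (x ∷ (N ++ []))      ≈⟨ *-congʳ (isSign-square (isSign-^ k)) ⟨
      (s * s) * rdet (x ∷ (N ++ [])) ≈⟨ *-assoc _ _ _ ⟩
      s * (s * rdet (x ∷ (N ++ []))) ≈⟨ *-congˡ (rdet-insert N x []) ⟨
      s * rdet (N ++ (x ∷ []))       ∎
    rows : ∀ i j → (M′ ++ (x ∷ [])) i j ≈ ((λ i j → M i j + ∑ λ r → y i * (x ∷ []) r j) ++ (x ∷ [])) i j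
    rows i j with splitAt k i
    ... | inj₁ i = +-congˡ (sym (∑-one _))
    ... | inj₂ i = refl

  rdet-pivotRow : ∀ {k l} (x : Vector Carrier k) (M : Matrix k l) →
    rdet ((1# ∷ λ _ → 0#) ∷ (λ i → x i ∷ M i)) ≈ rdet M
  rdet-pivotRow x M = begin
    rdet ((1# ∷ λ _ → 0#) ∷ (λ i → x i ∷ M i))
      ≈⟨ rdet-expandRow _ ⟩
    _ ≈⟨ ∑-suc _ ⟩
    1# * (1# * rdet M) + _
      ≈⟨ +-cong (trans (*-identityˡ _) (*-identityˡ _)) (∑-zero λ j → zero-term (sgn (suc j)) _ refl) ⟩
    rdet M + 0#
      ≈⟨ +-identityʳ _ ⟩
    rdet M ∎

  rdet-identity : ∀ {k} → rdet (identity {k}) ≈ 1#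
  rdet-identity {zero}  = rdet-empty _
  rdet-identity {suc k} = trans
    (rdet-cong λ { zero zero → refl ; zero (suc j) → refl ; (suc i) zero → refl ; (suc i) (suc j) → refl })
    (trans (rdet-pivotRow (λ _ → 0#) identity) rdet-identity)

  rdet-pivotCol : ∀ {k l} (y : Vector Carrier l) (M : Matrix k l) →
    rdet ((1# ∷ y) ∷ (λ i → 0# ∷ M i)) ≈ rdet M
  rdet-pivotCol y M = begin
    rdet ((1# ∷ y) ∷ (λ i → 0# ∷ M i))               ≈⟨ rdet-ᵀ _ ⟩
    rdet (((1# ∷ y) ∷ (λ i → 0# ∷ M i)) ᵀ)           ≈⟨ rdet-cong (λ { zero zero → refl ; zero (suc j) → refl
                                                                      ; (suc i) zero → refl ; (suc i) (suc j) → refl }) ⟩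
    rdet ((1# ∷ λ _ → 0#) ∷ (λ i → y i ∷ (M ᵀ) i))   ≈⟨ rdet-pivotRow y (M ᵀ) ⟩
    rdet (M ᵀ)                                       ≈⟨ rdet-ᵀ M ⟨
    rdet M                                           ∎

  -- The matrix determinant lemma without an inverse of `M`. Adding the row (1, -y) and subtracting
  -- its multiples by `x` gives the matrix with first row (1, -y) and first column `x`; linearity in
  -- that row separates (1, 0) from (0, -y).
  rdet-rankOne : ∀ {k l} (M : Matrix k l) (x : Vector Carrier k) (y : Vector Carrier l) →
    rdet (λ i j → M i j + x i * y j) ≈ rdet M + rdet ((0# ∷ λ j → - y j) ∷ (λ i → x i ∷ M i))
  rdet-rankOne M x y = begin
    rdet (λ i j → M i j + x i * y j)
      ≈⟨ rdet-pivotCol (λ j → - y j) _ ⟨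
    rdet ((1# ∷ λ j → - y j) ∷ (λ i → 0# ∷ λ j → M i j + x i * y j))
      ≈⟨ rdet-cong (λ { zero j → refl
                      ; (suc i) zero → sym (trans (+-congˡ (*-identityʳ _)) (-‿inverseʳ (x i)))
                      ; (suc i) (suc j) → +-congˡ (sym (trans (sym (-‿distribˡ-* _ _)) (trans (-‿cong (sym (-‿distribʳ-* _ _))) (-‿involutive _)))) }) ⟩
    rdet ((1# ∷ λ j → - y j) ∷ (λ i j → (x i ∷ M i) j + - x i * (1# ∷ λ j → - y j) j))
      ≈⟨ rdet-addFirst (1# ∷ λ j → - y j) (λ i → - x i) (λ i → x i ∷ M i) ⟩
    rdet ((1# ∷ λ j → - y j) ∷ (λ i → x i ∷ M i))
      ≈⟨ rdet-cong (λ { zero zero → sym (+-identityʳ 1#) ; zero (suc j) → sym (+-identityˡ _) ; (suc i) j → refl }) ⟩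
    rdet ((λ j → (1# ∷ λ _ → 0#) j + (0# ∷ λ j → - y j) j) ∷ (λ i → x i ∷ M i))
      ≈⟨ rdet-∷-+ (1# ∷ λ _ → 0#) (0# ∷ λ j → - y j) _ ⟩
    rdet ((1# ∷ λ _ → 0#) ∷ (λ i → x i ∷ M i)) + rdet ((0# ∷ λ j → - y j) ∷ (λ i → x i ∷ M i))
      ≈⟨ +-congʳ (rdet-pivotRow x M) ⟩
    rdet M + rdet ((0# ∷ λ j → - y j) ∷ (λ i → x i ∷ M i)) ∎

  block-swapRows : ∀ {k l m n} (A : Matrix k m) (B : Matrix k n) (C : Matrix l m) (D : Matrix l n) i j →
    block A B C D (+-swap l k ⟨$⟩ʳ i) j ≡ block C D A B i j
  block-swapRows A B C D i j = ≡.cong (λ r → r j) (++-swap (λ i → A i ++ B i) (λ i → C i ++ D i) i)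

  block-swapCols : ∀ {k l m n} (A : Matrix k m) (B : Matrix k n) (C : Matrix l m) (D : Matrix l n) i j →
    block A B C D i (+-swap n m ⟨$⟩ʳ j) ≡ block B A D C i j
  block-swapCols {k} A B C D i j with splitAt k i
  ... | inj₁ i = ++-swap (A i) (B i) j
  ... | inj₂ i = ++-swap (C i) (D i) j

  rdet-swapBlocks : ∀ {k l} (A : Matrix k k) (B : Matrix k l) (C : Matrix l k) (D : Matrix l l) →
    rdet (block A B C D) ≈ rdet (block D C B A)
  rdet-swapBlocks {k} {l} A B C D = trans (sym (rdet-conjugate (+-swap l k) (block A B C D)))
    (rdet-cong λ i j → reflexive (≡.trans (block-swapRows A B C D i _) (block-swapCols C D A B i j)))

  -- For square blocks: (0 -W′ ; Wᵀ 0) → (Wᵀ -W′ ; Wᵀ 0) → (0 Wᵀ ; -W′ Wᵀ) → (W′ 0 ; -W′ Wᵀ).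
  rdet-antidiagonal : ∀ {p n} (W W′ : Matrix p n) →
    rdet (block 𝟎 (λ i j → - W′ i j) (W ᵀ) 𝟎) ≈ rdet W * rdet W′
  rdet-antidiagonal {p} {n} W W′ with p ℕₚ.≟ n
  ... | no p≢n with e , e± , h ← rdet-permuteCols (+-swap n p) = begin
    rdet M                                          ≈⟨ *-identityˡ _ ⟨
    1# * rdet M                                     ≈⟨ *-congʳ (isSign-square e±) ⟨
    (e * e) * rdet M                                ≈⟨ *-assoc _ _ _ ⟩
    e * (e * rdet M)                                ≈⟨ *-congˡ (h M) ⟨
    e * rdet (λ i → M i ∘ (+-swap n p ⟨$⟩ʳ_))       ≈⟨ *-congˡ (rdet-cong λ i j → reflexive (block-swapCols 𝟎 W⁻ (W ᵀ) 𝟎 i j)) ⟩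
    e * rdet (block W⁻ 𝟎 𝟎 (W ᵀ))                   ≈⟨ *-congˡ (rdet-lowerTriangular W⁻ 𝟎 (W ᵀ) (inj₂ λ _ _ → refl)) ⟩
    e * (rdet W⁻ * rdet (W ᵀ))                      ≈⟨ *-congˡ (*-congʳ (rdet-nonsquare W⁻ p≢n)) ⟩
    e * (0# * rdet (W ᵀ))                           ≈⟨ trans (*-congˡ (zeroˡ _)) (zeroʳ e) ⟩
    0#                                              ≈⟨ zeroˡ _ ⟨
    0# * rdet W′                                    ≈⟨ *-congʳ (rdet-nonsquare W p≢n) ⟨
    rdet W * rdet W′                                ∎
    where
    W⁻ = λ i j → - W′ i j
    M = block 𝟎 W⁻ (W ᵀ) 𝟎
  ... | yes ≡.refl = begin
    rdet (block 𝟎 W⁻ (W ᵀ) 𝟎)                       ≈⟨ addRows 1# 𝟎 W⁻ (W ᵀ) 𝟎 ⟨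
    rdet (block _ _ (W ᵀ) 𝟎)
      ≈⟨ rdet-cong (block-cong {p} {p} {p} {p} (λ i j → trans (+-identityˡ _) (*-identityˡ _)) (λ i j → trans (+-congˡ (*-identityˡ _)) (+-identityʳ _)) (λ _ _ → refl) (λ _ _ → refl)) ⟩
    rdet (block (W ᵀ) W⁻ (W ᵀ) 𝟎)                   ≈⟨ rdet-swapBlocks (W ᵀ) W⁻ (W ᵀ) 𝟎 ⟩
    rdet (block 𝟎 (W ᵀ) W⁻ (W ᵀ))                   ≈⟨ addRows (- 1#) 𝟎 (W ᵀ) W⁻ (W ᵀ) ⟨
    rdet (block _ _ W⁻ (W ᵀ))
      ≈⟨ rdet-cong (block-cong {p} {p} {p} {p} (λ i j → trans (+-identityˡ _) (trans (-1*x≈-x _) (-‿involutive _)))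
                               (λ i j → trans (+-congˡ (-1*x≈-x _)) (-‿inverseʳ _)) (λ _ _ → refl) (λ _ _ → refl)) ⟩
    rdet (block W′ 𝟎 W⁻ (W ᵀ))                      ≈⟨ rdet-lowerTriangular W′ W⁻ (W ᵀ) (inj₁ ≡.refl) ⟩
    rdet W′ * rdet (W ᵀ)                            ≈⟨ *-comm _ _ ⟩
    rdet (W ᵀ) * rdet W′                            ≈⟨ *-congʳ (rdet-ᵀ W) ⟨
    rdet W * rdet W′                                ∎
    where
    W⁻ = λ i j → - W′ i j
    addRows : ∀ b (A B C D : Matrix p p) →
      rdet (block (λ i j → A i j + b * C i j) (λ i j → B i j + b * D i j) C D) ≈ rdet (block A B C D)
    addRows b A B C D = trans (rdet-cong rows) (rdet-addRows (λ i t → b * identity i t) (λ i → A i ++ B i) (λ i → C i ++ D i))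
      where
      scaled : ∀ i (f : Vector Carrier p) → b * f i ≈ ∑ λ t → (b * identity i t) * f t
      scaled i f = trans (*-congˡ (sym (∑-identityˡ f i))) (trans (*-∑ b _) (∑-cong λ t → sym (*-assoc _ _ _)))
      row : ∀ i j → ((λ j → A i j + b * C i j) ++ (λ j → B i j + b * D i j)) j
                    ≈ (A i ++ B i) j + ∑ λ t → (b * identity i t) * (C t ++ D t) j
      row i j with splitAt p j
      ... | inj₁ j = +-congˡ (scaled i λ t → C t j)
      ... | inj₂ j = +-congˡ (scaled i λ t → D t j)
      rows : block (λ i j → A i j + b * C i j) (λ i j → B i j + b * D i j) C D
             ≋ ((λ i j → (A i ++ B i) j + ∑ λ t → (b * identity i t) * (C t ++ D t) j) ++ (λ i → C i ++ D i))
      rows i with splitAt p i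
      ... | inj₁ i = row i
      ... | inj₂ i = λ j → refl

  weight : ∀ {m} → (Fin m → Carrier) → Subset m → Carrier
  weight c F = product λ e → if Vec.lookup F e then c e else 1#

  sumOverSubsets-cong : ∀ {m} {f f′ : Subset m → Carrier} → (∀ F → f F ≈ f′ F) → sumOverSubsets f ≈ sumOverSubsets f′
  sumOverSubsets-cong {zero}  h = h Vec.[]
  sumOverSubsets-cong {suc m} h = +-cong (sumOverSubsets-cong (h ∘ (inside Vec.∷_))) (sumOverSubsets-cong (h ∘ (outside Vec.∷_)))

  *-sumOverSubsets : ∀ {m} b (f : Subset m → Carrier) → b * sumOverSubsets f ≈ sumOverSubsets λ F → b * f F
  *-sumOverSubsets {zero}  b f = refl
  *-sumOverSubsets {suc m} b f = trans (distribˡ _ _ _) (+-cong (*-sumOverSubsets {m} b _) (*-sumOverSubsets {m} b _))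

  -- The minus sign removes all others: the Schur complement of `S` is W′ S⁻¹ Wᵀ, and for `S` zero
  -- the determinant is the plain product of `rdet W` and `rdet W′`.
  bordered : ∀ {p n} → Matrix p n → Matrix p n → Matrix n n → Matrix (p ℕ.+ n) (p ℕ.+ n)
  bordered W W′ S = block 𝟎 (λ i j → - W′ i j) (W ᵀ) S

  rdet-bordered-cong : ∀ {p n} {W V W′ V′ : Matrix p n} {S T : Matrix n n} →
    W ≋ V → W′ ≋ V′ → S ≋ T → rdet (bordered W W′ S) ≈ rdet (bordered V V′ T)
  rdet-bordered-cong {p} {n} {W} {V} {W′} {V′} {S} {T} W≋V W′≋V′ S≋T = rdet-cong
    (block-cong {p} {n} {p} {n} {𝟎} {𝟎} {λ i j → - W′ i j} {λ i j → - V′ i j} {W ᵀ} {V ᵀ} {S} {T}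
      (λ _ _ → refl) (λ i j → -‿cong (W′≋V′ i j)) (λ i j → W≋V j i) S≋T)

  -- The update touches the lower block only, so its vectors are padded with zeros along the border.
  -- The row and column that `rdet-rankOne` creates then simply enlarge the border by `x` and `y`.
  rdet-bordered-rankOne : ∀ {p n} (W W′ : Matrix p n) (S : Matrix n n) b (x y : Vector Carrier n) →
    rdet (bordered W W′ (λ i j → b * (x i * y j) + S i j)) ≈
    b * rdet (bordered (x ∷ W) (y ∷ W′) S) + rdet (bordered W W′ S)
  rdet-bordered-rankOne {p} {n} W W′ S b x y = begin
    rdet (bordered W W′ (λ i j → b * (x i * y j) + S i j))
      ≈⟨ rdet-cong entry ⟩
    rdet (λ i j → bordered W W′ S i j + x₀ i * (b * y₀ j))
      ≈⟨ rdet-rankOne (bordered W W′ S) x₀ (λ j → b * y₀ j) ⟩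
    rdet (bordered W W′ S) + rdet ((0# ∷ λ j → - (b * y₀ j)) ∷ (λ i → x₀ i ∷ bordered W W′ S i))
      ≈⟨ +-comm _ _ ⟩
    rdet ((0# ∷ λ j → - (b * y₀ j)) ∷ (λ i → x₀ i ∷ bordered W W′ S i)) + rdet (bordered W W′ S)
      ≈⟨ +-congʳ (trans (rdet-cong (λ { zero zero → sym (zeroʳ b) ; zero (suc j) → -‿distribʳ-* _ _ ; (suc i) j → refl }))
                        (rdet-∷-* b (0# ∷ λ j → - y₀ j) _)) ⟩
    b * rdet ((0# ∷ λ j → - y₀ j) ∷ (λ i → x₀ i ∷ bordered W W′ S i)) + rdet (bordered W W′ S)
      ≈⟨ +-congʳ (*-congˡ (rdet-cong λ i j → sym (larger i j))) ⟩
    b * rdet (bordered (x ∷ W) (y ∷ W′) S) + rdet (bordered W W′ S) ∎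
    where
    x₀ = (λ (_ : Fin p) → 0#) ++ x
    y₀ = (λ (_ : Fin p) → 0#) ++ y
    +0 : ∀ {u v} → v ≈ 0# → u ≈ u + v
    +0 v≈0 = sym (trans (+-congˡ v≈0) (+-identityʳ _))
    entry : ∀ i j → bordered W W′ (λ i j → b * (x i * y j) + S i j) i j ≈ bordered W W′ S i j + x₀ i * (b * y₀ j)
    entry i j with splitAt p i
    ... | inj₁ i = +0 (zeroˡ _)
    ... | inj₂ i with splitAt p j
    ...   | inj₁ j = +0 (trans (*-congˡ (zeroʳ b)) (zeroʳ _))
    ...   | inj₂ j = trans (+-comm _ _) (+-congˡ (solve 3 (λ b x y → b :* (x :* y) := x :* (b :* y)) refl b (x i) (y j)))
    larger : ∀ i j → bordered (x ∷ W) (y ∷ W′) S i j ≈ ((0# ∷ λ j → - y₀ j) ∷ (λ i → x₀ i ∷ bordered W W′ S i)) i j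
    larger zero zero = refl
    larger zero (suc j) with splitAt p j
    ... | inj₁ j = sym -0#≈0#
    ... | inj₂ j = refl
    larger (suc i) zero with splitAt p i
    ... | inj₁ i = refl
    ... | inj₂ i = refl
    larger (suc i) (suc j) with splitAt p i
    ... | inj₁ i = reflexive (++-suc (λ _ → 0#) (λ j → - W′ i j) j)
    ... | inj₂ i = reflexive (++-suc (λ j → (x ∷ W) j i) (S i) j)

  -- The edges are taken into the border one at a time by rank-one updates.
  cauchyBinet : ∀ {b} {B : Set b} {m n p} (f f′ : B → Vector Carrier n) (c : Fin m → Carrier) (a : Fin m → B) (W : Vector B p) →
    rdet (bordered (f ∘ W) (f′ ∘ W) (λ i j → ∑ λ e → c e * (f (a e) i * f′ (a e) j))) ≈
    sumOverSubsets λ F → weight c F * (rdet (f ∘ ((a ∘ elements F) ++ W)) * rdet (f′ ∘ ((a ∘ elements F) ++ W)))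
  cauchyBinet {m = zero} f f′ c a W = begin
    rdet (bordered (f ∘ W) (f′ ∘ W) _)
      ≈⟨ rdet-bordered-cong {W = f ∘ W} {W′ = f′ ∘ W} (λ _ _ → refl) (λ _ _ → refl) (λ _ _ → ∑-empty _) ⟩
    rdet (bordered (f ∘ W) (f′ ∘ W) 𝟎)
      ≈⟨ rdet-antidiagonal (f ∘ W) (f′ ∘ W) ⟩
    rdet (f ∘ W) * rdet (f′ ∘ W)
      ≈⟨ *-identityˡ _ ⟨
    1# * (rdet (f ∘ W) * rdet (f′ ∘ W)) ∎
  cauchyBinet {m = suc m} {p = p} f f′ c a W = begin
    rdet (bordered (f ∘ W) (f′ ∘ W) (λ i j → ∑ λ e → c e * (f (a e) i * f′ (a e) j)))
      ≈⟨ rdet-bordered-cong {W = f ∘ W} {W′ = f′ ∘ W} (λ _ _ → refl) (λ _ _ → refl) (λ _ _ → ∑-suc _) ⟩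
    rdet (bordered (f ∘ W) (f′ ∘ W) (λ i j → c zero * (f (a zero) i * f′ (a zero) j) + S i j))
      ≈⟨ rdet-bordered-rankOne (f ∘ W) (f′ ∘ W) S (c zero) (f (a zero)) (f′ (a zero)) ⟩
    c zero * rdet (bordered (f (a zero) ∷ (f ∘ W)) (f′ (a zero) ∷ (f′ ∘ W)) S) + rdet (bordered (f ∘ W) (f′ ∘ W) S)
      ≈⟨ +-cong (*-congˡ (trans (rdet-bordered-cong {W = f (a zero) ∷ (f ∘ W)} {W′ = f′ (a zero) ∷ (f′ ∘ W)} (λ i j → reflexive (≡.cong (λ r → r j) (≡.sym (∷-map f i))))
                   (λ i j → reflexive (≡.cong (λ r → r j) (≡.sym (∷-map f′ i)))) (λ _ _ → refl))
                 (cauchyBinet f f′ (c ∘ suc) (a ∘ suc) (a zero ∷ W))))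
               (cauchyBinet f f′ (c ∘ suc) (a ∘ suc) W) ⟩
    c zero * sumOverSubsets (λ F → weight (c ∘ suc) F * (X f F (a zero ∷ W) * X f′ F (a zero ∷ W)))
    + sumOverSubsets (λ F → weight (c ∘ suc) F * (X f F W * X f′ F W))
      -- The new edge stands behind the edges of `F`, but in the enumeration of the enlarged subset
      -- it comes first. Moving it there costs the same sign in both determinants.
      ≈⟨ +-cong (trans (*-sumOverSubsets {m} (c zero) _) (sumOverSubsets-cong {m} λ F → trans (sym (*-assoc _ _ _))
                   (*-congˡ {weight c (inside Vec.∷ F)} (trans (*-cong (move f F) (move f′ F)) (sign-cancel (isSign-^ ∣ F ∣))))))
                (sumOverSubsets-cong {m} λ F → *-congʳ {X f F W * X f′ F W} (sym (*-identityˡ (weight (c ∘ suc) F)))) ⟩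
    sumOverSubsets (λ F → weight c F * (rdet (f ∘ ((a ∘ elements F) ++ W)) * rdet (f′ ∘ ((a ∘ elements F) ++ W)))) ∎
    where
    S : Matrix _ _
    S i j = ∑ λ e → c (suc e) * (f (a (suc e)) i * f′ (a (suc e)) j)
    X : (_ → Vector Carrier _) → ∀ F {p′} → Vector _ p′ → Carrier
    X g F V = rdet (g ∘ ((a ∘ suc ∘ elements F) ++ V))
    ∷-map : ∀ g i → g ((a zero ∷ W) i) ≡ (g (a zero) ∷ (g ∘ W)) i
    ∷-map g zero    = ≡.refl
    ∷-map g (suc i) = ≡.refl
    move : ∀ g F → X g F (a zero ∷ W) ≈ (- 1#) ^ ∣ F ∣ * rdet (g ∘ ((a ∘ elements (inside Vec.∷ F)) ++ W))
    move g F = trans (rdet-move g (a ∘ suc ∘ elements F) (a zero) W) (*-congˡ (rdet-≗ λ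
      { zero → ≡.refl ; (suc i) → ≡.cong g (≡.sym (++-suc (a ∘ elements (inside Vec.∷ F)) W i)) }))

extend : ∀ {m n} k → Permutation m n → Permutation (m ℕ.+ k) (n ℕ.+ k)
extend k π = ↔-sym +↔⊎ ↔-∘ ((π ⊎-↔ Perm.id) ↔-∘ +↔⊎)

++-extend : ∀ {b} {B : Set b} {m n k} (π : Permutation m n) (U : Vector B n) (V : Vector B k) i →
            (U ++ V) (extend k π ⟨$⟩ʳ i) ≡ ((U ∘ (π ⟨$⟩ʳ_)) ++ V) i
++-extend {m = m} {n} {k} π U V i with splitAt m i
... | inj₁ i = ≡.cong Sum.[ U , V ] (splitAt-join n k (inj₁ (π ⟨$⟩ʳ i)))
... | inj₂ i = ≡.cong Sum.[ U , V ] (splitAt-join n k (inj₂ i))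

-- Incidence rows under contraction of edges.

module Incidence {a ℓ} (R : CommutativeRing a ℓ) where

  open CommutativeRing R hiding (zero)
  open LinearAlgebra R
  open Determinant R
  open Block R
  open CauchyBinet R
  open import Algebra.Properties.Ring ring using (-‿distribˡ-*; -‿distribʳ-*; -1*x≈-x; -‿involutive; -0#≈0#; -‿+-comm)
  open import Algebra.Properties.Semiring.Exp semiring using (_^_)
  open import Algebra.Solver.Ring.NaturalCoefficients.Default commutativeSemiring using (solve; _:+_; _:*_; _:=_)
  open import Relation.Binary.Reasoning.Setoid setoid

  -- One step of Gaussian elimination with pivot in column `s`, followed by deletion of the pivot
  -- row and column. The sign depends on `s` alone.
  rdet-contract : ∀ {k l} s (x : Vector Carrier (suc l)) (M : Matrix k (suc l)) → x s ≈ 1# →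
    rdet (x ∷ M) ≈ sgn s * rdet (λ i c → M i (punchIn s c) + - M i s * x (punchIn s c))
  rdet-contract s x M xₛ≈1 = begin
    rdet (x ∷ M)
      ≈⟨ rdet-addFirst x (λ i → - M i s) M ⟨
    rdet A
      ≈⟨ rdet-ᵀ A ⟩
    rdet (A ᵀ)
      ≈⟨ rdet-fromFront s (A ᵀ) ⟩
    sgn s * rdet ((A ᵀ) s ∷ ((A ᵀ) ∘ punchIn s))
      ≈⟨ *-congˡ {sgn s} (rdet-ᵀ _) ⟩
    sgn s * rdet (((A ᵀ) s ∷ ((A ᵀ) ∘ punchIn s)) ᵀ)
      ≈⟨ *-congˡ {sgn s} (rdet-cong λ { zero zero → xₛ≈1 ; zero (suc c) → refl ; (suc i) zero → cleared i ; (suc i) (suc c) → refl }) ⟩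
    sgn s * rdet ((1# ∷ (x ∘ punchIn s)) ∷ (λ i → 0# ∷ λ c → M i (punchIn s c) + - M i s * x (punchIn s c)))
      ≈⟨ *-congˡ {sgn s} (rdet-pivotCol (x ∘ punchIn s) _) ⟩
    sgn s * rdet (λ i c → M i (punchIn s c) + - M i s * x (punchIn s c)) ∎
    where
    A : Matrix _ _
    A = x ∷ (λ i j → M i j + - M i s * x j)
    cleared : ∀ i → M i s + - M i s * x s ≈ 0#
    cleared i = trans (+-congˡ (trans (*-congˡ xₛ≈1) (*-identityʳ _))) (-‿inverseʳ _)

  module _ {n : ℕ} where

    Edge : Set
    Edge = Fin n × Fin n

    -- The vectors inc ℓ (P p) are the columns of B_F if ℓ numbers the components of F, and those of D_P if ℓ = groundLabel g.
    inc : ∀ {r} → (Fin n → Fin (suc r)) → Edge → Vector Carrier r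
    inc ℓ e i = indicator (ℓ (proj₂ e) ≟ suc i) - indicator (ℓ (proj₁ e) ≟ suc i)

    -- The tail will be a row of E_I; no relabelling affects it. Ports without completion have k =
    -- 0.
    Item : ℕ → Set a
    Item k = Edge × Vector Carrier k

    plain : ∀ {k} → Edge → Item k
    plain e = e , λ _ → 0#

    row : ∀ {r k} → (Fin n → Fin (suc r)) → Item k → Vector Carrier (r ℕ.+ k)
    row ℓ x = inc ℓ (proj₁ x) ++ proj₂ x

    inc-loop : ∀ {r} (ℓ : Fin n → Fin (suc r)) {u v} → ℓ u ≡ ℓ v → ∀ i → inc ℓ (u , v) i ≈ 0#
    inc-loop ℓ {u} {v} eq i rewrite eq = -‿inverseʳ _

    inc-flip : ∀ {r} (ℓ : Fin n → Fin (suc r)) u v i → inc ℓ (u , v) i ≈ - 1# * inc ℓ (v , u) i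
    inc-flip ℓ u v i = sym (trans (-1*x≈-x _) (+-inverse-swap _ _))

    -- Elimination with the row of an edge from class `t` to class `suc s` adds column `s` to the
    -- column of `t`, or to none if `t` is the class of the ground. This is the incidence row for
    -- the merged labels; it is checked for each end of `f` separately.
    inc-merge : ∀ {r} (ℓ : Fin n → Fin (suc (suc r))) {s t} (t≢ : t ≢ suc s) {u v} → ℓ u ≡ t → ℓ v ≡ suc s → ∀ f i →
      inc ℓ f (punchIn s i) + - inc ℓ f s * inc ℓ (u , v) (punchIn s i) ≈ inc (merge s t≢ ∘ ℓ) f i
    inc-merge ℓ {s} {t} t≢ {u} {v} ut vs f i = begin
      inc ℓ f (punchIn s i) + - inc ℓ f s * inc ℓ (u , v) (punchIn s i)
        ≈⟨ +-congˡ (*-congˡ incₑ) ⟩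
      inc ℓ f (punchIn s i) + - inc ℓ f s * - y
        ≈⟨ +-congˡ (trans (sym (-‿distribˡ-* _ _)) (trans (-‿cong (sym (-‿distribʳ-* _ _))) (-‿involutive _))) ⟩
      (b₁ - a₁) + (b₂ - a₂) * y
        ≈⟨ solve 5 (λ b a b′ a′ y → (b :+ a) :+ (b′ :+ a′) :* y := (b :+ b′ :* y) :+ (a :+ a′ :* y)) refl b₁ (- a₁) b₂ (- a₂) y ⟩
      (b₁ + b₂ * y) + (- a₁ + - a₂ * y)
        ≈⟨ +-congˡ (trans (+-congˡ (sym (-‿distribˡ-* _ _))) (-‿+-comm _ _)) ⟩
      (b₁ + b₂ * y) - (a₁ + a₂ * y)
        ≈⟨ +-cong (label (ℓ (proj₂ f))) (-‿cong (label (ℓ (proj₁ f)))) ⟩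
      inc (merge s t≢ ∘ ℓ) f i ∎
      where
      y = indicator (t ≟ suc (punchIn s i))
      b₁ = indicator (ℓ (proj₂ f) ≟ suc (punchIn s i))
      a₁ = indicator (ℓ (proj₁ f) ≟ suc (punchIn s i))
      b₂ = indicator (ℓ (proj₂ f) ≟ suc s)
      a₂ = indicator (ℓ (proj₁ f) ≟ suc s)
      incₑ : inc ℓ (u , v) (punchIn s i) ≈ - y
      incₑ rewrite ut | vs = trans
        (+-congʳ (reflexive (indicator-no (suc s ≟ suc (punchIn s i)) (punchInᵢ≢i s i ∘ suc-injective ∘ ≡.sym)))) (+-identityˡ _)
      label : ∀ x → indicator (x ≟ suc (punchIn s i)) + indicator (x ≟ suc s) * y ≈ indicator (merge s t≢ x ≟ suc i)
      label x = go (x ≟ suc s)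
        where
        go : Dec (x ≡ suc s) → _
        go (yes ≡.refl) = begin
          indicator (suc s ≟ suc (punchIn s i)) + indicator (suc s ≟ suc s) * y
            ≈⟨ +-cong (reflexive (indicator-no (suc s ≟ suc (punchIn s i)) (punchInᵢ≢i s i ∘ suc-injective ∘ ≡.sym)))
                      (*-congʳ (reflexive (indicator-yes (suc s ≟ suc s) ≡.refl))) ⟩
          0# + 1# * y
            ≈⟨ trans (+-identityˡ _) (*-identityˡ y) ⟩
          y
            ≈⟨ reflexive (indicator-⇔ (t ≟ _) (merge s t≢ (suc s) ≟ suc i)
                 (λ eq → punchIn-injective (suc s) _ _ (≡.trans (merge-suc s t≢) eq))
                 (λ eq → ≡.trans (≡.sym (merge-suc s t≢)) (≡.cong (punchIn (suc s)) eq))) ⟩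
          indicator (merge s t≢ (suc s) ≟ suc i) ∎
        go (no x≢) = begin
          indicator (x ≟ suc (punchIn s i)) + indicator (x ≟ suc s) * y
            ≈⟨ +-congˡ (trans (*-congʳ (reflexive (indicator-no (x ≟ suc s) x≢))) (zeroˡ y)) ⟩
          indicator (x ≟ suc (punchIn s i)) + 0#
            ≈⟨ +-identityʳ _ ⟩
          indicator (x ≟ suc (punchIn s i))
            ≈⟨ reflexive (indicator-⇔ (x ≟ _) (merge s t≢ x ≟ suc i)
                 (λ eq → punchIn-injective (suc s) _ _ (≡.trans (merge-other s t≢ x≢) eq))
                 (λ eq → ≡.trans (≡.sym (merge-other s t≢ x≢)) (≡.cong (punchIn (suc s)) eq))) ⟩
          indicator (merge s t≢ x ≟ suc i) ∎

    -- The pivot is the column of the absorbed class. The pivot row has zero tail, so elimination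
    -- leaves the tails of `W` alone. An edge oriented the other way contributes one more factor -1.
    rdet-merge : ∀ {r k} (ℓ : Fin n → Fin (suc (suc r))) {s t} (t≢ : t ≢ suc s) {u v} → EndsAt (ℓ u) (ℓ v) s t →
      ∃ λ e → IsSign e × ∀ {p} (W : Vector (Item k) p) →
        rdet (row ℓ ∘ (plain (u , v) ∷ W)) ≈ e * rdet (row (merge s t≢ ∘ ℓ) ∘ W)
    rdet-merge {r} {k} ℓ {s} {t} t≢ {u} {v} (inj₁ (ut , vs)) = sgn ŝ , isSign-^ (toℕ ŝ) , λ W → begin
      rdet (row ℓ ∘ (plain (u , v) ∷ W))
        ≈⟨ rdet-≗ (λ { zero → ≡.refl ; (suc i) → ≡.refl }) ⟩
      rdet (x ∷ (row ℓ ∘ W))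
        ≈⟨ rdet-contract ŝ x (row ℓ ∘ W) xₛ≈1 ⟩
      sgn ŝ * rdet (λ i c → row ℓ (W i) (punchIn ŝ c) + - row ℓ (W i) ŝ * x (punchIn ŝ c))
        ≈⟨ *-congˡ {sgn ŝ} (rdet-cong λ i c → entry (W i) c) ⟩
      sgn ŝ * rdet (row (merge s t≢ ∘ ℓ) ∘ W) ∎
      where
      ŝ = s ↑ˡ k
      x : Vector Carrier (suc r ℕ.+ k)
      x = row ℓ (plain (u , v))
      xₛ≈1 : x ŝ ≈ 1#
      xₛ≈1 rewrite lookup-++ˡ (inc ℓ (u , v)) (λ (_ : Fin k) → 0#) s | ut | vs = begin
        indicator (suc s ≟ suc s) - indicator (t ≟ suc s)
          ≈⟨ +-cong (reflexive (indicator-yes (suc s ≟ suc s) ≡.refl)) (-‿cong (reflexive (indicator-no (t ≟ suc s) t≢))) ⟩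
        1# - 0# ≈⟨ trans (+-congˡ -0#≈0#) (+-identityʳ 1#) ⟩
        1# ∎
      entry : ∀ y c → row ℓ y (punchIn ŝ c) + - row ℓ y ŝ * x (punchIn ŝ c) ≈ row (merge s t≢ ∘ ℓ) y c
      entry (f , L) c rewrite ++-punchIn (inc ℓ f) L s c | ++-punchIn (inc ℓ (u , v)) (λ (_ : Fin k) → 0#) s c
        | lookup-++ˡ (inc ℓ f) L s with splitAt r c
      ... | inj₁ i = inc-merge ℓ t≢ ut vs f i
      ... | inj₂ j = trans (+-congˡ (zeroʳ _)) (+-identityʳ _)
    rdet-merge {r} {k} ℓ {s} {t} t≢ {u} {v} (inj₂ (us , vt)) with e , e± , h ← rdet-merge {k = k} ℓ t≢ {v} {u} (inj₁ (vt , us)) =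
      - 1# * e , isSign-* (inj₂ refl) e± , λ W → begin
      rdet (row ℓ ∘ (plain (u , v) ∷ W))
        ≈⟨ rdet-cong (λ { zero c → flipped c ; (suc i) c → refl }) ⟩
      rdet ((λ c → - 1# * row ℓ (plain (v , u)) c) ∷ (row ℓ ∘ W))
        ≈⟨ rdet-∷-* (- 1#) (row ℓ (plain (v , u))) _ ⟩
      - 1# * rdet (row ℓ (plain (v , u)) ∷ (row ℓ ∘ W))
        ≈⟨ *-congˡ (trans (rdet-≗ λ { zero → ≡.refl ; (suc i) → ≡.refl }) (h W)) ⟩
      - 1# * (e * rdet (row (merge s t≢ ∘ ℓ) ∘ W))
        ≈⟨ *-assoc _ _ _ ⟨
      (- 1# * e) * rdet (row (merge s t≢ ∘ ℓ) ∘ W) ∎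
      where
      flipped : ∀ c → row {k = k} ℓ (plain (u , v)) c ≈ - 1# * row ℓ (plain (v , u)) c
      flipped c with splitAt (suc r) c
      ... | inj₁ i = inc-flip ℓ u v i
      ... | inj₂ j = sym (zeroʳ _)

    module _ {r₀ : ℕ} {ℓ : Fin n → Fin (suc r₀)} {k : ℕ} where

      edgesWith : ∀ {l p} → Vec Edge l → Vector (Item k) p → Vector (Item k) (l ℕ.+ p)
      edgesWith es W = (plain ∘ Vec.lookup es) ++ W

      -- A chain contracts its last edge first. The head edge is therefore made part of the border
      -- while the edges behind it are contracted.
      rdet-uncons : ∀ {l p} e (es : Vec Edge l) (W : Vector (Item k) p) →
        rdet (row ℓ ∘ edgesWith (e Vec.∷ es) W) ≈ (- 1#) ^ l * rdet (row ℓ ∘ edgesWith es (plain e ∷ W))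
      rdet-uncons {l} e es W = begin
        rdet (row ℓ ∘ edgesWith (e Vec.∷ es) W)
          ≈⟨ rdet-≗ (λ { zero → ≡.refl ; (suc i) → ≡.cong (row ℓ) (++-suc (plain ∘ Vec.lookup (e Vec.∷ es)) W i) }) ⟩
        D                 ≈⟨ *-identityˡ _ ⟨
        1# * D            ≈⟨ *-congʳ (isSign-square (isSign-^ l)) ⟨
        (σ * σ) * D       ≈⟨ *-assoc _ _ _ ⟩
        σ * (σ * D)       ≈⟨ *-congˡ (rdet-move (row ℓ) (plain ∘ Vec.lookup es) (plain e) W) ⟨
        σ * rdet (row ℓ ∘ edgesWith es (plain e ∷ W)) ∎
        where
        σ = (- 1#) ^ l
        D = rdet (row ℓ ∘ (plain e ∷ edgesWith es W))

      -- The border is quantified behind the sign, so the induction hypothesis can be applied to the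
      -- border enlarged by the head edge, which is then contracted by `rdet-merge`.
      rdet-chain : ∀ {l} {es : Vec Edge l} {r} {ℓ′ : Fin n → Fin (suc r)} → Chain ℓ es ℓ′ →
        ∃ λ e → IsSign e × ∀ {p} (W : Vector (Item k) p) → rdet (row ℓ ∘ edgesWith es W) ≈ e * rdet (row ℓ′ ∘ W)
      rdet-chain done = 1# , inj₁ refl , λ W → sym (*-identityˡ _)
      rdet-chain (join {l} {es} {ℓ′ = ℓ′} t≢ ends c) with e₁ , e₁± , h₁ ← rdet-chain c | e₂ , e₂± , h₂ ← rdet-merge {k = k} ℓ′ t≢ ends =
        (- 1#) ^ l * (e₁ * e₂) , isSign-* (isSign-^ l) (isSign-* e₁± e₂±) , λ W →
        trans (rdet-uncons _ es W) (trans (*-congˡ (trans (h₁ _) (trans (*-congˡ (h₂ W)) (sym (*-assoc _ _ _))))) (sym (*-assoc _ _ _)))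

      -- Once the edges behind it are contracted, the loop has a zero row.
      rdet-dependent : ∀ {l} {es : Vec Edge l} → Dependent ℓ es → ∀ {p} (W : Vector (Item k) p) →
        rdet (row ℓ ∘ edgesWith es W) ≈ 0#
      rdet-dependent (loop {es = es} {r} {ℓ′} {u} {v} c eq) W with e , _ , h ← rdet-chain c = begin
        rdet (row ℓ ∘ edgesWith ((u , v) Vec.∷ es) W)             ≈⟨ rdet-uncons (u , v) es W ⟩
        _ * rdet (row ℓ ∘ edgesWith es (plain (u , v) ∷ W))       ≈⟨ *-congˡ (h _) ⟩
        _ * (e * rdet (row ℓ′ ∘ (plain (u , v) ∷ W)))             ≈⟨ *-congˡ (*-congˡ (rdet-zeroRow (row ℓ′ ∘ (plain (u , v) ∷ W)) zeros)) ⟩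
        _ * (e * 0#)                                              ≈⟨ trans (*-congˡ (zeroʳ e)) (zeroʳ _) ⟩
        0# ∎
        where
        zeros : ∀ c → row {k = k} ℓ′ (plain (u , v)) c ≈ 0#
        zeros c with splitAt r c
        ... | inj₁ i = inc-loop ℓ′ eq i
        ... | inj₂ j = refl
      rdet-dependent (later {es = es} {e} d) W = trans (rdet-uncons e es W) (trans (*-congˡ (rdet-dependent d _)) (zeroʳ _))

    -- The numbering produced by contraction need not be the prescribed one. Both give the ground
    -- label zero, so the bijection between them fixes zero and restricts to a permutation of the
    -- columns.
    rdet-relabel : ∀ {r r′ m k} {G : Multigraph n m} {F} {g} {ℓ : Fin n → Fin (suc r)} {ℓ′ : Fin n → Fin (suc r′)} →
      IsComponentMap G F ℓ → IsComponentMap G F ℓ′ → ℓ g ≡ zero → ℓ′ g ≡ zero →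
      ∃ λ e → IsSign e × ∀ {p} (W : Vector (Item k) p) → rdet (row ℓ ∘ W) ≈ e * rdet (row ℓ′ ∘ W)
    rdet-relabel {r} {r′} {k = k} {g = g} {ℓ} {ℓ′} (onto , kernel) (onto′ , kernel′) ℓg ℓ′g = e , e± , λ W →
        trans (rdet-cong λ i c → trans (entry (W i) c) (reflexive (≡.sym (++-extend (Perm.remove zero π) (inc ℓ′ (proj₁ (W i))) (proj₂ (W i)) c))))
              (h (row ℓ′ ∘ W))
      where
      to : Fin (suc r) → Fin (suc r′)
      to i = ℓ′ (proj₁ (onto i))
      from : Fin (suc r′) → Fin (suc r)
      from i = ℓ (proj₁ (onto′ i))
      to-ℓ : ∀ v → to (ℓ v) ≡ ℓ′ v
      to-ℓ v = Equivalence.from (kernel′ _ _) (Equivalence.to (kernel _ _) (proj₂ (onto (ℓ v))))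
      from-ℓ′ : ∀ v → from (ℓ′ v) ≡ ℓ v
      from-ℓ′ v = Equivalence.from (kernel _ _) (Equivalence.to (kernel′ _ _) (proj₂ (onto′ (ℓ′ v))))
      π : Permutation (suc r) (suc r′)
      π = Perm.permutation to from (λ i → ≡.trans (to-ℓ _) (proj₂ (onto′ i))) (λ i → ≡.trans (from-ℓ′ _) (proj₂ (onto i)))
      π-zero : to zero ≡ zero
      π-zero = ≡.trans (≡.cong to (≡.sym ℓg)) (≡.trans (to-ℓ g) ℓ′g)
      π-suc : ∀ i → to (suc i) ≡ suc (Perm.remove zero π ⟨$⟩ʳ i)
      π-suc i = ≡.sym (Perm.lift₀-remove π π-zero (suc i))
      permuted = rdet-permuteCols (extend k (Perm.remove zero π))
      e = proj₁ permuted
      e± = proj₁ (proj₂ permuted)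
      h = λ {l} → proj₂ (proj₂ permuted) {l}
      label : ∀ v i → indicator (ℓ v ≟ suc i) ≡ indicator (ℓ′ v ≟ suc (Perm.remove zero π ⟨$⟩ʳ i))
      label v i = indicator-⇔ (ℓ v ≟ suc i) (ℓ′ v ≟ suc (Perm.remove zero π ⟨$⟩ʳ i))
        (λ eq → ≡.trans (≡.sym (to-ℓ v)) (≡.trans (≡.cong to eq) (π-suc i)))
        (λ eq → ≡.trans (≡.sym (from-ℓ′ v)) (≡.trans (≡.cong from (≡.trans eq (≡.sym (π-suc i)))) (Perm.inverseˡ π)))
      entry : ∀ (x : Item k) c → row ℓ x c ≈ ((inc ℓ′ (proj₁ x) ∘ (Perm.remove zero π ⟨$⟩ʳ_)) ++ proj₂ x) c
      entry (f , L) = ++-≈ (λ i → +-cong (reflexive (label (proj₂ f) i)) (-‿cong (reflexive (label (proj₁ f) i)))) (λ _ → refl)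

    module _ {r₀ m : ℕ} {ℓ : Fin n → Fin (suc r₀)} {g : Fin n} {G : Multigraph n m} {F : Subset m} (ρ : Reduction ℓ g G F) {k : ℕ} where

      open Reduction ρ

      forestRows : ∀ {p} → Vector (Item k) p → Vector (Item k) (∣ F ∣ ℕ.+ p)
      forestRows W = (plain ∘ G ∘ elements F) ++ W

      forestRows-≗ : ∀ {p} (W : Vector (Item k) p) → rdet (row ℓ ∘ forestRows W) ≈ rdet (row ℓ ∘ edgesWith {ℓ = ℓ} (edgeList G F) W)
      forestRows-≗ W = rdet-≗ (λ i → ≡.cong (row ℓ) (eq i))
        where
        eq : ∀ i → forestRows W i ≡ edgesWith {ℓ = ℓ} (edgeList G F) W i
        eq i with splitAt ∣ F ∣ i
        ... | inj₁ i = ≡.cong plain (≡.sym (lookup-edgeList G F i))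
        ... | inj₂ i = ≡.refl

      rdet-forest : ∀ {r} {comp′ : Fin n → Fin (suc r)} → Acyclic G F → IsComponentMap G F comp′ → comp′ g ≡ zero →
        ∃ λ e → IsSign e × ∀ {p} (W : Vector (Item k) p) → rdet (row ℓ ∘ forestRows W) ≈ e * rdet (row comp′ ∘ W)
      rdet-forest acyc isComp′ ground′ with status
      ... | inj₂ (cyclic , _) = contradiction (λ {u} → acyc {u}) cyclic
      ... | inj₁ (_ , c) with e₁ , e₁± , h₁ ← rdet-chain {k = k} c
                            | e₂ , e₂± , h₂ ← rdet-relabel {k = k} isComponentMap isComp′ ground ground′ =
        e₁ * e₂ , isSign-* e₁± e₂± , λ W →
        trans (forestRows-≗ W) (trans (h₁ W) (trans (*-congˡ (h₂ W)) (sym (*-assoc _ _ _))))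

      -- Either `F` has a cycle and its rows are dependent, or it is a forest with another number of
      -- components, and the matrix that remains after contraction is not square.
      rdet-nonforest : ∀ {r p} → ¬ IsSpanningForest G (suc r) F → p ≡ r ℕ.+ k → (W : Vector (Item k) p) →
        rdet (row ℓ ∘ forestRows W) ≈ 0#
      rdet-nonforest {r} notForest p≡ W with status
      ... | inj₂ (_ , d) = trans (forestRows-≗ W) (rdet-dependent d W)
      ... | inj₁ (acyc , c) with e , _ , h ← rdet-chain {k = k} c = trans (forestRows-≗ W) (trans (h W)
        (trans (*-congˡ (rdet-nonsquare (row comp ∘ W) (λ p≡′ → other (ℕₚ.+-cancelʳ-≡ k rank r (≡.trans (≡.sym p≡′) p≡))))) (zeroʳ e)))
        where
        other : rank ≢ r
        other ≡.refl = notForest (acyc , comp , isComponentMap)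

-- Spanning trees as forests, the ground labelling, and enumerations of subsets.

module _ {n m} {G : Multigraph (suc n) m} {F : Subset m} where

  tree⇒componentMap : IsSpanningTree G F → IsComponentMap G F {1} (λ _ → zero)
  tree⇒componentMap (_ , conn) = (λ { zero → zero , ≡.refl }) , λ u v → mk⇔ (λ _ → conn u v) (λ _ → ≡.refl)

  tree⇒forest : IsSpanningTree G F → IsSpanningForest G 1 F
  tree⇒forest t@(acyc , _) = acyc , _ , tree⇒componentMap t

  forest⇒tree : IsSpanningForest G 1 F → IsSpanningTree G F
  forest⇒tree (acyc , comp , _ , kernel) = acyc , λ u v → Equivalence.to (kernel u v) (unique (comp u) (comp v))
    where
    unique : (x y : Fin 1) → x ≡ y
    unique zero zero = ≡.refl

module _ {n} (g : Fin (suc n)) where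

  -- Every vertex is its own class and the ground is class zero; the contraction of physical edges
  -- starts from here.
  groundLabel : Fin (suc n) → Fin (suc n)
  groundLabel v with g ≟ v
  ... | yes _  = zero
  ... | no g≢v = suc (punchOut g≢v)

  groundLabel-ground : groundLabel g ≡ zero
  groundLabel-ground with g ≟ g
  ... | yes _  = ≡.refl
  ... | no g≢g = contradiction ≡.refl g≢g

  groundLabel-punchIn : ∀ i → groundLabel (punchIn g i) ≡ suc i
  groundLabel-punchIn i with g ≟ punchIn g i
  ... | yes eq = contradiction (≡.sym eq) (punchInᵢ≢i g i)
  ... | no ne  = ≡.cong suc (punchIn-injective g _ _ (punchIn-punchOut ne))

  groundLabel-suc : ∀ {v i} → groundLabel v ≡ suc i → punchIn g i ≡ v
  groundLabel-suc {v} eq with g ≟ v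
  groundLabel-suc {v} ≡.refl | no g≢v = punchIn-punchOut g≢v

  groundLabel-injective : ∀ {u v} → groundLabel u ≡ groundLabel v → u ≡ v
  groundLabel-injective {u} {v} eq with g ≟ u
  ... | no g≢u     = ≡.trans (≡.sym (punchIn-punchOut g≢u)) (groundLabel-suc (≡.sym eq))
  ... | yes ≡.refl with g ≟ v
  ...   | yes g≡v = g≡v

  groundLabel-surjective : ∀ i → ∃ λ v → groundLabel v ≡ i
  groundLabel-surjective zero    = g , groundLabel-ground
  groundLabel-surjective (suc i) = punchIn g i , groundLabel-punchIn i

  reduceGround : ∀ {m} (G : Multigraph (suc n) m) F → Reduction groundLabel g G F
  reduceGround = reduce groundLabel g groundLabel-injective groundLabel-surjective groundLabel-ground

partition : ∀ {n} (I : Subset n) → (Fin ∣ ∁ I ∣ ⊎ Fin ∣ I ∣) ↔ Fin n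
partition {n} I = mk↔ₛ′ Sum.[ elements (∁ I) , elements I ] (from I) (to∘from I) (from∘to I)
  where
  from : ∀ {n} (I : Subset n) → Fin n → Fin ∣ ∁ I ∣ ⊎ Fin ∣ I ∣
  from (true  Vec.∷ I) zero    = inj₂ zero
  from (true  Vec.∷ I) (suc i) = Sum.map₂ suc (from I i)
  from (false Vec.∷ I) zero    = inj₁ zero
  from (false Vec.∷ I) (suc i) = Sum.map₁ suc (from I i)

  to∘from : ∀ {n} (I : Subset n) i → Sum.[ elements (∁ I) , elements I ] (from I i) ≡ i
  to∘from (true  Vec.∷ I) zero = ≡.refl
  to∘from (true  Vec.∷ I) (suc i) with from I i | to∘from I i
  ... | inj₁ _ | eq = ≡.cong suc eq
  ... | inj₂ _ | eq = ≡.cong suc eq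
  to∘from (false Vec.∷ I) zero = ≡.refl
  to∘from (false Vec.∷ I) (suc i) with from I i | to∘from I i
  ... | inj₁ _ | eq = ≡.cong suc eq
  ... | inj₂ _ | eq = ≡.cong suc eq

  from∘to : ∀ {n} (I : Subset n) x → from I (Sum.[ elements (∁ I) , elements I ] x) ≡ x
  from∘to (true  Vec.∷ I) (inj₁ i)       = ≡.cong (Sum.map₂ suc) (from∘to I (inj₁ i))
  from∘to (true  Vec.∷ I) (inj₂ zero)    = ≡.refl
  from∘to (true  Vec.∷ I) (inj₂ (suc i)) = ≡.cong (Sum.map₂ suc) (from∘to I (inj₂ i))
  from∘to (false Vec.∷ I) (inj₁ zero)    = ≡.refl
  from∘to (false Vec.∷ I) (inj₁ (suc i)) = ≡.cong (Sum.map₁ suc) (from∘to I (inj₁ i))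
  from∘to (false Vec.∷ I) (inj₂ i)       = ≡.cong (Sum.map₁ suc) (from∘to I (inj₂ i))

elements-⊤ : ∀ {n} i → elements (⊤ {n}) i ≡ cast (∣⊤∣≡n n) i
elements-⊤ {suc n} zero    = ≡.refl
elements-⊤ {suc n} (suc i) = ≡.cong suc (elements-⊤ i)

enum-⊤ : ∀ {n} (eq : ∣ ⊤ {n} ∣ ≡ n) i → enum ⊤ eq i ≡ i
enum-⊤ eq i = ≡.trans (elements-⊤ _) (cast-involutive (∣⊤∣≡n _) (≡.sym eq) i)

-- Unimodularity of reduced incidence matrices.

module Trees {a ℓ} (R : CommutativeRing a ℓ) where

  open CommutativeRing R hiding (zero)
  open LinearAlgebra R
  open Determinant R
  open Block R
  open CauchyBinet R
  open Incidence R
  open import Relation.Binary.Reasoning.Setoid setoid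

  -- Empty tails and empty borders leave sizes such as `l + 0`, which are not `l` by computation.
  rdet-pad : ∀ {k l} {A : Matrix k l} {B : Matrix (k ℕ.+ 0) (l ℕ.+ 0)} →
    (∀ i j → A i j ≈ B (i ↑ˡ 0) (j ↑ˡ 0)) → rdet A ≈ rdet B
  rdet-pad {k} {l} {A} {B} h = rdet-cast (≡.sym (ℕₚ.+-identityʳ k)) (≡.sym (ℕₚ.+-identityʳ l)) λ i j →
    trans (h i j) (reflexive (≡.sym (≡.cong₂ B (cast-↑ˡ i) (cast-↑ˡ j))))

  module _ {r q} (H : Multigraph (suc r) q) (S : Subset q) where

    private
      ρ = reduce id zero id (λ i → i , ≡.refl) ≡.refl H S

      padded : rdet (λ i → inc id (H (elements S i))) ≈ rdet (row id ∘ forestRows ρ {0} [])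
      padded = rdet-pad λ i j → sym (trans
        (reflexive (≡.cong (λ x → row id x (j ↑ˡ 0)) (lookup-++ˡ (plain ∘ H ∘ elements S) [] i)))
        (reflexive (lookup-++ˡ (inc id (H (elements S i))) (λ (_ : Fin 0) → 0#) j)))

    -- With an empty border, contracting the whole tree leaves the empty determinant 1, so only the
    -- sign remains.
    rdet-tree : IsSpanningTree H S → IsSign (rdet (λ i → inc id (H (elements S i))))
    rdet-tree tree with e , e± , h ← rdet-forest ρ {0} (proj₁ tree) (tree⇒componentMap tree) ≡.refl =
      isSign-resp (sym (trans padded (trans (h []) (trans (*-congˡ (rdet-empty _)) (*-identityʳ e))))) e±

    rdet-nontree : ¬ IsSpanningTree H S → rdet (λ i → inc id (H (elements S i))) ≈ 0#
    rdet-nontree ¬tree = trans padded (rdet-nonforest ρ (¬tree ∘ forest⇒tree) ≡.refl [])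

    rdet-tree-square : (t? : Dec (IsSpanningTree H S)) (x : Carrier) →
      (let d = rdet (λ i → inc id (H (elements S i)))) → (d * d) * x ≈ (if does t? then x else 0#)
    rdet-tree-square (yes t) x = trans (*-congʳ (isSign-square (rdet-tree t))) (*-identityˡ x)
    rdet-tree-square (no ¬t) x = trans (*-congʳ (trans (*-congʳ (rdet-nontree ¬t)) (zeroˡ _))) (zeroˡ x)

  -- Indexing by a type of named blocks turns a change of block order into a change of enumeration,
  -- which acts on rows and columns alike and so has no sign.
  rdet-enumerations : ∀ {k l b} {I : Set b} (e : Fin k ↔ I) (e′ : Fin l ↔ I) (M : I → I → Carrier) →
    rdet (λ i j → M (Inverse.to e i) (Inverse.to e j)) ≈ rdet (λ i j → M (Inverse.to e′ i) (Inverse.to e′ j))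
  rdet-enumerations e e′ M = trans
    (sym (rdet-conjugate (↔-sym e ↔-∘ e′) (λ i j → M (Inverse.to e i) (Inverse.to e j))))
    (rdet-cong λ i j → reflexive (≡.cong₂ M (back i) (back j)))
    where
    back : ∀ i → Inverse.to e (Inverse.from e (Inverse.to e′ i)) ≡ Inverse.to e′ i
    back i = Inverse.inverseˡ e ≡.refl

  sumOver-cong : ∀ {m} {P : Subset m → Set} (P? : ∀ F → Dec (P F)) {f f′ : ∀ F → P F → Carrier} →
    (∀ F F∈ → f F F∈ ≈ f′ F F∈) → sumOver P? f ≈ sumOver P? f′
  sumOver-cong {m} P? {f} {f′} h = sumOverSubsets-cong {m} λ F → term F (P? F)
    where
    term : ∀ F (d : Dec _) → withProof d (f F) ≈ withProof d (f′ F)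
    term F (yes F∈) = h F F∈
    term F (no _)   = refl

-- Forest expansions of the minors, multiplied through by `τ` and `Φ`.

module Transfer {a ℓ} (R : CommutativeRing a ℓ) {n m q : ℕ}
  (G : Multigraph (suc n) m) (simple : Simple G) (c : Fin m → CommutativeRing.Carrier R) (g : Fin (suc n))
  (P : Multigraph (suc n) q)
  (order : ∀ {r} F → IsSpanningForest G (suc r) F → ComponentOrder G g F r) where

  open CommutativeRing R hiding (zero)
  open LinearAlgebra R
  open Determinant R
  open Block R
  open CauchyBinet R
  open Incidence R
  open Trees R
  open Network R G c g P order
  open import Algebra.Properties.Ring ring using (-‿distribˡ-*; -‿distribʳ-*; -‿involutive; -0#≈0#)
  open import Algebra.Properties.Semiring.Sum semiring using (sum)
  open import Relation.Binary.Reasoning.Setoid setoid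

  private
    δ : Fin m → Fin (suc n) → Carrier
    δ e u = indicator (u ≟ proj₂ (G e)) - indicator (u ≟ proj₁ (G e))

    x-0 : ∀ x → x - 0# ≈ x
    x-0 x = trans (+-congˡ -0#≈0#) (+-identityʳ x)

    δ-none : ∀ e u → u ≢ proj₂ (G e) → u ≢ proj₁ (G e) → δ e u ≈ 0#
    δ-none e u ≢h ≢t = trans (+-cong (reflexive (indicator-no (u ≟ _) ≢h)) (-‿cong (reflexive (indicator-no (u ≟ _) ≢t)))) (x-0 0#)

    δ-head : ∀ e → δ e (proj₂ (G e)) ≈ 1#
    δ-head e = trans (+-cong (reflexive (indicator-yes (proj₂ (G e) ≟ _) ≡.refl))
      (-‿cong (reflexive (indicator-no (proj₂ (G e) ≟ _) (proj₁ simple e ∘ ≡.sym))))) (x-0 1#)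

    δ-tail : ∀ e → δ e (proj₁ (G e)) ≈ - 1#
    δ-tail e = trans (+-cong (reflexive (indicator-no (proj₁ (G e) ≟ _) (proj₁ simple e)))
      (-‿cong (reflexive (indicator-yes (proj₁ (G e) ≟ _) ≡.refl)))) (+-identityˡ _)

    δ-joins : ∀ e {u v} → Joins G e u v → δ e u * δ e v ≈ - 1#
    δ-joins e (inj₁ ≡.refl) = trans (*-cong (δ-tail e) (δ-head e)) (*-identityʳ _)
    δ-joins e (inj₂ ≡.refl) = trans (*-cong (δ-head e) (δ-tail e)) (*-identityˡ _)

    δ-notJoins : ∀ e {u v} → u ≢ v → ¬ Joins G e u v → δ e u * δ e v ≈ 0#
    δ-notJoins e {u} {v} u≢v ¬j with u ≟ proj₂ (G e) | u ≟ proj₁ (G e)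
    ... | no ≢h | no ≢t = trans (*-congʳ (x-0 0#)) (zeroˡ _)
    ... | yes ≡.refl | _ = trans (*-congˡ (δ-none e v (u≢v ∘ ≡.sym) λ { ≡.refl → ¬j (inj₂ ≡.refl) })) (zeroʳ _)
    ... | no _ | yes ≡.refl = trans (*-congˡ (δ-none e v (λ { ≡.refl → ¬j (inj₁ ≡.refl) }) (u≢v ∘ ≡.sym))) (zeroʳ _)

    δ-incident : ∀ e u (d : Dec (Incident G e u)) → c e * (δ e u * δ e u) ≈ (if does d then c e else 0#)
    δ-incident e u (yes (inj₁ ≡.refl)) = trans (*-congˡ (trans (*-cong (δ-tail e) (δ-tail e)) -1*-1≈1)) (*-identityʳ _)
    δ-incident e u (yes (inj₂ ≡.refl)) = trans (*-congˡ (trans (*-cong (δ-head e) (δ-head e)) (*-identityˡ _))) (*-identityʳ _)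
    δ-incident e u (no ¬inc) = trans (*-congˡ (trans (*-congʳ (δ-none e u (¬inc ∘ inj₂ ∘ ≡.sym) (¬inc ∘ inj₁ ∘ ≡.sym))) (zeroˡ _))) (zeroʳ _)

  -- In the absence of loops the two ends of an edge have the entries 1 and -1. In the absence of
  -- parallel edges at most one term of an off-diagonal sum survives.
  laplacian-factors : ∀ u v → laplacian u v ≈ ∑ λ e → c e * (δ e u * δ e v)
  laplacian-factors u v with u ≟ v
  ... | yes ≡.refl = trans (sym (∑≈sum _)) (∑-cong λ e → sym (δ-incident e u (incident? G e u)))
  ... | no u≢v with edge? G u v
  ...   | yes (e , j) = sym (trans
          (∑-single _ e λ e′ e′≢e → trans (*-congˡ (δ-notJoins e′ u≢v λ j′ → e′≢e (proj₂ simple j′ j))) (zeroʳ _))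
          (trans (*-congˡ (δ-joins e j)) (trans (sym (-‿distribʳ-* _ _)) (-‿cong (*-identityʳ _)))))
  ...   | no none = sym (∑-zero λ e → trans (*-congˡ (δ-notJoins e u≢v λ j → none (e , j))) (zeroʳ _))

  private
    ℓ₀ : Fin (suc n) → Fin (suc n)
    ℓ₀ = groundLabel g

    grounded : ∀ i v → indicator (punchIn g i ≟ v) ≡ indicator (ℓ₀ v ≟ suc i)
    grounded i v = indicator-⇔ (punchIn g i ≟ v) (ℓ₀ v ≟ suc i)
      (λ eq → ≡.trans (≡.cong ℓ₀ (≡.sym eq)) (groundLabel-punchIn g i)) (groundLabel-suc g)

    incident : ∀ i e → indicator (punchIn g i ≟ proj₂ e) - indicator (punchIn g i ≟ proj₁ e) ≈ inc ℓ₀ e i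
    incident i e = +-cong (reflexive (grounded i (proj₂ e))) (-‿cong (reflexive (grounded i (proj₁ e))))

  K-factors : ∀ i j → K i j ≈ ∑ λ e → c e * (inc ℓ₀ (G e) i * inc ℓ₀ (G e) j)
  K-factors i j = trans (laplacian-factors (punchIn g i) (punchIn g j)) (∑-cong λ e → *-congˡ {c e} (*-cong (incident i (G e)) (incident j (G e))))

  D-inc : ∀ i p → D i p ≈ inc ℓ₀ (P p) i
  D-inc i p = incident i (P p)

  -- The sum over non-ground vertices finds each end of a port and reads off its component. An end
  -- at the ground is missed, in agreement with component zero having no row in `Q`.
  B-inc : ∀ {r F} (F∈ : F ∈𝓕 suc r) t p → B F∈ t p ≈ inc (ComponentOrder.comp (order F F∈)) (P p) t
  B-inc {F = F} F∈ t p = begin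
    sum (λ i → Q F∈ t i * D i p)
      ≈⟨ ∑≈sum _ ⟨
    ∑ (λ i → Q F∈ t i * D i p)
      ≈⟨ ∑-cong (λ i → trans (distribˡ _ _ _) (+-congˡ (sym (-‿distribʳ-* _ _)))) ⟩
    ∑ (λ i → Q F∈ t i * indicator (punchIn g i ≟ proj₂ (P p)) - Q F∈ t i * indicator (punchIn g i ≟ proj₁ (P p)))
      ≈⟨ trans (∑-+ (λ i → Q F∈ t i * indicator (punchIn g i ≟ proj₂ (P p))) _) (+-congˡ (∑-neg λ i → Q F∈ t i * indicator (punchIn g i ≟ proj₁ (P p)))) ⟩
    ∑ (λ i → Q F∈ t i * indicator (punchIn g i ≟ proj₂ (P p))) - ∑ (λ i → Q F∈ t i * indicator (punchIn g i ≟ proj₁ (P p)))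
      ≈⟨ +-cong (pick (proj₂ (P p))) (-‿cong (pick (proj₁ (P p)))) ⟩
    inc comp (P p) t ∎
    where
    open ComponentOrder (order F F∈)
    pick : ∀ v → ∑ (λ i → Q F∈ t i * indicator (punchIn g i ≟ v)) ≈ indicator (comp v ≟ suc t)
    pick v with groundLabel g v in eq
    ... | suc j with ≡.refl ← groundLabel-suc g eq = trans
      (∑-single _ j λ i i≢j → trans (*-congˡ (reflexive (indicator-no (punchIn g i ≟ punchIn g j) (i≢j ∘ punchIn-injective g i j)))) (zeroʳ _))
      (trans (*-congˡ (reflexive (indicator-yes (punchIn g j ≟ punchIn g j) ≡.refl))) (*-identityʳ _))
    ... | zero with ≡.refl ← groundLabel-injective g {g} {v} (≡.trans (groundLabel-ground g) (≡.sym eq)) = trans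
      (∑-zero λ i → trans (*-congˡ (reflexive (indicator-no (punchIn g i ≟ g) (punchInᵢ≢i g i)))) (zeroʳ _))
      (reflexive (≡.sym (indicator-no (comp g ≟ suc t) λ eq → case-zero (≡.trans (≡.sym ground) eq))))
      where
      case-zero : ∀ {k} {i : Fin k} → ¬ (zero ≡ suc i)
      case-zero ()

  -- This is `K` enlarged by `k` zero rows and columns, written as a sum over edges so that
  -- Cauchy-Binet applies.
  edgeForm : ∀ k → Matrix (n ℕ.+ k) (n ℕ.+ k)
  edgeForm k i j = ∑ λ e → c e * (row ℓ₀ (plain {k = k} (G e)) i * row ℓ₀ (plain {k = k} (G e)) j)

  module _ {k p : ℕ} (W : Vector (Item {suc n} k × Item {suc n} k) p) where

    private
      first second : Vector (Item k) p
      first  = proj₁ ∘ W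
      second = proj₂ ∘ W

      both : Edge {suc n} → Item k × Item k
      both e = plain e , plain e

      S = edgeForm k

      compRows : ∀ {r F} → F ∈𝓕 suc r → (V : Vector (Item k) p) → Matrix p (r ℕ.+ k)
      compRows {F = F} F∈ V = row (ComponentOrder.comp (order F F∈)) ∘ V

    -- Cauchy–Binet with the edges sorted by the forest that they form.
    rdet-forestSum : ∀ {r} → p ≡ r ℕ.+ k →
      rdet (bordered (row ℓ₀ ∘ first) (row ℓ₀ ∘ second) S) ≈
      ∑𝓕 (suc r) λ F F∈ → rdet (compRows F∈ first) * rdet (compRows F∈ second) * w F
    rdet-forestSum {r} p≡r+k = trans (cauchyBinet (row ℓ₀ ∘ proj₁) (row ℓ₀ ∘ proj₂) c (both ∘ G) W)
      (sumOverSubsets-cong {m} λ F → term F (spanningForest? G (suc r) F))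
      where
      rows : ∀ F (φ : Item {suc n} k × Item {suc n} k → Item {suc n} k) → (∀ e → φ (both e) ≡ plain e) →
        rdet (row ℓ₀ ∘ φ ∘ ((both ∘ G ∘ elements F) ++ W)) ≈ rdet (row ℓ₀ ∘ forestRows (reduceGround g G F) (φ ∘ W))
      rows F φ φ-both = rdet-≗ λ i → ≡.cong (row ℓ₀) (eq i)
        where
        eq : ∀ i → φ (((both ∘ G ∘ elements F) ++ W) i) ≡ forestRows (reduceGround g G F) (φ ∘ W) i
        eq i with splitAt ∣ F ∣ i
        ... | inj₁ i = φ-both (G (elements F i))
        ... | inj₂ i = ≡.refl
      term : ∀ F (d : Dec (F ∈𝓕 suc r)) →
        weight c F * (rdet (row ℓ₀ ∘ proj₁ ∘ ((both ∘ G ∘ elements F) ++ W)) * rdet (row ℓ₀ ∘ proj₂ ∘ ((both ∘ G ∘ elements F) ++ W)))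
        ≈ withProof d λ F∈ → rdet (compRows F∈ first) * rdet (compRows F∈ second) * w F
      term F (yes F∈) = go (rdet-forest (reduceGround g G F) {k} (proj₁ F∈) isComponentMap ground)
        where
        open ComponentOrder (order F F∈)
        go : (∃ λ e → IsSign e × ∀ {p} (V : Vector (Item k) p) → rdet (row ℓ₀ ∘ forestRows (reduceGround g G F) V) ≈ e * rdet (row comp ∘ V)) →
          weight c F * (rdet (row ℓ₀ ∘ proj₁ ∘ ((both ∘ G ∘ elements F) ++ W)) * rdet (row ℓ₀ ∘ proj₂ ∘ ((both ∘ G ∘ elements F) ++ W)))
          ≈ rdet (compRows F∈ first) * rdet (compRows F∈ second) * w F
        go (e , e± , h) = begin
          weight c F * (rdet (row ℓ₀ ∘ proj₁ ∘ ((both ∘ G ∘ elements F) ++ W)) * rdet (row ℓ₀ ∘ proj₂ ∘ ((both ∘ G ∘ elements F) ++ W)))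
            ≈⟨ *-congˡ {weight c F} (*-cong (trans (rows F proj₁ λ _ → ≡.refl) (h first)) (trans (rows F proj₂ λ _ → ≡.refl) (h second))) ⟩
          weight c F * ((e * rdet (compRows F∈ first)) * (e * rdet (compRows F∈ second)))
            ≈⟨ *-congˡ {weight c F} (sign-cancel e±) ⟩
          weight c F * (rdet (compRows F∈ first) * rdet (compRows F∈ second))
            ≈⟨ *-comm _ _ ⟩
          rdet (compRows F∈ first) * rdet (compRows F∈ second) * w F ∎
      term F (no F∉) = trans (*-congˡ {weight c F} (trans (*-congʳ
        (trans (rows F proj₁ λ _ → ≡.refl) (rdet-nonforest (reduceGround g G F) F∉ p≡r+k first))) (zeroˡ _))) (zeroʳ _)

    private
      -- Ports, non-ground vertices and tail positions. The border used for Cauchy-Binet lists them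
      -- in this order (`pnk`); eliminating `K` requires the vertices to come last (`kpn`).
      Index : Set
      Index = Fin p ⊎ (Fin n ⊎ Fin k)

      𝓜 : Index → Index → Carrier
      𝓜 (inj₁ i)        (inj₁ j)        = 0#
      𝓜 (inj₁ i)        (inj₂ (inj₁ v)) = - inc ℓ₀ (proj₁ (second i)) v
      𝓜 (inj₁ i)        (inj₂ (inj₂ b)) = - proj₂ (second i) b
      𝓜 (inj₂ (inj₁ u)) (inj₁ j)        = inc ℓ₀ (proj₁ (first j)) u
      𝓜 (inj₂ (inj₁ u)) (inj₂ (inj₁ v)) = K u v
      𝓜 (inj₂ (inj₁ u)) (inj₂ (inj₂ b)) = 0#
      𝓜 (inj₂ (inj₂ a)) (inj₁ j)        = proj₂ (first j) a
      𝓜 (inj₂ (inj₂ a)) (inj₂ _)        = 0#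

      pnk : Fin (p ℕ.+ (n ℕ.+ k)) ↔ Index
      pnk = (Perm.id ⊎-↔ +↔⊎) ↔-∘ +↔⊎

      kpn : Fin ((k ℕ.+ p) ℕ.+ n) ↔ Index
      kpn = mk↔ₛ′ (λ { (inj₁ (inj₁ a)) → inj₂ (inj₂ a) ; (inj₁ (inj₂ i)) → inj₁ i ; (inj₂ u) → inj₂ (inj₁ u) })
                  (λ { (inj₁ i) → inj₁ (inj₂ i) ; (inj₂ (inj₁ u)) → inj₂ u ; (inj₂ (inj₂ a)) → inj₁ (inj₁ a) })
                  (λ { (inj₁ i) → ≡.refl ; (inj₂ (inj₁ u)) → ≡.refl ; (inj₂ (inj₂ a)) → ≡.refl })
                  (λ { (inj₁ (inj₁ a)) → ≡.refl ; (inj₁ (inj₂ i)) → ≡.refl ; (inj₂ u) → ≡.refl })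
            ↔-∘ ((+↔⊎ ⊎-↔ Perm.id) ↔-∘ +↔⊎)

      S-𝓜 : ∀ i j → S i j ≈ 𝓜 (inj₂ (splitAt n i)) (inj₂ (splitAt n j))
      S-𝓜 i j with splitAt n i | splitAt n j
      ... | inj₁ u | inj₁ v = sym (K-factors u v)
      ... | inj₁ u | inj₂ b = ∑-zero λ e → trans (*-congˡ (zeroʳ _)) (zeroʳ _)
      ... | inj₂ a | _      = ∑-zero λ e → trans (*-congˡ (zeroˡ _)) (zeroʳ _)

      bordered-𝓜 : ∀ i j → bordered (row ℓ₀ ∘ first) (row ℓ₀ ∘ second) S i j ≈ 𝓜 (Inverse.to pnk i) (Inverse.to pnk j)
      bordered-𝓜 i j with splitAt p i
      bordered-𝓜 i j | inj₁ x with splitAt p j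
      ... | inj₁ y = refl
      ... | inj₂ y with splitAt n y
      ...   | inj₁ v = refl
      ...   | inj₂ b = refl
      bordered-𝓜 i j | inj₂ x with splitAt p j
      ... | inj₂ y = S-𝓜 x y
      ... | inj₁ y with splitAt n x
      ...   | inj₁ u = refl
      ...   | inj₂ a = refl

      L : Matrix k p
      L a j = proj₂ (first j) a
      L⁻ : Matrix p k
      L⁻ i b = - proj₂ (second i) b
      Dᶠ : Matrix (k ℕ.+ p) n
      Dᶠ = 𝟎 ++ λ i v → - inc ℓ₀ (proj₁ (second i)) v
      Dˢ : Matrix n (k ℕ.+ p)
      Dˢ u = (λ _ → 0#) ++ λ j → inc ℓ₀ (proj₁ (first j)) u

      𝓜-block : ∀ i j → 𝓜 (Inverse.to kpn i) (Inverse.to kpn j) ≈ block (block 𝟎 L L⁻ 𝟎) Dᶠ Dˢ K i j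
      𝓜-block i j with splitAt (k ℕ.+ p) i
      𝓜-block i j | inj₁ x with splitAt (k ℕ.+ p) j
      𝓜-block i j | inj₁ x | inj₁ y with splitAt k x
      ... | inj₁ a with splitAt k y
      ...   | inj₁ b = refl
      ...   | inj₂ j′ = refl
      𝓜-block i j | inj₁ x | inj₁ y | inj₂ i′ with splitAt k y
      ...   | inj₁ b = refl
      ...   | inj₂ j′ = refl
      𝓜-block i j | inj₁ x | inj₂ v with splitAt k x
      ... | inj₁ a = refl
      ... | inj₂ i′ = refl
      𝓜-block i j | inj₂ u with splitAt (k ℕ.+ p) j
      ... | inj₂ v = refl
      ... | inj₁ y with splitAt k y
      ...   | inj₁ b = refl
      ...   | inj₂ j′ = refl

    -- The product of the incidence rows of the second items, K⁻¹, and the incidence columns of the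
    -- first items. It is `Z` or a submatrix of it, and appears as the Schur complement of `K`.
    portMatrix : Matrix n n → Matrix p p
    portMatrix K⁻¹ i j = ∑ λ t → ∑ (λ s → inc ℓ₀ (proj₁ (proj₂ (W i))) s * K⁻¹ s t) * inc ℓ₀ (proj₁ (proj₁ (W j))) t

    rdet-eliminateK : ∀ (K⁻¹ : Matrix n n) → (∀ i j → ∑ (λ t → K⁻¹ i t * K t j) ≈ identity i j) →
      rdet (bordered (row ℓ₀ ∘ first) (row ℓ₀ ∘ second) S) ≈
      rdet (block 𝟎 (λ a j → proj₂ (proj₁ (W j)) a) (λ i b → - proj₂ (proj₂ (W i)) b) (portMatrix K⁻¹)) * rdet K
    rdet-eliminateK K⁻¹ K⁻¹K≈1 = begin
      rdet (bordered (row ℓ₀ ∘ first) (row ℓ₀ ∘ second) S)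
        ≈⟨ rdet-cong bordered-𝓜 ⟩
      rdet (λ i j → 𝓜 (Inverse.to pnk i) (Inverse.to pnk j))
        ≈⟨ rdet-enumerations pnk kpn 𝓜 ⟩
      rdet (λ i j → 𝓜 (Inverse.to kpn i) (Inverse.to kpn j))
        ≈⟨ rdet-cong 𝓜-block ⟩
      rdet (block (block 𝟎 L L⁻ 𝟎) Dᶠ Dˢ K)
        ≈⟨ rdet-schur (block 𝟎 L L⁻ 𝟎) Dᶠ Dˢ K K⁻¹ K⁻¹K≈1 ⟩
      rdet (λ i j → block 𝟎 L L⁻ 𝟎 i j - ∑ λ t → ∑ (λ s → Dᶠ i s * K⁻¹ s t) * Dˢ t j) * rdet K
        ≈⟨ *-congʳ (rdet-cong complement) ⟩
      rdet (block 𝟎 L L⁻ (portMatrix K⁻¹)) * rdet K ∎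
      where
      -0≈ : ∀ {x y} → y ≈ 0# → x - y ≈ x
      -0≈ {x} y≈0 = trans (+-congˡ (-‿cong y≈0)) (x-0 x)
      zeroCol : ∀ (f : Vector Carrier n) → ∑ (λ t → f t * 0#) ≈ 0#
      zeroCol f = ∑-zero λ t → zeroʳ (f t)
      zeroRow : ∀ (f : Vector Carrier n) → ∑ (λ t → ∑ (λ s → 0# * K⁻¹ s t) * f t) ≈ 0#
      zeroRow f = ∑-zero λ t → trans (*-congʳ (∑-zero λ s → zeroˡ (K⁻¹ s t))) (zeroˡ (f t))
      negate : ∀ i j → 0# - ∑ (λ t → ∑ (λ s → - inc ℓ₀ (proj₁ (second i)) s * K⁻¹ s t) * inc ℓ₀ (proj₁ (first j)) t) ≈ portMatrix K⁻¹ i j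
      negate i j = begin
        0# - ∑ (λ t → ∑ (λ s → - inc ℓ₀ (proj₁ (second i)) s * K⁻¹ s t) * inc ℓ₀ (proj₁ (first j)) t)
          ≈⟨ +-identityˡ _ ⟩
        - ∑ (λ t → ∑ (λ s → - inc ℓ₀ (proj₁ (second i)) s * K⁻¹ s t) * inc ℓ₀ (proj₁ (first j)) t)
          ≈⟨ -‿cong (∑-cong λ t → trans (*-congʳ (trans (∑-cong λ s → sym (-‿distribˡ-* _ _)) (∑-neg λ s → inc ℓ₀ (proj₁ (second i)) s * K⁻¹ s t)))
                                         (sym (-‿distribˡ-* _ _))) ⟩
        - ∑ (λ t → - (∑ (λ s → inc ℓ₀ (proj₁ (second i)) s * K⁻¹ s t) * inc ℓ₀ (proj₁ (first j)) t))
          ≈⟨ trans (-‿cong (∑-neg _)) (-‿involutive _) ⟩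
        portMatrix K⁻¹ i j ∎
      complement : ∀ i j → block 𝟎 L L⁻ 𝟎 i j - ∑ (λ t → ∑ (λ s → Dᶠ i s * K⁻¹ s t) * Dˢ t j) ≈ block 𝟎 L L⁻ (portMatrix K⁻¹) i j
      complement i j with splitAt k i
      complement i j | inj₁ a with splitAt k j
      ... | inj₁ b = -0≈ (zeroRow λ _ → 0#)
      ... | inj₂ j′ = -0≈ (zeroRow λ t → inc ℓ₀ (proj₁ (first j′)) t)
      complement i j | inj₂ i′ with splitAt k j
      ... | inj₁ b = -0≈ (zeroCol _)
      ... | inj₂ j′ = negate i′ j′

    forestFormula : ∀ {r} → p ≡ r ℕ.+ k → (K⁻¹ : Matrix n n) → (∀ i j → ∑ (λ t → K⁻¹ i t * K t j) ≈ identity i j) →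
      rdet (block 𝟎 L L⁻ (portMatrix K⁻¹)) * rdet K ≈
      ∑𝓕 (suc r) λ F F∈ → rdet (compRows F∈ first) * rdet (compRows F∈ second) * w F
    forestFormula p≡r+k K⁻¹ K⁻¹K≈1 = trans (sym (rdet-eliminateK K⁻¹ K⁻¹K≈1)) (rdet-forestSum p≡r+k)

  compOf : ∀ {r F} → F ∈𝓕 suc r → Fin (suc n) → Fin (suc r)
  compOf {F = F} F∈ = ComponentOrder.comp (order F F∈)

  -- The weighted matrix-tree theorem, obtained as the case of an empty border: forests with one
  -- component are the spanning trees, and both determinants are empty.
  rdet-K : rdet K ≈ τ
  rdet-K = begin
    rdet K
      ≈⟨ rdet-pad {B = edgeForm 0} (λ i j → trans (K-factors i j) (∑-cong λ e → *-congˡ {c e} (*-cong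
           (reflexive (≡.sym (lookup-++ˡ (inc ℓ₀ (G e)) (λ (_ : Fin 0) → 0#) i))) (reflexive (≡.sym (lookup-++ˡ (inc ℓ₀ (G e)) (λ (_ : Fin 0) → 0#) j)))))) ⟩
    rdet (edgeForm 0)
      ≈⟨ rdet-forestSum none {0} ≡.refl ⟩
    ∑𝓕 1 _
      ≈⟨ sumOverSubsets-cong {m} (λ F → term F (spanningForest? G 1 F) (spanningTree? G F)) ⟩
    τ ∎
    where
    none : Vector (Item {suc n} 0 × Item {suc n} 0) 0
    none ()
    term : ∀ F (f? : Dec (F ∈𝓕 1)) (t? : Dec (IsSpanningTree G F)) →
      withProof f? (λ F∈ → rdet (row (compOf F∈) ∘ proj₁ ∘ none) * rdet (row (compOf F∈) ∘ proj₂ ∘ none) * w F) ≈ withProof t? (λ _ → w F)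
    term F (yes F∈) (yes t) = trans (*-congʳ (trans (*-cong (rdet-empty _) (rdet-empty _)) (*-identityˡ _))) (*-identityˡ _)
    term F (yes F∈) (no ¬t) = contradiction (forest⇒tree F∈) ¬t
    term F (no F∉)  (yes t) = contradiction (tree⇒forest t) F∉
    term F (no F∉)  (no ¬t) = refl

  χ-rows : ∀ {r F} (F∈ : F ∈𝓕 suc r) (A : Subset q) (∣A∣≡r : ∣ A ∣ ≡ r) →
    χ F∈ A ∣A∣≡r ≈ rdet (λ i → row {k = 0} (compOf F∈) (plain (P (enum A ∣A∣≡r i))))
  χ-rows {r} F∈ A ∣A∣≡r = trans (det≈rdet _) (trans (rdet-ᵀ _)
    (rdet-cast ≡.refl (≡.sym (ℕₚ.+-identityʳ r)) λ i j → trans (B-inc F∈ j (enum A ∣A∣≡r i)) (reflexive (≡.sym (≡.trans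
      (≡.cong₂ (λ i j → row {k = 0} (compOf F∈) (plain (P (enum A ∣A∣≡r i))) j) (cast-is-id ≡.refl i) (cast-↑ˡ j))
      (lookup-++ˡ (inc (compOf F∈) (P (enum A ∣A∣≡r i))) (λ (_ : Fin 0) → 0#) j))))))

  χ̂-rows : ∀ {k r F} (F∈ : F ∈𝓕 suc r) (r+k≡q : r ℕ.+ k ≡ q) (I : Subset q) (∣I∣≡k : ∣ I ∣ ≡ k) →
    χ̂ F∈ r+k≡q I ∣I∣≡k ≈ rdet (λ p → row (compOf F∈) (P p , λ b → identity p (enum I ∣I∣≡k b)))
  χ̂-rows {k} {r} F∈ r+k≡q I ∣I∣≡k = trans (det≈rdet _) (trans (rdet-ᵀ _) (rdet-cast ≡.refl (≡.sym r+k≡q) λ p i →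
    trans (entry p (cast (≡.sym r+k≡q) i)) (reflexive (≡.cong (λ p → row (compOf F∈) (P p , λ b → identity p (enum I ∣I∣≡k b)) (cast (≡.sym r+k≡q) i))
      (≡.sym (cast-is-id ≡.refl p))))))
    where
    entry : ∀ p x → (B F∈ ++ E F∈ I ∣I∣≡k ᵀ) x p ≈ row (compOf F∈) (P p , λ b → identity p (enum I ∣I∣≡k b)) x
    entry p x with splitAt r x
    ... | inj₁ t = B-inc F∈ t p
    ... | inj₂ b = refl

  -- `H F∈` is `P` with its ends replaced by their components, so its incidence rows for the
  -- identity labelling are those of `P` for `compOf F∈`. The tree criterion thus becomes applicable
  -- to the quotient graph.
  χ-elements : ∀ {r F} (F∈ : F ∈𝓕 suc r) (A : Subset q) (∣A∣≡r : ∣ A ∣ ≡ r) →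
    χ F∈ A ∣A∣≡r ≈ rdet (λ i → inc id (H F∈ (elements A i)))
  χ-elements F∈ A ∣A∣≡r = trans (det≈rdet _) (trans (rdet-ᵀ _) (rdet-cast (≡.sym ∣A∣≡r) ≡.refl λ i j →
    trans (B-inc F∈ j (enum A ∣A∣≡r i)) (reflexive (≡.cong (inc id (H F∈ (enum A ∣A∣≡r i))) (≡.sym (cast-is-id ≡.refl j))))))

  -- Listing the virtual edges outside I before those in I makes the completed matrix block triangular.
  χ̂-complement : ∀ {k r F} (F∈ : F ∈𝓕 suc r) (r+k≡q : r ℕ.+ k ≡ q) (I : Subset q) (∣I∣≡k : ∣ I ∣ ≡ k) →
    ∃ λ e → IsSign e × χ̂ F∈ r+k≡q I ∣I∣≡k ≈ e * rdet (λ i → inc id (H F∈ (elements (∁ I) i)))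
  χ̂-complement {k} {r} F∈ r+k≡q I ≡.refl with e , e± , h ← rdet-permuteRows (partition I ↔-∘ +↔⊎) = e , e± , (begin
    χ̂ F∈ r+k≡q I ≡.refl
      ≈⟨ χ̂-rows F∈ r+k≡q I ≡.refl ⟩
    rdet rows
      ≈⟨ trans (sym (*-identityˡ _)) (*-congʳ (sym (isSign-square e±))) ⟩
    (e * e) * rdet rows
      ≈⟨ *-assoc _ _ _ ⟩
    e * (e * rdet rows)
      ≈⟨ *-congˡ (h rows) ⟨
    e * rdet (rows ∘ Sum.[ elements (∁ I) , elements I ] ∘ splitAt ∣ ∁ I ∣)
      ≈⟨ *-congˡ (rdet-cong sorted) ⟩
    e * rdet (block (λ i → inc id (H F∈ (elements (∁ I) i))) 𝟎 (λ i → inc id (H F∈ (elements I i))) (identity {k}))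
      ≈⟨ *-congˡ (rdet-lowerTriangular _ _ _ (inj₁ ∣∁I∣≡r)) ⟩
    e * (rdet (λ i → inc id (H F∈ (elements (∁ I) i))) * rdet (identity {k}))
      ≈⟨ *-congˡ (trans (*-congˡ rdet-identity) (*-identityʳ _)) ⟩
    e * rdet (λ i → inc id (H F∈ (elements (∁ I) i))) ∎)
    where
    rows : Matrix q (r ℕ.+ k)
    rows p = row (compOf F∈) (P p , λ b → identity p (enum I ≡.refl b))
    ∣∁I∣≡r : ∣ ∁ I ∣ ≡ r
    ∣∁I∣≡r = ≡.trans (∣∁p∣≡n∸∣p∣ I) (≡.trans (≡.cong (ℕ._∸ k) (≡.sym r+k≡q)) (ℕₚ.m+n∸n≡m r k))
    injective : ∀ {x y} → Sum.[ elements (∁ I) , elements I ] x ≡ Sum.[ elements (∁ I) , elements I ] y → x ≡ y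
    injective {x} {y} eq = ≡.trans (≡.sym (Inverse.inverseʳ (partition I) ≡.refl)) (Inverse.inverseʳ (partition I) eq)
    enum-refl : ∀ b → enum I ≡.refl b ≡ elements I b
    enum-refl b = ≡.cong (elements I) (cast-is-id ≡.refl b)
    inj₂-injective : ∀ {x y : Fin ∣ I ∣} → inj₂ {A = Fin ∣ ∁ I ∣} x ≡ inj₂ y → x ≡ y
    inj₂-injective ≡.refl = ≡.refl
    sorted : ∀ i j → rows (Sum.[ elements (∁ I) , elements I ] (splitAt ∣ ∁ I ∣ i)) j
                     ≈ block (λ i → inc id (H F∈ (elements (∁ I) i))) 𝟎 (λ i → inc id (H F∈ (elements I i))) (identity {k}) i j
    sorted i j with splitAt ∣ ∁ I ∣ i
    ... | inj₁ i = ++-≈ {u = inc (compOf F∈) (P (elements (∁ I) i))} (λ _ → refl) (λ b → reflexive (indicator-no (elements (∁ I) i ≟ enum I ≡.refl b)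
            λ eq → case (injective {inj₁ i} {inj₂ b} (≡.trans eq (enum-refl b))))) j
      where
      case : ∀ {b} → ¬ (inj₁ i ≡ inj₂ {B = Fin ∣ I ∣} b)
      case ()
    ... | inj₂ i = ++-≈ {u = inc (compOf F∈) (P (elements I i))} (λ _ → refl) (λ b → reflexive (indicator-⇔ (elements I i ≟ enum I ≡.refl b) (i ≟ b)
            (λ eq → inj₂-injective (injective {inj₂ i} {inj₂ b} (≡.trans eq (enum-refl b))))
            (λ { ≡.refl → ≡.sym (enum-refl b) }))) j

  Z-inc : ∀ K⁻¹ i j → Z K⁻¹ i j ≈ ∑ λ t → ∑ (λ s → inc ℓ₀ (P i) s * K⁻¹ s t) * inc ℓ₀ (P j) t
  Z-inc K⁻¹ i j = trans (sym (∑≈sum _)) (∑-cong λ t → *-cong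
    (trans (sym (∑≈sum _)) (∑-cong λ s → *-congʳ (D-inc s i))) (D-inc t j))

  module _ (K⁻¹ : Matrix n n) (K⁻¹K≈1 : ∀ i j → ∑ (λ t → K⁻¹ i t * K t j) ≈ identity i j) where

    det-Z-minor : ∀ {r} (A B : Subset q) (∣A∣≡r : ∣ A ∣ ≡ r) (∣B∣≡r : ∣ B ∣ ≡ r) →
      det (Z K⁻¹ [ enum A ∣A∣≡r , enum B ∣B∣≡r ]) * τ ≈ ∑𝓕 (suc r) λ F F∈ → χ F∈ A ∣A∣≡r * χ F∈ B ∣B∣≡r * w F
    det-Z-minor {r} A B ∣A∣≡r ∣B∣≡r = begin
      det (Z K⁻¹ [ enum A ∣A∣≡r , enum B ∣B∣≡r ]) * τ
        ≈⟨ *-cong (trans (det≈rdet _) (rdet-cong λ i j → Z-inc K⁻¹ (enum A ∣A∣≡r i) (enum B ∣B∣≡r j))) (sym rdet-K) ⟩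
      rdet (portMatrix W K⁻¹) * rdet K
        ≈⟨ forestFormula W (≡.sym (ℕₚ.+-identityʳ r)) K⁻¹ K⁻¹K≈1 ⟩
      (∑𝓕 (suc r) λ F F∈ → rdet (row (compOf F∈) ∘ proj₁ ∘ W) * rdet (row (compOf F∈) ∘ proj₂ ∘ W) * w F)
        ≈⟨ sumOver-cong (spanningForest? G (suc r)) (λ F F∈ → *-congʳ (trans (*-comm _ _)
             (*-cong (sym (χ-rows F∈ A ∣A∣≡r)) (sym (χ-rows F∈ B ∣B∣≡r))))) ⟩
      (∑𝓕 (suc r) λ F F∈ → χ F∈ A ∣A∣≡r * χ F∈ B ∣B∣≡r * w F) ∎
      where
      W : Vector (Item {suc n} 0 × Item {suc n} 0) r
      -- `portMatrix` takes its rows from the second items and its columns from the first ones;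
      -- therefore `A` stands second.
      W i = plain (P (enum B ∣B∣≡r i)) , plain (P (enum A ∣A∣≡r i))

    -- The minor with all ports. Its coefficients are squares of signs or of 0, so they single out
    -- the forests over which `P` becomes a spanning tree.
    det-Z : rdet (Z K⁻¹) * τ ≈ Φ
    det-Z = begin
      rdet (Z K⁻¹) * τ
        ≈⟨ *-congʳ (trans (rdet-cong λ i j → reflexive (≡.sym (≡.cong₂ (Z K⁻¹) (enum-⊤ ∣⊤∣≡q i) (enum-⊤ ∣⊤∣≡q j)))) (sym (det≈rdet _))) ⟩
      det (Z K⁻¹ [ enum ⊤ ∣⊤∣≡q , enum ⊤ ∣⊤∣≡q ]) * τ
        ≈⟨ det-Z-minor ⊤ ⊤ ∣⊤∣≡q ∣⊤∣≡q ⟩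
      (∑𝓕 (suc q) λ F F∈ → χ F∈ ⊤ ∣⊤∣≡q * χ F∈ ⊤ ∣⊤∣≡q * w F)
        ≈⟨ sumOver-cong (spanningForest? G (suc q)) (λ F F∈ → trans
             (*-congʳ (*-cong (χ-elements F∈ ⊤ ∣⊤∣≡q) (χ-elements F∈ ⊤ ∣⊤∣≡q)))
             (rdet-tree-square (H F∈) ⊤ (spanningTree? (H F∈) ⊤) (w F))) ⟩
      Φ ∎
      where
      ∣⊤∣≡q = ∣⊤∣≡n q

    -- The determinant with tails from E_I and E_J is reduced twice. Eliminating `K` leaves a block
    -- matrix with `Z` in the lower corner; eliminating `Z` leaves E_Iᵀ 𝓛 E_J, the wanted minor. The
    -- factors split off are det Z and det K, whose product is `Φ` by `det-Z` and `rdet-K`.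
    det-𝓛-minor : (𝓛 : Matrix q q) → (∀ i j → ∑ (λ t → 𝓛 i t * Z K⁻¹ t j) ≈ identity i j) →
      ∀ {k r} (r+k≡q : r ℕ.+ k ≡ q) (I J : Subset q) (∣I∣≡k : ∣ I ∣ ≡ k) (∣J∣≡k : ∣ J ∣ ≡ k) →
      det (𝓛 [ enum I ∣I∣≡k , enum J ∣J∣≡k ]) * Φ ≈
      ∑𝓕 (suc r) λ F F∈ → χ̂ F∈ r+k≡q I ∣I∣≡k * χ̂ F∈ r+k≡q J ∣J∣≡k * w F
    det-𝓛-minor 𝓛 𝓛Z≈1 {k} {r} r+k≡q I J ∣I∣≡k ∣J∣≡k = begin
      det (𝓛 [ enum I ∣I∣≡k , enum J ∣J∣≡k ]) * Φ
        ≈⟨ *-cong (det≈rdet _) (trans (sym det-Z) (*-cong (rdet-cong (Z-inc K⁻¹)) (sym rdet-K))) ⟩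
      rdet (λ a b → 𝓛 (enum I ∣I∣≡k a) (enum J ∣J∣≡k b)) * (rdet (portMatrix W K⁻¹) * rdet K)
        ≈⟨ *-assoc _ _ _ ⟨
      rdet (λ a b → 𝓛 (enum I ∣I∣≡k a) (enum J ∣J∣≡k b)) * rdet (portMatrix W K⁻¹) * rdet K
        ≈⟨ *-congʳ (*-congʳ (rdet-cong select)) ⟨
      rdet (λ a b → 0# - ∑ λ t → ∑ (λ s → L a s * 𝓛 s t) * - L′ b t) * rdet (portMatrix W K⁻¹) * rdet K
        ≈⟨ *-congʳ (rdet-schur 𝟎 L (λ t b → - L′ b t) (portMatrix W K⁻¹) 𝓛 (λ i j →
             trans (∑-cong λ t → *-congˡ {𝓛 i t} (sym (Z-inc K⁻¹ t j))) (𝓛Z≈1 i j))) ⟨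
      rdet (block 𝟎 L (λ t b → - L′ b t) (portMatrix W K⁻¹)) * rdet K
        ≈⟨ forestFormula W (≡.sym r+k≡q) K⁻¹ K⁻¹K≈1 ⟩
      (∑𝓕 (suc r) λ F F∈ → rdet (row (compOf F∈) ∘ proj₁ ∘ W) * rdet (row (compOf F∈) ∘ proj₂ ∘ W) * w F)
        ≈⟨ sumOver-cong (spanningForest? G (suc r)) (λ F F∈ → *-congʳ
             (*-cong (sym (χ̂-rows F∈ r+k≡q I ∣I∣≡k)) (sym (χ̂-rows F∈ r+k≡q J ∣J∣≡k)))) ⟩
      (∑𝓕 (suc r) λ F F∈ → χ̂ F∈ r+k≡q I ∣I∣≡k * χ̂ F∈ r+k≡q J ∣J∣≡k * w F) ∎
      where
      L L′ : Matrix k q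
      L  a p = identity p (enum I ∣I∣≡k a)
      L′ b p = identity p (enum J ∣J∣≡k b)
      W : Vector (Item {suc n} k × Item {suc n} k) q
      W p = (P p , λ a → L a p) , (P p , λ b → L′ b p)
      select : ∀ a b → 0# - ∑ (λ t → ∑ (λ s → L a s * 𝓛 s t) * - L′ b t) ≈ 𝓛 (enum I ∣I∣≡k a) (enum J ∣J∣≡k b)
      select a b = begin
        0# - ∑ (λ t → ∑ (λ s → L a s * 𝓛 s t) * - L′ b t)
          ≈⟨ +-identityˡ _ ⟩
        - ∑ (λ t → ∑ (λ s → L a s * 𝓛 s t) * - L′ b t)
          ≈⟨ -‿cong (trans (∑-cong λ t → sym (-‿distribʳ-* _ _)) (∑-neg _)) ⟩
        - - ∑ (λ t → ∑ (λ s → L a s * 𝓛 s t) * L′ b t)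
          ≈⟨ -‿involutive _ ⟩
        ∑ (λ t → ∑ (λ s → L a s * 𝓛 s t) * L′ b t)
          ≈⟨ ∑-identityʳ _ (enum J ∣J∣≡k b) ⟩
        ∑ (λ s → L a s * 𝓛 s (enum J ∣J∣≡k b))
          ≈⟨ trans (∑-cong λ s → *-comm _ _) (∑-identityʳ (λ s → 𝓛 s (enum J ∣J∣≡k b)) (enum I ∣I∣≡k a)) ⟩
        𝓛 (enum I ∣I∣≡k a) (enum J ∣J∣≡k b) ∎

-- Completing the ports to a spanning tree by physical edges.

module Complement {a ℓ} (R : CommutativeRing a ℓ) {n m q : ℕ}
  (G : Multigraph (suc n) m) (g : Fin (suc n)) (P : Multigraph (suc n) q) where

  open CommutativeRing R hiding (zero)
  open LinearAlgebra R
  open Determinant R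
  open Block R
  open CauchyBinet R
  open Incidence R
  open import Relation.Binary.Reasoning.Setoid setoid

  ports : Vector (Item {suc n} 0) q
  ports p = plain (P p)

  private
    rdet-++-cast : ∀ {b} {B : Set b} {k k′ p l} (f : B → Vector Carrier l) (k≡k′ : k ≡ k′) (U : Vector B k) (U′ : Vector B k′) (V : Vector B p) →
      (∀ i → U i ≡ U′ (cast k≡k′ i)) → rdet (f ∘ (U ++ V)) ≈ rdet (f ∘ (U′ ++ V))
    rdet-++-cast {k = k} f ≡.refl U U′ V h = rdet-≗ λ i → ≡.cong f (eq i)
      where
      eq : ∀ i → (U ++ V) i ≡ (U′ ++ V) i
      eq i with splitAt k i
      ... | inj₁ i = ≡.trans (h i) (≡.cong U′ (cast-is-id ≡.refl i))
      ... | inj₂ i = ≡.refl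

    isSign-unscale : ∀ {e x} → IsSign e → IsSign (e * x) → IsSign x
    isSign-unscale {e} {x} e± ex± = isSign-resp
      (trans (sym (*-assoc _ _ _)) (trans (*-congʳ (isSign-square e±)) (*-identityˡ x))) (isSign-* e± ex±)

  -- The determinant is a sign because F, found greedily, completes P to a spanning tree.
  completion : Connected G ⊤ → Acyclic P ⊤ → ∃ λ F → IsSign (rdet (row (groundLabel g) ∘ forestRows (reduceGround g G F) ports))
  completion conn acyc with Reduction.status ρ
    where ρ = reduceGround g P ⊤
  ... | inj₂ (cyclic , _) = contradiction (λ {u} → acyc {u}) cyclic
  ... | inj₁ (_ , c) = forest , isSign-unscale (proj₁ (proj₂ swapped)) (isSign-resp (sym scaled)
      (isSign-* (proj₁ (proj₂ chain₁)) (isSign-* (proj₁ (proj₂ chain₂)) (inj₁ rank-zero))))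
    where
    open Reduction (reduceGround g P ⊤) using (comp; isComponentMap)
    open Extension (greedy comp (proj₁ isComponentMap) G)
    ℓ₀ = groundLabel g
    edgesP = edgeList P ⊤
    edgesG = edgeList G forest
    rowsG : Vector (Item 0) ∣ forest ∣
    rowsG = plain ∘ G ∘ elements forest
    rowsG′ : Vector (Item 0) ∣ forest ∣
    rowsG′ = plain ∘ Vec.lookup edgesG
    chain₁ = rdet-chain {k = 0} c
    chain₂ = rdet-chain {k = 0} chain
    swapped = rdet-permuteRows (+-swap q ∣ forest ∣)
    -- When the ports and the greedy edges are contracted, connectedness of `G` leaves a single
    -- class, hence an empty matrix.
    rank-zero : rdet (row label ∘ []) ≈ 1#
    rank-zero = empty (connected⇒rank-zero conn label surjective maximal) _
      where
      empty : ∀ {r} → r ≡ 0 → (A : Matrix 0 (r ℕ.+ 0)) → rdet A ≈ 1#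
      empty ≡.refl A = rdet-empty A
    -- `forestRows` lists the physical edges before the ports, but the greedy choice presupposes
    -- that the ports are contracted first. The two blocks are swapped at the cost of a sign.
    scaled : proj₁ swapped * rdet (row ℓ₀ ∘ forestRows (reduceGround g G forest) ports)
             ≈ proj₁ chain₁ * (proj₁ chain₂ * rdet (row label ∘ []))
    scaled = begin
      proj₁ swapped * rdet (row ℓ₀ ∘ (rowsG ++ ports))
        ≈⟨ proj₂ (proj₂ swapped) _ ⟨
      rdet (row ℓ₀ ∘ (rowsG ++ ports) ∘ (+-swap q ∣ forest ∣ ⟨$⟩ʳ_))
        ≈⟨ rdet-≗ (λ i → ≡.cong (row ℓ₀) (++-swap rowsG ports i)) ⟩
      rdet (row ℓ₀ ∘ (ports ++ rowsG))
        ≈⟨ rdet-++-cast (row ℓ₀) (≡.sym (∣⊤∣≡n q)) ports (plain ∘ Vec.lookup edgesP) rowsG (λ i → ≡.sym (port i)) ⟩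
      rdet (row ℓ₀ ∘ ((plain ∘ Vec.lookup edgesP) ++ rowsG))
        ≈⟨ proj₂ (proj₂ chain₁) rowsG ⟩
      proj₁ chain₁ * rdet (row comp ∘ rowsG)
        ≈⟨ *-congˡ (trans (rdet-≗ λ i → ≡.cong (row comp ∘ plain) (≡.sym (lookup-edgeList G forest i))) (rdet-++[] (row comp ∘ rowsG′))) ⟩
      proj₁ chain₁ * rdet ((row comp ∘ rowsG′) ++ [])
        ≈⟨ *-congˡ (trans (rdet-≗ λ i → ≡.sym (≡.trans (++-map (row comp) rowsG′ [] i) (noRows i))) (proj₂ (proj₂ chain₂) [])) ⟩
      proj₁ chain₁ * (proj₁ chain₂ * rdet (row label ∘ [])) ∎
      where
      noRows : ∀ i → ((row comp ∘ rowsG′) ++ (row comp ∘ [])) i ≡ ((row comp ∘ rowsG′) ++ []) i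
      noRows i with splitAt ∣ forest ∣ i
      ... | inj₁ _ = ≡.refl
      port : ∀ i → plain (Vec.lookup edgesP (cast (≡.sym (∣⊤∣≡n q)) i)) ≡ ports i
      port i = ≡.trans (≡.cong plain (≡.trans (lookup-edgeList P ⊤ _) (≡.cong P (enum-⊤ (∣⊤∣≡n q) i)))) ≡.refl

open Real using (ℝ; ℝ-commutativeRing; _<ᴿ_; recip)

private
  module R = CommutativeRing ℝ-commutativeRing

open R using (0#; 1#) renaming (_≈_ to _≈ᴿ_; _*_ to _*ᴿ_; _+_ to _+ᴿ_)

-- Positivity of products and subset sums of reals.

module Positivity where

  open Real.ℝ
  open Real._≈_
  open LinearAlgebra ℝ-commutativeRing
  open import Algebra.Properties.CommutativeMonoid.Sum R.*-commutativeMonoid using () renaming (sum to product)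

  private
    x-0 : ∀ x → x ℚ.- 0ℚ ≡ x
    x-0 = ℚₚ.+-identityʳ

  0<1 : 0# <ᴿ 1#
  0<1 = ½ , toWitness {a? = 0ℚ ℚₚ.<? ½} tt , 0 , λ _ _ → toWitness {a? = ½ ℚₚ.<? 1ℚ ℚ.- 0ℚ} tt

  0≮0 : ¬ 0# <ᴿ 0#
  0≮0 (δ , δ>0 , N , h) = ℚₚ.<-asym δ>0 (h N ℕₚ.≤-refl)

  -- If `x` stays above `δ` and `y` eventually stays within half of `δ` of it, then `y` keeps the
  -- other half as its margin.
  pos-resp-≈ : ∀ {x y} → x ≈ᴿ y → 0# <ᴿ x → 0# <ᴿ y
  pos-resp-≈ {x} {y} x≈y (δ , δ>0 , M , below) =
    let ε>0 = ℚₚ.*-monoʳ-<-pos ½ δ>0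
        N , h = close x≈y (½ ℚ.* δ) ε>0
    in ½ ℚ.* δ , ε>0 , M ⊔ N , λ n le → bound (seq x n) (seq y n)
         (below n (ℕₚ.≤-trans (ℕₚ.m≤m⊔n M N) le)) (h n (ℕₚ.≤-trans (ℕₚ.m≤n⊔m M N) le))
    where
    open +-*-Solver using (solve; _:+_; _:-_; _:=_)
    bound : ∀ a b → δ ℚ.< a ℚ.- 0ℚ → ℚ.∣ a ℚ.- b ∣ ℚ.< ½ ℚ.* δ → ½ ℚ.* δ ℚ.< b ℚ.- 0ℚ
    bound a b δ<a near = ℚₚ.≰⇒> λ b≤ → ℚₚ.<-irrefl ≡.refl (ℚₚ.<-trans δ<a (≡.subst₂ ℚ._<_
      (solve 3 (λ a b z → (a :- b) :+ (b :- z) := a :- z) ≡.refl a b 0ℚ)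
      (≡.trans (≡.sym (ℚₚ.*-distribʳ-+ δ ½ ½)) (ℚₚ.*-identityˡ δ))
      (ℚₚ.+-mono-<-≤ (ℚₚ.≤-<-trans (p≤∣p∣ (a ℚ.- b)) near) b≤)))
      where
      p≤∣p∣ : ∀ p → p ℚ.≤ ℚ.∣ p ∣
      p≤∣p∣ p with ℚₚ.≤-total 0ℚ p
      ... | inj₁ 0≤p = ℚₚ.≤-reflexive (≡.sym (ℚₚ.0≤p⇒∣p∣≡p 0≤p))
      ... | inj₂ p≤0 = ℚₚ.≤-trans p≤0 (ℚₚ.0≤∣p∣ p)

  opaque
    unfolding Real._+ᴿ_ Real._*ᴿ_

    pos-+ : ∀ {x y} → 0# <ᴿ x → 0# <ᴿ y → 0# <ᴿ (x +ᴿ y)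
    pos-+ {x} {y} (δ , δ>0 , M , g) (η , η>0 , N , h) = δ ℚ.+ η , ℚₚ.+-mono-< δ>0 η>0 , M ⊔ N , λ n le →
      ≡.subst (δ ℚ.+ η ℚ.<_) (≡.trans (≡.cong₂ ℚ._+_ (x-0 (seq x n)) (x-0 (seq y n))) (≡.sym (x-0 _)))
        (ℚₚ.+-mono-< (g n (ℕₚ.≤-trans (ℕₚ.m≤m⊔n M N) le)) (h n (ℕₚ.≤-trans (ℕₚ.m≤n⊔m M N) le)))

    pos-* : ∀ {x y} → 0# <ᴿ x → 0# <ᴿ y → 0# <ᴿ (x *ᴿ y)
    pos-* {x} {y} (δ , δ>0 , M , g) (η , η>0 , N , h) =
      δ ℚ.* η , ℚₚ.positive⁻¹ (δ ℚ.* η) {{ℚₚ.pos*pos⇒pos δ {{ℚ.positive δ>0}} η {{ℚ.positive η>0}}}} , M ⊔ N , λ n le →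
      let δ<x = ≡.subst (δ ℚ.<_) (x-0 (seq x n)) (g n (ℕₚ.≤-trans (ℕₚ.m≤m⊔n M N) le))
          η<y = ≡.subst (η ℚ.<_) (x-0 (seq y n)) (h n (ℕₚ.≤-trans (ℕₚ.m≤n⊔m M N) le))
      in ≡.subst (δ ℚ.* η ℚ.<_) (≡.sym (x-0 _)) (ℚₚ.<-trans
           (ℚₚ.*-monoˡ-<-pos η {{ℚ.positive η>0}} δ<x)
           (ℚₚ.*-monoʳ-<-pos (seq x n) {{ℚ.positive (ℚₚ.<-trans δ>0 δ<x)}} η<y))

  1≉0 : ¬ 1# ≈ᴿ 0#
  1≉0 1≈0 = 0≮0 (pos-resp-≈ 1≈0 0<1)

  product-pos : ∀ {n} (f : Fin n → ℝ) → (∀ i → 0# <ᴿ f i) → 0# <ᴿ product f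
  product-pos {zero}  f h = 0<1
  product-pos {suc n} f h = pos-* (h zero) (product-pos (f ∘ suc) (h ∘ suc))

  -- Stronger than being nonnegative: the alternative is decided. For the summands here it follows
  -- from a decidable condition on `F`, and it passes to sums, where one positive summand settles
  -- the sign.
  PosOrZero : ℝ → Set
  PosOrZero x = 0# <ᴿ x ⊎ x ≈ᴿ 0#

  posOrZero-+ : ∀ {x y} → PosOrZero x → PosOrZero y → PosOrZero (x +ᴿ y)
  posOrZero-+ (inj₁ p) (inj₁ q) = inj₁ (pos-+ p q)
  posOrZero-+ (inj₁ p) (inj₂ q) = inj₁ (pos-resp-≈ (R.sym (R.trans (R.+-congˡ q) (R.+-identityʳ _))) p)
  posOrZero-+ (inj₂ p) (inj₁ q) = inj₁ (pos-resp-≈ (R.sym (R.trans (R.+-congʳ p) (R.+-identityˡ _))) q)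
  posOrZero-+ (inj₂ p) (inj₂ q) = inj₂ (R.trans (R.+-cong p q) (R.+-identityˡ _))

  sum-posOrZero : ∀ {m} (f : Subset m → ℝ) → (∀ F → PosOrZero (f F)) → PosOrZero (sumOverSubsets f)
  sum-posOrZero {zero}  f h = h Vec.[]
  sum-posOrZero {suc m} f h = posOrZero-+ (sum-posOrZero _ (h ∘ (inside Vec.∷_))) (sum-posOrZero _ (h ∘ (outside Vec.∷_)))

  pos-+-posOrZero : ∀ {x y} → 0# <ᴿ x → PosOrZero y → 0# <ᴿ (x +ᴿ y)
  pos-+-posOrZero p (inj₁ q) = pos-+ p q
  pos-+-posOrZero p (inj₂ q) = pos-resp-≈ (R.sym (R.trans (R.+-congˡ q) (R.+-identityʳ _))) p

  sum-pos : ∀ {m} (f : Subset m → ℝ) → (∀ F → PosOrZero (f F)) → ∀ F → 0# <ᴿ f F → 0# <ᴿ sumOverSubsets f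
  sum-pos {zero}  f h Vec.[] p = p
  sum-pos {suc m} f h (true  Vec.∷ F) p = pos-+-posOrZero
    (sum-pos _ (h ∘ (inside Vec.∷_)) F p) (sum-posOrZero _ (h ∘ (outside Vec.∷_)))
  sum-pos {suc m} f h (false Vec.∷ F) p = pos-resp-≈ (R.+-comm _ _) (pos-+-posOrZero
    (sum-pos _ (h ∘ (outside Vec.∷_)) F p) (sum-posOrZero _ (h ∘ (inside Vec.∷_))))

-- Inverting `τ` and `Φ` over the reals, and the values of the coefficients.

module Ports {n m q : ℕ} (G : Multigraph (suc n) m) (simple : Simple G) (conn : Connected G ⊤)
  (c : Fin m → ℝ) (c>0 : ∀ e → 0# <ᴿ c e) (g : Fin (suc n)) (P : Multigraph (suc n) q) (acyc : Acyclic P ⊤)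
  (order : ∀ {r} F → IsSpanningForest G (suc r) F → ComponentOrder G g F r) where

  open LinearAlgebra ℝ-commutativeRing
  open Determinant ℝ-commutativeRing
  open Block ℝ-commutativeRing
  open CauchyBinet ℝ-commutativeRing
  open Incidence ℝ-commutativeRing
  open Trees ℝ-commutativeRing
  open Network ℝ-commutativeRing G c g P order
  open Transfer ℝ-commutativeRing G simple c g P order
  open Positivity
  open import Algebra.Properties.Ring R.ring using (-‿involutive; -0#≈0#)

  isSign≉0 : ∀ {x} → IsSign x → ¬ x ≈ᴿ 0#
  isSign≉0 (inj₁ x≈1)  x≈0 = 1≉0 (R.trans (R.sym x≈1) x≈0)
  isSign≉0 (inj₂ x≈-1) x≈0 = 1≉0 (R.trans (R.sym (-‿involutive 1#))
    (R.trans (R.-‿cong (R.trans (R.sym x≈-1) x≈0)) -0#≈0#))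

  w>0 : ∀ F → 0# <ᴿ w F
  w>0 F = product-pos _ (λ e → choose (Vec.lookup F e) e)
    where
    choose : ∀ b e → 0# <ᴿ (if b then c e else 1#)
    choose true  e = c>0 e
    choose false e = 0<1

  χ-⊤ : ∀ {F} (F∈ : F ∈𝓕 suc q) → let open Complement ℝ-commutativeRing G g P in
    rdet (row (compOf F∈) ∘ ports) ≈ᴿ rdet (λ i → inc id (H F∈ (elements ⊤ i)))
  χ-⊤ F∈ = R.trans (rdet-≗ λ i → ≡.cong (λ p → row (compOf F∈) (plain (P p))) (≡.sym (enum-⊤ (∣⊤∣≡n q) i)))
    (R.trans (R.sym (χ-rows F∈ ⊤ (∣⊤∣≡n q))) (χ-elements F∈ ⊤ (∣⊤∣≡n q)))

  -- The subset supplied by `completion` has a determinant equal to a sign. If it were not a forest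
  -- with q + 1 components, or if `P` were not a spanning tree of its quotient, that determinant
  -- would be 0. So it contributes its positive weight.
  Φ>0 : 0# <ᴿ Φ
  Φ>0 = let F₀ , sign = completion conn acyc in
    sum-pos _ (λ F → term F (spanningForest? G (suc q) F)) F₀ (term₀ (isSign≉0 sign) (spanningForest? G (suc q) F₀))
    where
    open Complement ℝ-commutativeRing G g P
    value : ∀ F → F ∈𝓕 suc q → ℝ
    value F F∈ = if does (spanningTree? (H F∈) ⊤) then w F else 0#
    branch : ∀ F {A : Set} (d : Dec A) → PosOrZero (if does d then w F else 0#)
    branch F (yes _) = inj₁ (w>0 F)
    branch F (no _)  = inj₂ R.refl
    term : ∀ F (d : Dec (F ∈𝓕 suc q)) → PosOrZero (withProof d (value F))
    term F (yes F∈) = branch F (spanningTree? (H F∈) ⊤)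
    term F (no _)   = inj₂ R.refl
    completes : Subset m → ℝ
    completes F = rdet (row (groundLabel g) ∘ forestRows (reduceGround g G F) ports)
    branch₀ : ∀ {F} → ¬ completes F ≈ᴿ 0# → (F∈ : F ∈𝓕 suc q) (d : Dec (IsSpanningTree (H F∈) ⊤)) → 0# <ᴿ (if does d then w F else 0#)
    branch₀ {F} nonzero F∈ (yes _) = w>0 F
    branch₀ {F} nonzero F∈ (no ¬t) = contradiction vanishes nonzero
      where
      open ComponentOrder (order F F∈) using (isComponentMap; ground)
      vanishes : completes F ≈ᴿ 0#
      vanishes with e , _ , h ← rdet-forest (reduceGround g G F) {0} (proj₁ F∈) isComponentMap ground =
        R.trans (h ports) (R.trans (R.*-congˡ (R.trans (χ-⊤ F∈) (rdet-nontree (H F∈) ⊤ ¬t))) (R.zeroʳ e))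
    term₀ : ∀ {F} → ¬ completes F ≈ᴿ 0# → (d : Dec (F ∈𝓕 suc q)) → 0# <ᴿ withProof d (value F)
    term₀ nonzero (yes F∈) = branch₀ nonzero F∈ (spanningTree? (H F∈) ⊤)
    term₀ {F} nonzero (no F∉) = contradiction (rdet-nonforest (reduceGround g G F) F∉ (≡.sym (ℕₚ.+-identityʳ q)) ports) nonzero

  -- The same completion, run without ports, yields a spanning tree of `G` itself.
  τ>0 : 0# <ᴿ τ
  τ>0 = let F₀ , sign = completion conn noPorts-acyclic in
    sum-pos _ (λ F → term F (spanningTree? G F)) F₀ (term₀ sign (spanningTree? G F₀))
    where
    noPorts : Multigraph (suc n) 0
    noPorts ()
    noPorts-acyclic : Acyclic noPorts ⊤
    noPorts-acyclic ε (ne , _) = ne ≡.refl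
    noPorts-acyclic ((() , _) ◅ _) _
    open Complement ℝ-commutativeRing G g noPorts
    term : ∀ F (d : Dec (IsSpanningTree G F)) → PosOrZero (withProof d λ _ → w F)
    term F (yes _) = inj₁ (w>0 F)
    term F (no _)  = inj₂ R.refl
    term₀ : ∀ {F} → IsSign (rdet (row (groundLabel g) ∘ forestRows (reduceGround g G F) ports)) →
      (d : Dec (IsSpanningTree G F)) → 0# <ᴿ withProof d λ _ → w F
    term₀ {F} sign (yes _) = w>0 F
    term₀ {F} sign (no ¬t) = contradiction (rdet-nonforest (reduceGround g G F) (¬t ∘ forest⇒tree) ≡.refl ports) (isSign≉0 sign)

  Is0or±1-* : ∀ {x y} → Is0or±1 x → Is0or±1 y → Is0or±1 (x *ᴿ y)
  Is0or±1-* (inj₁ x≈0) _          = inj₁ (R.trans (R.*-congʳ x≈0) (R.zeroˡ _))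
  Is0or±1-* (inj₂ _)   (inj₁ y≈0) = inj₁ (R.trans (R.*-congˡ y≈0) (R.zeroʳ _))
  Is0or±1-* (inj₂ x±)  (inj₂ y±)  = inj₂ (isSign-* x± y±)

  Is0or±1-tree : ∀ {r} (H : Multigraph (suc r) q) S → Is0or±1 (rdet λ i → inc id (H (elements S i)))
  Is0or±1-tree H S with spanningTree? H S
  ... | yes t = inj₂ (rdet-tree H S t)
  ... | no ¬t = inj₁ (rdet-nontree H S ¬t)

  Is0or±1-resp : ∀ {x y} → x ≈ᴿ y → Is0or±1 x → Is0or±1 y
  Is0or±1-resp x≈y = Sum.map (R.trans (R.sym x≈y)) (isSign-resp x≈y)

  χ-values : ∀ {r F} (F∈ : F ∈𝓕 suc r) A (∣A∣≡r : ∣ A ∣ ≡ r) → Is0or±1 (χ F∈ A ∣A∣≡r)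
  χ-values F∈ A ∣A∣≡r = Is0or±1-resp (R.sym (χ-elements F∈ A ∣A∣≡r)) (Is0or±1-tree (H F∈) A)

  χ̂-values : ∀ {k r F} (F∈ : F ∈𝓕 suc r) (r+k≡q : r ℕ.+ k ≡ q) I (∣I∣≡k : ∣ I ∣ ≡ k) → Is0or±1 (χ̂ F∈ r+k≡q I ∣I∣≡k)
  χ̂-values F∈ r+k≡q I ∣I∣≡k with e , e± , eq ← χ̂-complement F∈ r+k≡q I ∣I∣≡k =
    Is0or±1-resp (R.sym eq) (Is0or±1-* (inj₂ e±) (Is0or±1-tree (H F∈) (∁ I)))

  -- By `χ̂-complement` the value is a sign times the determinant of the complementary ports in the
  -- quotient. Since being a spanning tree is decidable, a tree can be obtained from the mere
  -- negation.
  χ̂-nonzero : ∀ {k r F} (F∈ : F ∈𝓕 suc r) (r+k≡q : r ℕ.+ k ≡ q) I (∣I∣≡k : ∣ I ∣ ≡ k) →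
    (¬ χ̂ F∈ r+k≡q I ∣I∣≡k ≈ᴿ 0#) ⇔ IsSpanningTree (H F∈) (∁ I)
  χ̂-nonzero F∈ r+k≡q I ∣I∣≡k with e , e± , eq ← χ̂-complement F∈ r+k≡q I ∣I∣≡k = mk⇔
    (λ χ̂≉0 → decided χ̂≉0 (spanningTree? (H F∈) (∁ I)))
    (λ t → isSign≉0 (isSign-resp (R.sym eq) (isSign-* e± (rdet-tree (H F∈) (∁ I) t))))
    where
    decided : ¬ χ̂ F∈ r+k≡q I ∣I∣≡k ≈ᴿ 0# → Dec (IsSpanningTree (H F∈) (∁ I)) → IsSpanningTree (H F∈) (∁ I)
    decided χ̂≉0 (yes t) = t
    decided χ̂≉0 (no ¬t) = contradiction (R.trans eq (R.trans (R.*-congˡ (rdet-nontree (H F∈) (∁ I) ¬t)) (R.zeroʳ e))) χ̂≉0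

  solveFor : ∀ {x y s} (y>0 : 0# <ᴿ y) → x *ᴿ y ≈ᴿ s → x ≈ᴿ recip y y>0 *ᴿ s
  solveFor {x} {y} {s} y>0 xy≈s = begin
    x                          ≈⟨ R.*-identityʳ x ⟨
    x *ᴿ 1#                    ≈⟨ R.*-congˡ (Real.*-recip y y>0) ⟨
    x *ᴿ (y *ᴿ recip y y>0)    ≈⟨ R.*-assoc _ _ _ ⟨
    (x *ᴿ y) *ᴿ recip y y>0    ≈⟨ R.*-congʳ xy≈s ⟩
    s *ᴿ recip y y>0           ≈⟨ R.*-comm _ _ ⟩
    recip y y>0 *ᴿ s           ∎
    where
    open import Relation.Binary.Reasoning.Setoid R.setoid

  isInverse : ∀ {k} {M N : Matrix k k} → (∀ i j → ∑ (λ t → M i t *ᴿ N t j) ≈ᴿ identity i j) →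
    (∀ i j → ∑ (λ t → N i t *ᴿ M t j) ≈ᴿ identity i j) → IsInverse M N
  isInverse h h′ = (λ i j → R.trans (R.sym (∑≈sum _)) (h i j)) , (λ i j → R.trans (R.sym (∑≈sum _)) (h′ i j))

  K-inverse : ∃ λ (K⁻¹ : Matrix n n) → (∀ i j → ∑ (λ t → K i t *ᴿ K⁻¹ t j) ≈ᴿ identity i j)
                                     × (∀ i j → ∑ (λ t → K⁻¹ i t *ᴿ K t j) ≈ᴿ identity i j)
  K-inverse = inverse K (recip τ τ>0) (R.trans (R.*-congʳ rdet-K) (Real.*-recip τ τ>0))

  module _ (K⁻¹ : Matrix n n) (K⁻¹K≈1 : ∀ i j → ∑ (λ t → K⁻¹ i t *ᴿ K t j) ≈ᴿ identity i j) where

    Z-inverse : ∃ λ (𝓛 : Matrix q q) → (∀ i j → ∑ (λ t → Z K⁻¹ i t *ᴿ 𝓛 t j) ≈ᴿ identity i j)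
                                     × (∀ i j → ∑ (λ t → 𝓛 i t *ᴿ Z K⁻¹ t j) ≈ᴿ identity i j)
    -- By `det-Z` the determinant is `Φ` divided by `τ`; its inverse is the reciprocal quotient.
    Z-inverse = inverse (Z K⁻¹) (τ *ᴿ recip Φ Φ>0)
      (R.trans (R.sym (R.*-assoc _ _ _)) (R.trans (R.*-congʳ (det-Z K⁻¹ K⁻¹K≈1)) (Real.*-recip Φ Φ>0)))

  portMinors : ∃ λ (K⁻¹ : Matrix n n) → IsInverse K K⁻¹ ×
    (Σ (0# <ᴿ τ) λ τ>0 →
      ∀ {r} (A B : Subset q) (∣A∣≡r : ∣ A ∣ ≡ r) (∣B∣≡r : ∣ B ∣ ≡ r) →
      det (Z K⁻¹ [ enum A ∣A∣≡r , enum B ∣B∣≡r ]) ≈ᴿ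
      recip τ τ>0 *ᴿ ∑𝓕 (suc r) λ F F∈ → χ F∈ A ∣A∣≡r *ᴿ χ F∈ B ∣B∣≡r *ᴿ w F) ×
    (∃ λ (𝓛 : Matrix q q) → IsInverse (Z K⁻¹) 𝓛 ×
      (Σ (0# <ᴿ Φ) λ Φ>0 →
        ∀ {k r} (r+k≡q : r ℕ.+ k ≡ q) (I J : Subset q) (∣I∣≡k : ∣ I ∣ ≡ k) (∣J∣≡k : ∣ J ∣ ≡ k) →
        det (𝓛 [ enum I ∣I∣≡k , enum J ∣J∣≡k ]) ≈ᴿ
        recip Φ Φ>0 *ᴿ ∑𝓕 (suc r) λ F F∈ → χ̂ F∈ r+k≡q I ∣I∣≡k *ᴿ χ̂ F∈ r+k≡q J ∣J∣≡k *ᴿ w F))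
  portMinors =
    let K⁻¹ , KK⁻¹≈1 , K⁻¹K≈1 = K-inverse
        𝓛 , Z𝓛≈1 , 𝓛Z≈1 = Z-inverse K⁻¹ K⁻¹K≈1
    in K⁻¹ , isInverse KK⁻¹≈1 K⁻¹K≈1 ,
       (τ>0 , λ A B ∣A∣≡r ∣B∣≡r → solveFor τ>0 (det-Z-minor K⁻¹ K⁻¹K≈1 A B ∣A∣≡r ∣B∣≡r)) ,
       (𝓛 , isInverse Z𝓛≈1 𝓛Z≈1 ,
        (Φ>0 , λ r+k≡q I J ∣I∣≡k ∣J∣≡k → solveFor Φ>0 (det-𝓛-minor K⁻¹ K⁻¹K≈1 𝓛 𝓛Z≈1 r+k≡q I J ∣I∣≡k ∣J∣≡k)))

open import Data.Nat.Base using (_+_)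
open CommutativeRing ℝ-commutativeRing using (_≈_; _*_)
open LinearAlgebra ℝ-commutativeRing using (Matrix; IsInverse; det; _[_,_]; Is0or±1)

theorem6p1 : ∀ {n m q : ℕ} (G : Multigraph (suc n) m) → Simple G → Connected G ⊤ →
    (c : Fin m → ℝ) → (∀ e → 0# <ᴿ c e) →
    (g : Fin (suc n)) →
    (P : Multigraph (suc n) q) → Acyclic P ⊤ →
    (order : ∀ {r} F → IsSpanningForest G (suc r) F → ComponentOrder G g F r) →
    let open Network ℝ-commutativeRing G c g P order in
    (∃ λ (K⁻¹ : Matrix n n) → IsInverse K K⁻¹ ×
    (Σ (0# <ᴿ τ) λ τ>0 →
    ∀ {r} (A B : Subset q) (∣A∣≡r : ∣ A ∣ ≡ r) (∣B∣≡r : ∣ B ∣ ≡ r) →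
    det (Z K⁻¹ [ enum A ∣A∣≡r , enum B ∣B∣≡r ]) ≈
    recip τ τ>0 * ∑𝓕 (suc r) λ F F∈ → χ F∈ A ∣A∣≡r * χ F∈ B ∣B∣≡r * w F) ×
    (∃ λ (𝓛 : Matrix q q) → IsInverse (Z K⁻¹) 𝓛 ×
    (Σ (0# <ᴿ Φ) λ Φ>0 →
    ∀ {k r} (r+k≡q : r + k ≡ q) (I J : Subset q) (∣I∣≡k : ∣ I ∣ ≡ k) (∣J∣≡k : ∣ J ∣ ≡ k) →
    det (𝓛 [ enum I ∣I∣≡k , enum J ∣J∣≡k ]) ≈
    recip Φ Φ>0 * ∑𝓕 (suc r) λ F F∈ → χ̂ F∈ r+k≡q I ∣I∣≡k * χ̂ F∈ r+k≡q J ∣J∣≡k * w F)))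
    × (∀ {r F} (F∈ : F ∈𝓕 suc r) (A B : Subset q) (∣A∣≡r : ∣ A ∣ ≡ r) (∣B∣≡r : ∣ B ∣ ≡ r) →
    Is0or±1 (χ F∈ A ∣A∣≡r * χ F∈ B ∣B∣≡r))
    × (∀ {k r F} (F∈ : F ∈𝓕 suc r) (r+k≡q : r + k ≡ q) (I J : Subset q)
    (∣I∣≡k : ∣ I ∣ ≡ k) (∣J∣≡k : ∣ J ∣ ≡ k) →
    Is0or±1 (χ̂ F∈ r+k≡q I ∣I∣≡k * χ̂ F∈ r+k≡q J ∣J∣≡k))
    × (∀ {k r F} (F∈ : F ∈𝓕 suc r) (r+k≡q : r + k ≡ q) (I : Subset q) (∣I∣≡k : ∣ I ∣ ≡ k) →
    (¬ (χ̂ F∈ r+k≡q I ∣I∣≡k ≈ 0#)) ⇔ IsSpanningTree (H F∈) (∁ I))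
theorem6p1 G simple conn c c>0 g P acyc order =
  portMinors ,
  (λ F∈ A B ∣A∣≡r ∣B∣≡r → Is0or±1-* (χ-values F∈ A ∣A∣≡r) (χ-values F∈ B ∣B∣≡r)) ,
  (λ F∈ r+k≡q I J ∣I∣≡k ∣J∣≡k → Is0or±1-* (χ̂-values F∈ r+k≡q I ∣I∣≡k) (χ̂-values F∈ r+k≡q J ∣J∣≡k)) ,
  χ̂-nonzero
  where
  open Ports G simple conn c c>0 g P acyc order
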